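{- There exists a universal constant $d_0>0$ such that the following holds for all integers $d\geq d_0$. Let $G$ be a connected $n$-vertex $(1\pm 10^{ -10})d$-regular graph and let $\mathcal{T}$ be a spanning tree of $G$ chosen uniformly at random from the set of all spanning trees of $G$. Then for every $n$-vertex tree $T$, $$\Pr[\mathcal{T}\simeq_{\mathrm{iso}} T]\leq e^{ -n/2000}.$$
   Context: For constants $d,\delta>0$, a graph $G$ is called $(1\pm\delta)d$-regular if every vertex degree of $G$ lies in the interval $[(1-\delta)d,(1+\delta)d]$. The notation $\mathcal{T}\simeq_{\mathrm{iso}} T$ means that $\mathcal{T}$ is isomorphic (as an unlabeled graph) to $T$. -}

module Defs where

open import Data.Nat using (ℕ; zero; suc; _+_; _*_; _∸_; _^_; _≤_; _<_; _!)

open import Data.Bool using (Bool; true; false)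
open import Data.Fin using (Fin; zero; suc; inject₁; fromℕ)
open import Data.Vec using (Vec; lookup; []; _∷_)
open import Data.Product using (Σ; _×_; _,_)
open import Data.List using (List; length)
open import Relation.Binary.PropositionalEquality using (_≡_)
open import Relation.Nullary using (¬_)
open import Function.Bundles using (_↔_; _⇔_; Inverse)

Graph : ℕ → Set
Graph n = Vec (Vec Bool n) n

Adj : ∀ {n} → Graph n → Fin n → Fin n → Set
Adj G i j = lookup (lookup G i) j ≡ true

IsSimple : ∀ {n} → Graph n → Set
IsSimple {n} G = (∀ (i j : Fin n) → Adj G i j → Adj G j i) × (∀ (i : Fin n) → ¬ Adj G i i)

trues : ∀ {m} → Vec Bool m → ℕ
trues [] = 0
trues (true ∷ v) = suc (trues v)
trues (false ∷ v) = trues v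

deg : ∀ {n} → Graph n → Fin n → ℕ
deg G i = trues (lookup G i)

-- (1 ± 10^-10) d - regular :  (1-δ)d ≤ deg v ≤ (1+δ)d with δ = 10^-10,
-- multiplied through by 10^10.
NearlyRegular : ∀ {n} → Graph n → ℕ → Set
NearlyRegular {n} G d = ∀ (v : Fin n) →
  ((10 ^ 10 ∸ 1) * d ≤ (10 ^ 10) * deg G v) × ((10 ^ 10) * deg G v ≤ (10 ^ 10 + 1) * d)

data Reachable {n} (G : Graph n) : Fin n → Fin n → Set where
  here : ∀ {i} → Reachable G i i
  step : ∀ {i j k} → Adj G i j → Reachable G j k → Reachable G i k

Connected : ∀ {n} → Graph n → Set
Connected {n} G = ∀ (i j : Fin n) → Reachable G i j

record Cycle {n} (G : Graph n) : Set where
  field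
    k        : ℕ
    k≥2      : 2 ≤ k
    v        : Fin (suc k) → Fin n
    distinct : ∀ a b → v a ≡ v b → a ≡ b
    path     : ∀ (t : Fin k) → Adj G (v (inject₁ t)) (v (suc t))
    close    : Adj G (v (fromℕ k)) (v zero)

Acyclic : ∀ {n} → Graph n → Set
Acyclic G = ¬ Cycle G

IsTree : ∀ {n} → Graph n → Set
IsTree G = IsSimple G × Connected G × Acyclic G

_⊆G_ : ∀ {n} → Graph n → Graph n → Set
_⊆G_ {n} H G = ∀ (i j : Fin n) → Adj H i j → Adj G i j

IsSpanningTree : ∀ {n} → Graph n → Graph n → Set
IsSpanningTree G H = IsTree H × (H ⊆G G)

Isomorphic : ∀ {n} → Graph n → Graph n → Set
Isomorphic {n} H T = Σ (Fin n ↔ Fin n) λ σ →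
  ∀ (i j : Fin n) → (Adj H (Inverse.to σ i) (Inverse.to σ j) ⇔ Adj T i j)

-- expScaled n K = K! * Σ_{k=0}^{K} n^k / k!   (a natural number)
expScaled : ℕ → ℕ → ℕ
expScaled n zero = 1
expScaled n (suc K) = suc K * expScaled n K + n ^ suc K

-- a / b ≤ e^{-n/2000}  ⇔  a^2000 · e^n ≤ b^2000
--                      ⇔  ∀ K, a^2000 · Σ_{k≤K} n^k/k! ≤ b^2000   (partial sums increase to e^n)
ProbBound : ℕ → ℕ → ℕ → Set
ProbBound n a b = ∀ (K : ℕ) → a ^ 2000 * expScaled n K ≤ b ^ 2000 * (K !)

{-# OPTIONS --safe #-}
-- Compare the number of copies of T in G with the number of all spanning trees.
--
-- Spanning trees.  A self-map f of the vertices with v ~ f v has on average few vertices on cycles of length at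
-- most K (redirecting one arc destroys a cycle), and at most n/K longer cycles.  Cutting one arc per cycle of f
-- and extending the resulting forest to a spanning tree H of G loses little: f is recovered from H, the cut arcs
-- and the edges of H outside the forest.  So there are almost ∏ deg v ≥ mⁿ spanning trees, m ≈ d ≈ D.
--
-- Copies of T.  Root T and let ℓ be the number of its leaves.  If ℓ ≥ n/500, fix the embedding of the other
-- vertices; the leaves form a matching, and Minc's bound ∏ (rᵢ + 1)/2 on permanents saves a factor 2^ℓ over the
-- trivial n Dⁿ.  If ℓ < n/500, the parent function of a copy restricts to a matching between n - ℓ vertices
-- (one child per non-leaf) and the non-leaves, and the same bound saves almost 2ⁿ.
--
-- Either way the 2000-th power of the ratio is at most 4^(-n) ≤ e^(-n).
module Submission where

open import Defs
open import Data.Bool using (Bool; true; false; if_then_else_; not; _∧_; T)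
import Data.Bool.Properties as Boolₚ
open import Data.Nat as ℕ hiding (_≟_)
open import Data.Nat.Properties hiding (_≟_)
open import Data.Nat.GeneralisedArithmetic using (iterate)
open import Data.Fin as Fin using (Fin; zero; suc; toℕ; fromℕ; fromℕ<; inject₁)
import Data.Fin.Properties as Finₚ
open Finₚ using (_≟_)
open import Data.Fin.Relation.Unary.Top using (view; ‵fromℕ; ‵inject₁)
open import Data.Vec as Vec using (Vec; lookup; []; _∷_)
import Data.Vec.Properties as Vecₚ
open import Data.Vec.Functional using (updateAt)
open import Data.Vec.Functional.Properties using (updateAt-updates; updateAt-minimal)
open import Data.Maybe using (Maybe; just; nothing)
import Data.Maybe.Properties as Maybeₚ
open Maybeₚ using (just-injective)
import Data.Product.Properties as Productₚ
import Data.Unit.Properties as Unitₚ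
open import Data.Product using (Σ; ∃; ∃₂; _×_; _,_; proj₁; proj₂)
open import Data.Sum as Sum using (_⊎_; inj₁; inj₂; swap; [_,_]′)
open import Data.Unit using (⊤; tt)
open import Data.List as List using (List; []; _∷_; length; map; filter; _++_; cartesianProductWith; cartesianProduct; allFin; upTo)
open import Data.List.Extrema.Nat using (argmin; argmax; f[argmin]≤f[xs]; f[xs]≤f[argmax])
import Data.List.Properties as Listₚ
open import Data.List.Membership.Propositional using (_∈_)
import Data.List.Membership.Propositional.Properties as ∈ₚ
open import Data.List.Relation.Unary.Any using (here; there)
open import Data.List.Relation.Unary.All as All using (All; []; _∷_)
import Data.List.Relation.Unary.All.Properties as Allₚ
open import Data.List.Relation.Unary.AllPairs using ([]; _∷_)
open import Data.List.Relation.Unary.Unique.Propositional using (Unique)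
import Data.List.Relation.Unary.Unique.Propositional.Properties as Uniqueₚ
open import Function using (_∘_; id; const)
open import Function.Bundles using (_⇔_; mk⇔; Inverse; Equivalence)
open import Relation.Nullary using (¬_; Dec; yes; no; does; contradiction; ¬?)
open import Relation.Nullary.Decidable using (_×-dec_; _⊎-dec_; dec-true; dec-false)
open import Relation.Binary.Definitions using (DecidableEquality; tri<; tri≈; tri>)
open import Relation.Binary.PropositionalEquality hiding ([_])
open import Algebra.Properties.CommutativeMonoid.Sum +-0-commutativeMonoid
  using (sum; sum-cong-≗; ∑-distrib-+)
open import Algebra.Properties.CommutativeMonoid.Sum *-1-commutativeMonoid
  using () renaming (sum to prod; sum-cong-≗ to prod-cong; ∑-distrib-+ to prod-*)
open import Data.Nat.DivMod using (m/n*n≤m; m*n/n≡m; /-monoˡ-≤; m≡m%n+[m/n]*n; m%n<n)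
open import Data.Nat.Solver using (module +-*-Solver)
open +-*-Solver using (solve; _:+_; _:*_; _:=_; con)

-- Storing a cut arc costs a factor of about D, so the number of cut arcs must be small against n /
-- log D. Hence a cycle counts as long only beyond some K that is large against log D, whereas the
-- redirection argument requires K² ≤ m. Both can hold because log d is far below √d; this is what
-- the size of d₀ provides.
--
-- All estimates compare natural numbers, so nothing is ever divided and no root or logarithm is
-- taken: denominators stand on the other side, and whole counts are raised to a fixed power s =
-- 8000. The same s has three roles: it is the exponent, 1/s is the weight in the count of partial
-- vectors, and D / m ≤ 1 + 1/s is the precision demanded of the degrees. Since (1 + 1/s)^s ≤ 4, an
-- error factor 1 + 1/s per vertex becomes a bounded factor per vertex after the s-th power. The
-- exponent is 16 · 500 because the copies of T save 2^n only at the 500-th power, and this saving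
-- has to outweigh the bounded factors.

private variable
  A B E : Set
  n : ℕ

-- Finite sums and products

sum-mono : {f g : Fin n → ℕ} → (∀ i → f i ≤ g i) → sum f ≤ sum g
sum-mono {zero}  h = z≤n
sum-mono {suc n} h = +-mono-≤ (h zero) (sum-mono (h ∘ suc))

prod-mono : {f g : Fin n → ℕ} → (∀ i → f i ≤ g i) → prod f ≤ prod g
prod-mono {zero}  h = ≤-refl
prod-mono {suc n} h = *-mono-≤ (h zero) (prod-mono (h ∘ suc))

prod-const : ∀ n c → prod {n} (λ _ → c) ≡ c ^ n
prod-const zero    c = refl
prod-const (suc n) c = cong (c *_) (prod-const n c)

sum-const : ∀ n c → sum {n} (λ _ → c) ≡ n * c
sum-const zero    c = refl
sum-const (suc n) c = cong (c +_) (sum-const n c)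

sum-*ʳ : (f : Fin n → ℕ) → ∀ c → sum f * c ≡ sum (λ i → f i * c)
sum-*ʳ {zero}  f c = refl
sum-*ʳ {suc n} f c = trans (*-distribʳ-+ c (f zero) _) (cong (f zero * c +_) (sum-*ʳ (f ∘ suc) c))

-- A factor is replaced by 1 instead of being removed, so that the index type stays `Fin n`.
omit : Fin n → (Fin n → ℕ) → Fin n → ℕ
omit i f j = if does (j Finₚ.≟ i) then 1 else f j

prod-omit : (f : Fin n → ℕ) → ∀ i → prod f ≡ f i * prod (omit i f)
prod-omit {suc n} f zero    = cong (f zero *_) (sym (*-identityˡ _))
prod-omit {suc n} f (suc i) = begin
  f zero * prod (f ∘ suc)                             ≡⟨ cong (f zero *_) (prod-omit (f ∘ suc) i) ⟩
  f zero * (f (suc i) * prod (omit i (f ∘ suc)))      ≡⟨ *-assoc (f zero) _ _ ⟨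
  f zero * f (suc i) * prod (omit i (f ∘ suc))        ≡⟨ cong (_* prod (omit i (f ∘ suc))) (*-comm (f zero) _) ⟩
  f (suc i) * f zero * prod (omit i (f ∘ suc))        ≡⟨ *-assoc (f (suc i)) _ _ ⟩
  f (suc i) * (f zero * prod (omit i (f ∘ suc)))      ∎
  where open ≡-Reasoning

#_ : (Fin n → Bool) → ℕ
# p = sum (λ i → if p i then 1 else 0)

elems : (Fin n → Bool) → List (Fin n)
elems {zero}  p = []
elems {suc n} p = if p zero then zero ∷ map suc (elems (p ∘ suc)) else map suc (elems (p ∘ suc))

length-elems : (p : Fin n → Bool) → length (elems p) ≡ # p
length-elems {zero}  p = refl
length-elems {suc n} p with p zero
... | true  = cong suc (trans (Listₚ.length-map suc (elems (p ∘ suc))) (length-elems (p ∘ suc)))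
... | false = trans (Listₚ.length-map suc (elems (p ∘ suc))) (length-elems (p ∘ suc))

∈-elems⁺ : (p : Fin n → Bool) → ∀ {i} → p i ≡ true → i ∈ elems p
∈-elems⁺ {suc n} p {zero}  pi with p zero
∈-elems⁺ {suc n} p {zero}  refl | true = here refl
∈-elems⁺ {suc n} p {suc i} pi with p zero
... | true  = there (∈ₚ.∈-map⁺ suc (∈-elems⁺ (p ∘ suc) pi))
... | false = ∈ₚ.∈-map⁺ suc (∈-elems⁺ (p ∘ suc) pi)

∈-elems⁻ : (p : Fin n → Bool) → ∀ {i} → i ∈ elems p → p i ≡ true
∈-elems⁻ {suc n} p {i} i∈ with p zero in eq
∈-elems⁻ {suc n} p i∈         | true with i∈
... | here refl = eq
... | there i∈′ with ∈ₚ.∈-map⁻ suc i∈′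
...   | j , j∈ , refl = ∈-elems⁻ (p ∘ suc) j∈
∈-elems⁻ {suc n} p i∈         | false with ∈ₚ.∈-map⁻ suc i∈
... | j , j∈ , refl = ∈-elems⁻ (p ∘ suc) j∈

elems-unique : (p : Fin n → Bool) → Unique (elems p)
elems-unique {zero}  p = []
elems-unique {suc n} p with p zero
... | true  = Allₚ.map⁺ (All.universal (λ _ ()) _) ∷ Uniqueₚ.map⁺ Finₚ.suc-injective (elems-unique (p ∘ suc))
... | false = Uniqueₚ.map⁺ Finₚ.suc-injective (elems-unique (p ∘ suc))

#-complement : (p : Fin n → Bool) → # p + # (not ∘ p) ≡ n
#-complement {n} p = trans (sym (∑-distrib-+ (λ i → if p i then 1 else 0) (λ i → if not (p i) then 1 else 0)))
  (trans (sum-cong-≗ (λ i → one (p i))) (trans (sum-const n 1) (*-identityʳ n)))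
  where
  one : ∀ b → (if b then 1 else 0) + (if not b then 1 else 0) ≡ 1
  one true  = refl
  one false = refl

#≤n : (p : Fin n → Bool) → # p ≤ n
#≤n p = subst (# p ≤_) (#-complement p) (m≤m+n _ _)

prod-if : (p : Fin n → Bool) → ∀ c → prod (λ i → if p i then c else 1) ≡ c ^ (# p)
prod-if {zero}  p c = refl
prod-if {suc n} p c with p zero
... | true  = cong (c *_) (prod-if (p ∘ suc) c)
... | false = trans (*-identityˡ _) (prod-if (p ∘ suc) c)

-- Counting by injections and fibres

remove-∈ : {x : A} {ys : List A} → x ∈ ys →
           Σ (List A) λ zs → length ys ≡ suc (length zs) × (∀ {z} → z ∈ ys → z ≢ x → z ∈ zs)
remove-∈ {ys = y ∷ ys} (here refl) = ys , refl , λ where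
  (here z≡x) z≢x → contradiction z≡x z≢x
  (there z∈) _   → z∈
remove-∈ {ys = y ∷ ys} (there x∈) with remove-∈ x∈
... | zs , eq , sub = y ∷ zs , cong suc eq , λ where
  (here z≡y) _   → here z≡y
  (there z∈) z≢x → there (sub z∈ z≢x)

⊆⇒length≤ : {xs ys : List A} → Unique xs → (∀ {x} → x ∈ xs → x ∈ ys) → length xs ≤ length ys
⊆⇒length≤ []        sub = z≤n
⊆⇒length≤ {xs = x ∷ xs} (x∉ ∷ u) sub with remove-∈ (sub (here refl))
... | zs , eq , keep = subst (suc (length xs) ≤_) (sym eq)
  (s≤s (⊆⇒length≤ u (λ z∈ → keep (sub (there z∈)) (λ z≡x → All.lookup x∉ z∈ (sym z≡x)))))

-- `R` is a relation and not a function because the code of an object may depend on a choice, such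
-- as an isomorphism or an extension to a spanning tree. One code is picked per element, and
-- injectivity of `R` keeps the picked codes distinct.
image : (R : A → B → Set) → (∀ {x x′ y} → R x y → R x′ y → x ≡ x′) → (xs : List A) → Unique xs →
        All (λ x → ∃ (R x)) xs →
        Σ (List B) λ ys → Unique ys × length ys ≡ length xs × (∀ {y} → y ∈ ys → ∃ λ x → x ∈ xs × R x y)
image R inj []       u        []             = [] , [] , refl , λ ()
image R inj (x ∷ xs) (x∉ ∷ u) ((y , r) ∷ rs) with image R inj xs u rs
... | ys , u′ , eq , back = y ∷ ys , All.tabulate fresh ∷ u′ , cong suc eq , λ where
      (here refl) → x , here refl , r
      (there y∈)  → let x′ , x′∈ , r′ = back y∈ in x′ , there x′∈ , r′
  where
  fresh : ∀ {z} → z ∈ ys → y ≢ z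
  fresh z∈ refl with back z∈
  ... | x′ , x′∈ , r′ = All.lookup x∉ x′∈ (inj r r′)

injection-length≤ : (R : A → B → Set) → (∀ {x x′ y} → R x y → R x′ y → x ≡ x′) →
                    {xs : List A} {ys : List B} → Unique xs →
                    (∀ {x} → x ∈ xs → ∃ λ y → y ∈ ys × R x y) → length xs ≤ length ys
injection-length≤ R inj {xs} {ys} u tot with image (λ x y → y ∈ ys × R x y) (λ r r′ → inj (proj₂ r) (proj₂ r′)) xs u (All.tabulate tot)
... | zs , uz , eq , back = subst (_≤ length ys) eq (⊆⇒length≤ uz (λ z∈ → proj₁ (proj₂ (proj₂ (back z∈)))))

#-injection : ∀ {n m} (p : Fin n → Bool) (q : Fin m → Bool) (h : Fin n → Fin m) →
              (∀ i → p i ≡ true → q (h i) ≡ true) →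
              (∀ i j → p i ≡ true → p j ≡ true → h i ≡ h j → i ≡ j) → # p ≤ # q
#-injection p q h into inj = subst₂ _≤_ (length-elems p) (length-elems q)
  (injection-length≤ (λ i j → p i ≡ true × j ≡ h i)
    (λ { (pi , e) (pj , e′) → inj _ _ pi pj (trans (sym e) e′) })
    (elems-unique p)
    (λ {i} i∈ → h i , ∈-elems⁺ q (into i (∈-elems⁻ p i∈)) , ∈-elems⁻ p i∈ , refl))

filter-split : ∀ {P : A → Set} (P? : ∀ x → Dec (P x)) xs →
               length xs ≡ length (filter P? xs) + length (filter (λ x → ¬? (P? x)) xs)
filter-split P? [] = refl
filter-split P? (x ∷ xs) with P? x
... | yes _ = cong suc (filter-split P? xs)
... | no  _ = trans (cong suc (filter-split P? xs)) (sym (+-suc _ _))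

-- The fibres are split off one code at a time. The factor `s` on the left carries the powers of 2
-- that `permanent-bound` supplies for each fibre, in place of a division.
fibre-bound : (_≟_ : DecidableEquality E) (P : A → Set) (code : A → E) (s b : ℕ) →
              (∀ c zs → Unique zs → All (λ z → P z × code z ≡ c) zs → length zs * s ≤ b) →
              ∀ ys xs → Unique xs → All P xs → All (λ x → code x ∈ ys) xs →
              length xs * s ≤ length ys * b
fibre-bound _≟_ P code s b fib []       []       u p c = z≤n
fibre-bound _≟_ P code s b fib []       (x ∷ xs) u p (() ∷ _)
fibre-bound _≟_ P code s b fib (y ∷ ys) xs       u p c = begin
  length xs * s                                   ≡⟨ cong (_* s) (filter-split is xs) ⟩
  (length (filter is xs) + length (filter isnt xs)) * s ≡⟨ *-distribʳ-+ s (length (filter is xs)) _ ⟩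
  length (filter is xs) * s + length (filter isnt xs) * s
    ≤⟨ +-mono-≤ (fib y (filter is xs) (Uniqueₚ.filter⁺ is u)
                   (All.zip (Allₚ.filter⁺ is p , Allₚ.all-filter is xs)))
                (fibre-bound _≟_ P code s b fib ys (filter isnt xs) (Uniqueₚ.filter⁺ isnt u) (Allₚ.filter⁺ isnt p)
                   (All.map shrink (All.zip (Allₚ.filter⁺ isnt c , Allₚ.all-filter isnt xs)))) ⟩
  b + length ys * b ∎
  where
  open ≤-Reasoning
  is   = λ x → code x ≟ y
  isnt = λ x → ¬? (code x ≟ y)
  shrink : ∀ {x} → code x ∈ (y ∷ ys) × ¬ code x ≡ y → code x ∈ ys
  shrink (here e , ne)  = contradiction e ne
  shrink (there c∈ , _) = c∈

-- Lists of all vectors and of all sparse partial vectors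

vectors : (Fin n → List A) → List (Vec A n)
vectors {zero}  o = [] ∷ []
vectors {suc n} o = cartesianProductWith _∷_ (o zero) (vectors (o ∘ suc))

length-cartesianProductWith : (f : A → B → E) → ∀ xs ys → length (cartesianProductWith f xs ys) ≡ length xs * length ys
length-cartesianProductWith f []       ys = refl
length-cartesianProductWith f (x ∷ xs) ys = trans (Listₚ.length-++ (map (f x) ys))
  (cong₂ _+_ (Listₚ.length-map (f x) ys) (length-cartesianProductWith f xs ys))

length-vectors : (o : Fin n → List A) → length (vectors o) ≡ prod (length ∘ o)
length-vectors {zero}  o = refl
length-vectors {suc n} o = trans (length-cartesianProductWith _∷_ (o zero) _) (cong (length (o zero) *_) (length-vectors (o ∘ suc)))

∈-vectors⁺ : (o : Fin n → List A) (v : Vec A n) → (∀ i → lookup v i ∈ o i) → v ∈ vectors o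
∈-vectors⁺ o []      h = here refl
∈-vectors⁺ o (x ∷ v) h = ∈ₚ.∈-cartesianProductWith⁺ _∷_ (h zero) (∈-vectors⁺ (o ∘ suc) v (h ∘ suc))

∈-vectors⁻ : (o : Fin n → List A) (v : Vec A n) → v ∈ vectors o → ∀ i → lookup v i ∈ o i
∈-vectors⁻ {suc n} o v v∈ i with ∈ₚ.∈-cartesianProductWith⁻ _∷_ (o zero) (vectors (o ∘ suc)) v∈
∈-vectors⁻ {suc n} o v v∈ zero    | a , w , a∈ , w∈ , refl = a∈
∈-vectors⁻ {suc n} o v v∈ (suc i) | a , w , a∈ , w∈ , refl = ∈-vectors⁻ (o ∘ suc) w w∈ i

vectors-unique : (o : Fin n → List A) → (∀ i → Unique (o i)) → Unique (vectors o)
vectors-unique {zero}  o u = [] ∷ []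
vectors-unique {suc n} o u = Uniqueₚ.cartesianProductWith⁺ _∷_ Vecₚ.∷-injective (u zero) (vectors-unique (o ∘ suc) (u ∘ suc))

justs : Vec (Maybe A) n → ℕ
justs []            = 0
justs (just _  ∷ v) = suc (justs v)
justs (nothing ∷ v) = justs v

-- The vector itself shows where it is defined, so this one list pays both for a set of at most `l`
-- positions and for the values chosen there.
partials : (Fin n → List A) → ℕ → List (Vec (Maybe A) n)
partials {zero}  o l       = [] ∷ []
partials {suc n} o zero    = map (nothing ∷_) (partials (o ∘ suc) zero)
partials {suc n} o (suc l) = map (nothing ∷_) (partials (o ∘ suc) (suc l)) ++
                             cartesianProductWith (λ a v → just a ∷ v) (o zero) (partials (o ∘ suc) l)

∈-partials : (o : Fin n → List A) → ∀ l (v : Vec (Maybe A) n) → justs v ≤ l →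
             (∀ i {a} → lookup v i ≡ just a → a ∈ o i) → v ∈ partials o l
∈-partials o l       []            j h = here refl
∈-partials o zero    (nothing ∷ v) j h = ∈ₚ.∈-map⁺ _ (∈-partials (o ∘ suc) zero v j (h ∘ suc))
∈-partials o (suc l) (nothing ∷ v) j h = ∈ₚ.∈-++⁺ˡ (∈ₚ.∈-map⁺ _ (∈-partials (o ∘ suc) (suc l) v j (h ∘ suc)))
∈-partials o (suc l) (just a ∷ v)  (s≤s j) h = ∈ₚ.∈-++⁺ʳ (map (nothing ∷_) (partials (o ∘ suc) (suc l)))
  (∈ₚ.∈-cartesianProductWith⁺ _ (h zero refl) (∈-partials (o ∘ suc) l v j (h ∘ suc)))

-- Weighing a defined entry by 1 / (D s) bounds the generating function Σ by (1 + 1/s)ⁿ.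
length-partials : (o : Fin n → List A) → ∀ D s → (∀ i → length (o i) ≤ D) → 1 ≤ D * s → ∀ l →
                  length (partials o l) * s ^ n ≤ (D * s) ^ l * suc s ^ n
length-partials {zero} o D s oD Ds l = subst (1 ≤_) (sym (*-identityʳ _)) (pow l)
  where
  pow : ∀ l → 1 ≤ (D * s) ^ l
  pow zero    = ≤-refl
  pow (suc l) = *-mono-≤ Ds (pow l)
length-partials {suc n} o D s oD Ds zero = begin
  length (map (nothing ∷_) ps) * (s * s ^ n) ≡⟨ cong (_* (s * s ^ n)) (Listₚ.length-map _ ps) ⟩
  length ps * (s * s ^ n)  ≡⟨ cong (length ps *_) (*-comm s _) ⟩
  length ps * (s ^ n * s)  ≡⟨ *-assoc (length ps) _ _ ⟨
  length ps * s ^ n * s    ≤⟨ *-mono-≤ (length-partials (o ∘ suc) D s (oD ∘ suc) Ds zero) (n≤1+n s) ⟩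
  1 * suc s ^ n * suc s    ≡⟨ cong (_* suc s) (*-identityˡ (suc s ^ n)) ⟩
  suc s ^ n * suc s        ≡⟨ *-comm (suc s ^ n) (suc s) ⟩
  suc s * suc s ^ n        ≡⟨ *-identityˡ _ ⟨
  1 * (suc s * suc s ^ n)  ∎
  where open ≤-Reasoning
        ps = partials (o ∘ suc) zero
length-partials {suc n} o D s oD Ds (suc l) = begin
  length (partials o (suc l)) * (s * s ^ n)
    ≡⟨ cong (_* (s * s ^ n)) (trans (Listₚ.length-++ (map (nothing ∷_) ps))
         (cong₂ _+_ (Listₚ.length-map _ ps) (length-cartesianProductWith _ (o zero) qs))) ⟩
  (length ps + length (o zero) * length qs) * (s * s ^ n)
    ≤⟨ *-monoˡ-≤ (s * s ^ n) (+-monoʳ-≤ (length ps) (*-monoˡ-≤ (length qs) (oD zero))) ⟩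
  (length ps + D * length qs) * (s * s ^ n)
    ≡⟨ solve 5 (λ p d q s t → (p :+ d :* q) :* (s :* t) := s :* (p :* t) :+ (d :* s) :* (q :* t)) refl (length ps) D (length qs) s (s ^ n) ⟩
  s * (length ps * s ^ n) + D * s * (length qs * s ^ n)
    ≤⟨ +-mono-≤ (*-monoʳ-≤ s (length-partials (o ∘ suc) D s (oD ∘ suc) Ds (suc l)))
                (*-monoʳ-≤ (D * s) (length-partials (o ∘ suc) D s (oD ∘ suc) Ds l)) ⟩
  s * ((D * s) * (D * s) ^ l * suc s ^ n) + D * s * ((D * s) ^ l * suc s ^ n)
    ≡⟨ solve 4 (λ s x y z → s :* (x :* y :* z) :+ x :* (y :* z) := x :* y :* ((con 1 :+ s) :* z)) refl s (D * s) ((D * s) ^ l) (suc s ^ n) ⟩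
  (D * s) * (D * s) ^ l * (suc s * suc s ^ n) ∎
  where open ≤-Reasoning
        ps = partials (o ∘ suc) (suc l)
        qs = partials (o ∘ suc) l

-- The inequality behind the permanent bound

ind : Bool → ℕ
ind b = if b then 1 else 0

vec-ext : {u v : Vec A n} → (∀ i → lookup u i ≡ lookup v i) → u ≡ v
vec-ext {u = []}    {[]}    h = refl
vec-ext {u = x ∷ u} {y ∷ v} h = cong₂ _∷_ (h zero) (vec-ext (h ∘ suc))

-- The coefficient of t in the product of all yᵢ + t bᵢ, with `b` read as 0 or 1. Expanding a
-- permanent along a column produces this sum.
derivative : (Fin n → Bool) → (Fin n → ℕ) → ℕ
derivative b y = sum (λ i → ind (b i) * prod (omit i y))

derivative-suc : (b : Fin (suc n) → Bool) (y : Fin (suc n) → ℕ) →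
  derivative b y ≡ ind (b zero) * prod (y ∘ suc) + y zero * derivative (b ∘ suc) (y ∘ suc)
derivative-suc b y = cong₂ _+_ (cong (ind (b zero) *_) (*-identityˡ _))
  (begin
    sum (λ i → ind (b (suc i)) * (y zero * prod (omit i (y ∘ suc))))
      ≡⟨ sum-cong-≗ (λ i → solve 3 (λ a b c → a :* (b :* c) := a :* c :* b) refl (ind (b (suc i))) (y zero) _) ⟩
    sum (λ i → ind (b (suc i)) * prod (omit i (y ∘ suc)) * y zero)
      ≡⟨ sum-*ʳ (λ i → ind (b (suc i)) * prod (omit i (y ∘ suc))) (y zero) ⟨
    derivative (b ∘ suc) (y ∘ suc) * y zero
      ≡⟨ *-comm _ (y zero) ⟩
    y zero * derivative (b ∘ suc) (y ∘ suc) ∎)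
  where open ≡-Reasoning

-- With xᵢ = 1/yᵢ the claim is 2(m + Σ xᵢ) ≤ 2ᵐ ∏ (1 + xᵢ); it is affine in each xᵢ ∈ [0,1],
-- and raising some xᵢ from 0 to 1 has the effect of raising m by one.
derivative-bound′ : ∀ m (b : Fin n → Bool) (y : Fin n → ℕ) → (∀ i → 1 ≤ y i) →
  2 * (m * prod y + derivative b y) ≤ 2 ^ m * prod (λ i → y i + ind (b i))
derivative-bound′ {zero} m b y y≥1 = begin
  2 * (m * 1 + 0) ≡⟨ solve 1 (λ m → con 2 :* (m :* con 1 :+ con 0) := con 2 :* m) refl m ⟩
  2 * m           ≤⟨ double≤ m ⟩
  2 ^ m           ≡⟨ *-identityʳ _ ⟨
  2 ^ m * 1       ∎
  where
  open ≤-Reasoning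
  double≤ : ∀ m → 2 * m ≤ 2 ^ m
  double≤ zero          = z≤n
  double≤ (suc zero)    = ≤-refl
  double≤ (suc (suc m)) = *-monoʳ-≤ 2 (≤-trans (+-monoˡ-≤ (suc m) (s≤s z≤n))
    (subst (_≤ 2 ^ suc m) (cong (suc m +_) (+-identityʳ (suc m))) (double≤ (suc m))))
derivative-bound′ {suc n} m b y y≥1 = begin
  2 * (m * (y₀ * P) + derivative b y)                ≡⟨ cong (λ z → 2 * (m * (y₀ * P) + z)) (derivative-suc b y) ⟩
  2 * (m * (y₀ * P) + (ind (b zero) * P + y₀ * S))   ≤⟨ case-b₀ (b zero) ⟩
  2 ^ m * ((y₀ + ind (b zero)) * R)                  ∎
  where
  open ≤-Reasoning
  y₀ = y zero
  z  = y₀ ∸ 1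
  y₀≡ : y₀ ≡ suc z
  y₀≡ = sym (m+[n∸m]≡n (y≥1 zero))
  P = prod (y ∘ suc)
  S = derivative (b ∘ suc) (y ∘ suc)
  R = prod (λ i → y (suc i) + ind (b (suc i)))
  IH : ∀ m → 2 * (m * P + S) ≤ 2 ^ m * R
  IH m = derivative-bound′ m (b ∘ suc) (y ∘ suc) (y≥1 ∘ suc)
  case-b₀ : ∀ c → 2 * (m * (y₀ * P) + (ind c * P + y₀ * S)) ≤ 2 ^ m * ((y₀ + ind c) * R)
  case-b₀ false = begin
    2 * (m * (y₀ * P) + (0 * P + y₀ * S))
      ≡⟨ solve 4 (λ m y P S → con 2 :* (m :* (y :* P) :+ (con 0 :* P :+ y :* S)) := y :* (con 2 :* (m :* P :+ S))) refl m y₀ P S ⟩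
    y₀ * (2 * (m * P + S))
      ≤⟨ *-monoʳ-≤ y₀ (IH m) ⟩
    y₀ * (2 ^ m * R)
      ≡⟨ solve 3 (λ y t R → y :* (t :* R) := t :* ((y :+ con 0) :* R)) refl y₀ (2 ^ m) R ⟩
    2 ^ m * ((y₀ + 0) * R) ∎
  case-b₀ true = begin
    2 * (m * (y₀ * P) + (1 * P + y₀ * S))
      ≡⟨ cong (λ y → 2 * (m * (y * P) + (1 * P + y * S))) y₀≡ ⟩
    2 * (m * (suc z * P) + (1 * P + suc z * S))
      -- With y₀ = z + 1 the left side is z times the case m plus once the case m + 1; this is the
      -- affine dependence on 1/y₀.
      ≡⟨ solve 4 (λ m z P S → con 2 :* (m :* ((con 1 :+ z) :* P) :+ (con 1 :* P :+ (con 1 :+ z) :* S))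
                  := z :* (con 2 :* (m :* P :+ S)) :+ con 2 :* ((con 1 :+ m) :* P :+ S)) refl m z P S ⟩
    z * (2 * (m * P + S)) + 2 * (suc m * P + S)
      ≤⟨ +-mono-≤ (*-monoʳ-≤ z (IH m)) (IH (suc m)) ⟩
    z * (2 ^ m * R) + 2 * 2 ^ m * R
      ≡⟨ solve 3 (λ z t R → z :* (t :* R) :+ con 2 :* t :* R := t :* ((con 1 :+ z :+ con 1) :* R)) refl z (2 ^ m) R ⟩
    2 ^ m * ((suc z + 1) * R)
      ≡⟨ cong (λ y → 2 ^ m * ((y + 1) * R)) y₀≡ ⟨
    2 ^ m * ((y₀ + 1) * R) ∎

derivative-bound : (b : Fin n → Bool) (y : Fin n → ℕ) → (∀ i → 1 ≤ y i) →
  2 * derivative b y ≤ prod (λ i → y i + ind (b i))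
derivative-bound b y y≥1 = subst (2 * derivative b y ≤_) (*-identityˡ _) (derivative-bound′ 0 b y y≥1)

count : (Fin n → Bool) → List (Fin n) → ℕ
count p []       = 0
count p (c ∷ cs) = ind (p c) + count p cs

count≤# : (p : Fin n → Bool) → ∀ {cs} → Unique cs → count p cs ≤ # p
count≤# p {cs} u = subst₂ _≤_ (length-filter cs) (length-elems p)
    (⊆⇒length≤ (Uniqueₚ.filter⁺ P? u) (λ {x} x∈ → ∈-elems⁺ p (proj₂ (∈ₚ.∈-filter⁻ P? {xs = cs} x∈))))
  where
  P? = λ x → p x Boolₚ.≟ true
  length-filter : ∀ cs → length (filter P? cs) ≡ count p cs
  length-filter []       = refl
  length-filter (c ∷ cs) with p c
  ... | true  = cong suc (length-filter cs)
  ... | false = length-filter cs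

-- Double counting of the pairs (i, x) with `P i x`: each x occurs in at least t / c of them.
length*≤sum-filter : ∀ {P : Fin n → A → Set} (P? : ∀ i x → Dec (P i x)) t c xs →
                     All (λ x → t ≤ sum (λ i → ind (does (P? i x))) * c) xs →
                     length xs * t ≤ sum (λ i → length (filter (P? i) xs)) * c
length*≤sum-filter P? t c []       []       = z≤n
length*≤sum-filter P? t c (x ∷ xs) (h ∷ hs) = begin
  t + length xs * t
    ≤⟨ +-mono-≤ h (length*≤sum-filter P? t c xs hs) ⟩
  sum (λ i → ind (does (P? i x))) * c + sum (λ i → length (filter (P? i) xs)) * c
    ≡⟨ *-distribʳ-+ c (sum (λ i → ind (does (P? i x)))) _ ⟨
  (sum (λ i → ind (does (P? i x))) + sum (λ i → length (filter (P? i) xs))) * c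
    ≡⟨ cong (_* c) (∑-distrib-+ (λ i → ind (does (P? i x))) _) ⟨
  sum (λ i → ind (does (P? i x)) + length (filter (P? i) xs)) * c
    ≡⟨ cong (_* c) (sum-cong-≗ add) ⟩
  sum (λ i → length (filter (P? i) (x ∷ xs))) * c ∎
  where
  open ≤-Reasoning
  add : ∀ i → ind (does (P? i x)) + length (filter (P? i) xs) ≡ length (filter (P? i) (x ∷ xs))
  add i with does (P? i x)
  ... | true  = refl
  ... | false = refl

length≤sum-filter : ∀ {P : Fin n → A → Set} (P? : ∀ i x → Dec (P i x)) xs → All (λ x → ∃ λ i → P i x) xs →
                    length xs ≤ sum (λ i → length (filter (P? i) xs))
length≤sum-filter P? xs h = subst₂ _≤_ (*-identityʳ _) (*-identityʳ _)
  (length*≤sum-filter P? 1 1 xs (All.map (λ {x} (i , pi) → subst (1 ≤_) (sym (*-identityʳ _)) (hit (λ i → does (P? i x)) i (dec-true (P? i x) pi))) h))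
  where
  hit : ∀ {n} (b : Fin n → Bool) i → b i ≡ true → 1 ≤ # b
  hit b zero    bi rewrite bi = s≤s z≤n
  hit b (suc i) bi = ≤-trans (hit (b ∘ suc) i bi) (m≤n+m _ (ind (b zero)))

-- The permanent bound  per A ≤ ∏ (rᵢ + 1)/2  for 0-1 matrices (Minc), by expansion along a column.
module _ (N : Fin n → Fin n → Bool) where

  -- A stage of the column expansion: `I` holds the rows still to be matched, `C` the columns still
  -- free. Since `ψ` prescribes the values outside `I`, a vector is determined by its matching, and
  -- a list of distinct vectors is at most as long as the permanent of the submatrix.
  record Matching (I : Fin n → Bool) (C : List (Fin n)) (ψ φ : Vec (Fin n) n) : Set where
    field
      range      : ∀ i → I i ≡ true → lookup φ i ∈ C
      allowed    : ∀ i → I i ≡ true → N i (lookup φ i) ≡ true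
      injective  : ∀ i j → I i ≡ true → I j ≡ true → lookup φ i ≡ lookup φ j → i ≡ j
      surjective : ∀ {c} → c ∈ C → ∃ λ i → I i ≡ true × lookup φ i ≡ c
      outside    : ∀ i → I i ≡ false → lookup φ i ≡ lookup ψ i

  permanent-bound : ∀ C I ψ X → Unique C → Unique X → All (Matching I C ψ) X →
    length X * prod (λ i → if I i then 2 else 1) ≤ prod (λ i → if I i then suc (count (N i) C) else 1)
  -- Without columns no row can remain in `I`, so every vector equals `ψ` and the list has at most
  -- one entry.
  permanent-bound [] I ψ []          _ u ms = z≤n
  permanent-bound [] I ψ (φ ∷ [])    _ u (m ∷ ms) = subst (_≤ prod (λ i → if I i then 1 else 1)) (sym (+-identityʳ _))
    (prod-mono mono)
    where
    mono : ∀ i → (if I i then 2 else 1) ≤ (if I i then 1 else 1)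
    mono i with I i in eq
    ... | false = ≤-refl
    ... | true  with () ← Matching.range m i eq
  permanent-bound [] I ψ (φ ∷ φ′ ∷ X) _ ((ne ∷ _) ∷ u) (m ∷ m′ ∷ ms) = contradiction (vec-ext same) ne
    where
    same : ∀ i → lookup φ i ≡ lookup φ′ i
    same i with I i in eq
    ... | false = trans (Matching.outside m i eq) (sym (Matching.outside m′ i eq))
    ... | true  with () ← Matching.range m i eq
  permanent-bound (c ∷ C) I ψ X (c∉C ∷ uC) u ms = begin
    length X * ∏2 I                                    ≤⟨ *-monoˡ-≤ (∏2 I) (length≤sum-filter P? X (All.map split ms)) ⟩
    sum (λ i → length (filter (P? i) X)) * ∏2 I        ≡⟨ sum-*ʳ (λ i → length (filter (P? i) X)) (∏2 I) ⟩
    sum (λ i → length (filter (P? i) X) * ∏2 I)        ≤⟨ sum-mono term ⟩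
    sum (λ i → ind (b i) * prod (omit i y) * 2)        ≡⟨ sum-*ʳ (λ i → ind (b i) * prod (omit i y)) 2 ⟨
    derivative b y * 2                                 ≡⟨ *-comm (derivative b y) 2 ⟩
    -- The 2 on the left is the factor of the row that was matched with `c`. Adding `b i` to `y i`
    -- on the right restores the column `c` to each row.
    2 * derivative b y                                 ≤⟨ derivative-bound b y y≥1 ⟩
    prod (λ i → y i + ind (b i))                       ≡⟨ prod-cong rows ⟩
    prod (λ i → if I i then suc (count (N i) (c ∷ C)) else 1) ∎
    where
    open ≤-Reasoning
    ∏2 : (Fin n → Bool) → ℕ
    ∏2 I = prod (λ i → if I i then 2 else 1)
    y : Fin n → ℕ
    y i = if I i then suc (count (N i) C) else 1
    y≥1 : ∀ i → 1 ≤ y i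
    y≥1 i with I i
    ... | true  = s≤s z≤n
    ... | false = ≤-refl
    b : Fin n → Bool
    b i = I i ∧ N i c
    rows : ∀ i → y i + ind (b i) ≡ (if I i then suc (count (N i) (c ∷ C)) else 1)
    rows i with I i
    ... | true  = cong suc (+-comm (count (N i) C) _)
    ... | false = refl
    P? = λ i φ → (b i Boolₚ.≟ true) ×-dec (lookup φ i Finₚ.≟ c)
    split : ∀ {φ} → Matching I (c ∷ C) ψ φ → ∃ λ i → b i ≡ true × lookup φ i ≡ c
    split m with Matching.surjective m (here refl)
    ... | i , Ii , refl = i , cong₂ _∧_ Ii (Matching.allowed m i Ii) , refl
    I∖_ : Fin n → Fin n → Bool
    (I∖ i) j = if does (j Finₚ.≟ i) then false else I j
    omit-if : ∀ i (f : Fin n → ℕ) → prod (omit i (λ j → if I j then f j else 1)) ≡ prod (λ j → if (I∖ i) j then f j else 1)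
    omit-if i f = prod-cong eq
      where
      eq : ∀ j → omit i (λ j → if I j then f j else 1) j ≡ (if (I∖ i) j then f j else 1)
      eq j with does (j Finₚ.≟ i)
      ... | true  = refl
      ... | false = refl
    term : ∀ i → length (filter (P? i) X) * ∏2 I ≤ ind (b i) * prod (omit i y) * 2
    term i with b i in bi
    ... | false = subst (λ l → l * ∏2 I ≤ 0) (sym (cong length (Listₚ.filter-none (λ φ → (false Boolₚ.≟ true) ×-dec (lookup φ i Finₚ.≟ c)) (All.universal (λ _ → λ ()) X)))) z≤n
    ... | true = begin
      length Xᵢ * ∏2 I
        ≡⟨ cong (length Xᵢ *_) (trans (prod-omit (λ j → if I j then 2 else 1) i)
              (cong₂ _*_ (cong (if_then 2 else 1) Ii) (omit-if i (λ _ → 2)))) ⟩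
      length Xᵢ * (2 * ∏2 (I∖ i))
        ≡⟨ solve 2 (λ x p → x :* (con 2 :* p) := x :* p :* con 2) refl (length Xᵢ) _ ⟩
      length Xᵢ * ∏2 (I∖ i) * 2
        ≤⟨ *-monoˡ-≤ 2 (permanent-bound C (I∖ i) ψ′ Xᵢ uC (Uniqueₚ.filter⁺ Q? u)
             (All.map restrict (All.zip (Allₚ.filter⁺ Q? ms , Allₚ.all-filter Q? X)))) ⟩
      prod (λ j → if (I∖ i) j then suc (count (N j) C) else 1) * 2
        ≡⟨ cong (_* 2) (omit-if i (λ j → suc (count (N j) C))) ⟨
      prod (omit i y) * 2
        ≡⟨ cong (_* 2) (*-identityˡ (prod (omit i y))) ⟨
      1 * prod (omit i y) * 2 ∎
      where
      Q? = λ φ → (true Boolₚ.≟ true) ×-dec (lookup φ i Finₚ.≟ c)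
      Xᵢ = filter Q? X
      -- Row i leaves `I`, so its value `c` now belongs to the prescribed part.
      ψ′ = ψ Vec.[ i ]≔ c
      Ii : I i ≡ true
      Ii = Boolₚ.∧-conicalˡ (I i) (N i c) bi
      restrict : ∀ {φ} → Matching I (c ∷ C) ψ φ × (true ≡ true × lookup φ i ≡ c) → Matching (I∖ i) C ψ′ φ
      restrict {φ} (m , _ , φi) = record
        { range      = λ j r → let j≢i , Ij = ∖⁻ j r in drop-c j j≢i Ij (Matching.range m j Ij)
        ; allowed    = λ j r → Matching.allowed m j (proj₂ (∖⁻ j r))
        ; injective  = λ j k r r′ → Matching.injective m j k (proj₂ (∖⁻ j r)) (proj₂ (∖⁻ k r′))
        ; surjective = surj
        ; outside    = out }
        where
        ∖⁻ : ∀ j → (I∖ i) j ≡ true → j ≢ i × I j ≡ true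
        ∖⁻ j r with j Finₚ.≟ i
        ... | no j≢i = j≢i , r
        drop-c : ∀ j → j ≢ i → I j ≡ true → lookup φ j ∈ (c ∷ C) → lookup φ j ∈ C
        drop-c j j≢i Ij (there d) = d
        drop-c j j≢i Ij (here e)  = contradiction (Matching.injective m j i Ij Ii (trans e (sym φi))) j≢i
        surj : ∀ {d} → d ∈ C → ∃ λ j → (I∖ i) j ≡ true × lookup φ j ≡ d
        surj d∈ with Matching.surjective m (there d∈)
        ... | j , Ij , e with j Finₚ.≟ i in dec
        ...   | no  j≢i = j , trans (cong (λ z → if does z then false else I j) dec) Ij , e
        ...   | yes refl = contradiction (trans (sym φi) e) (All.lookup c∉C d∈)
        out : ∀ j → (I∖ i) j ≡ false → lookup φ j ≡ lookup ψ′ j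
        out j r with j Finₚ.≟ i
        ... | yes refl = trans φi (sym (Vecₚ.lookup∘update i ψ c))
        ... | no  j≢i  = trans (Matching.outside m j r) (sym (Vecₚ.lookup∘update′ j≢i ψ c))

iterate-suc : (f : A → A) → ∀ x k → iterate f x (suc k) ≡ f (iterate f x k)
iterate-suc f x zero    = refl
iterate-suc f x (suc k) = iterate-suc f (f x) k

iterate-+ : (f : A → A) → ∀ x i j → iterate f x (i + j) ≡ iterate f (iterate f x i) j
iterate-+ f x zero    j = refl
iterate-+ f x (suc i) j = iterate-+ f (f x) i j

-- Rooted forests as parent functions, the roots being the fixed points

Edge : (Fin n → Fin n) → Fin n → Fin n → Set
Edge p u v = u ≢ v × (p u ≡ v ⊎ p v ≡ u)

Edge? : (p : Fin n → Fin n) → ∀ u v → Dec (Edge p u v)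
Edge? p u v = ¬? (u ≟ v) ×-dec ((p u ≟ v) ⊎-dec (p v ≟ u))

Edge-sym : (p : Fin n → Fin n) → ∀ {u v} → Edge p u v → Edge p v u
Edge-sym p (u≢v , e) = u≢v ∘ sym , swap e

-- The decreasing `rank` excludes cycles without mentioning them. The `root` is kept as data, so
-- that lying in the same component is an equation that can be decided.
record Forest {n} (p : Fin n → Fin n) : Set where
  field
    rank        : Fin n → ℕ
    root        : Fin n → Fin n
    rank-<      : ∀ v → p v ≢ v → rank (p v) < rank v
    root-parent : ∀ v → root (p v) ≡ root v
    root-fixed  : ∀ v → p (root v) ≡ root v
    root-root   : ∀ v → p v ≡ v → root v ≡ v

  Joined : Fin n → Fin n → Set
  Joined u v = root u ≡ root v

  rank-induction : ∀ {ℓ} (P : Fin n → Set ℓ) → (∀ v → p v ≡ v → P v) → (∀ v → p v ≢ v → P (p v) → P v) → ∀ v → P v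
  rank-induction P base up v = go (rank v) v ≤-refl
    where
    go : ∀ k v → rank v ≤ k → P v
    go k v r≤k with p v ≟ v
    go k       v r≤k | yes e = base v e
    go zero    v r≤0 | no ne = contradiction (<-≤-trans (rank-< v ne) r≤0) λ ()
    go (suc k) v r≤k | no ne = up v ne (go k (p v) (≤-pred (<-≤-trans (rank-< v ne) r≤k)))

  no-2-cycle : ∀ {u v} → p u ≡ v → p v ≡ u → u ≡ v
  no-2-cycle {u} {v} pu pv with u ≟ v
  ... | yes e  = e
  ... | no u≢v = contradiction (<-trans (down pu (u≢v ∘ sym)) (down pv u≢v)) (<-irrefl refl)
    where
    down : ∀ {x y} → p x ≡ y → y ≢ x → rank y < rank x
    down refl = rank-< _

_⊆ₑ_ : (p q : Fin n → Fin n) → Set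
p ⊆ₑ q = ∀ {u v} → Edge p u v → Edge q u v

Joined⊆ : {p q : Fin n → Fin n} → Forest p → Forest q → Set
Joined⊆ F F′ = ∀ {u v} → Forest.Joined F u v → Forest.Joined F′ u v

id-forest : Forest {n} id
id-forest = record
  { rank = λ _ → 0 ; root = id ; rank-< = λ v ne → contradiction refl ne
  ; root-parent = λ _ → refl ; root-fixed = λ _ → refl ; root-root = λ _ _ → refl }

-- The rank drops at every step that moves, so after `N` steps each vertex has arrived at a fixed
-- point, which serves as its root.
forest-from-rank : (p : Fin n → Fin n) (rank : Fin n → ℕ) → ∀ N → (∀ v → rank v ≤ N) →
                   (∀ v → p v ≢ v → rank (p v) < rank v) → Forest p
forest-from-rank p rank N bound dec = record
  { rank = rank ; root = λ v → iterate p v N ; rank-< = dec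
  ; root-parent = λ v → trans (iterate-suc p v N) (fixed N v (bound v))
  ; root-fixed = λ v → fixed N v (bound v)
  ; root-root = λ v pv → stays v pv N }
  where
  stays : ∀ v → p v ≡ v → ∀ k → iterate p v k ≡ v
  stays v pv zero    = refl
  stays v pv (suc k) = trans (cong (λ z → iterate p z k) pv) (stays v pv k)
  fixed : ∀ k v → rank v ≤ k → p (iterate p v k) ≡ iterate p v k
  fixed k v r≤k with p v ≟ v
  ... | yes pv = trans (cong p (stays v pv k)) (trans pv (sym (stays v pv k)))
  fixed zero    v r≤k | no ne = contradiction (<-≤-trans (dec v ne) r≤k) λ ()
  fixed (suc k) v r≤k | no ne = fixed k (p v) (≤-pred (<-≤-trans (dec v ne) r≤k))

-- Roots and undirected edges determine a forest. Going away from the roots, `q` agrees with `p` at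
-- `p v`; if `q` directed the edge at `v` the other way, then v would be the parent of its own
-- parent.
forest-unique : {p q : Fin n → Fin n} → Forest p → (∀ v → p v ≡ v → q v ≡ v) → p ⊆ₑ q → ∀ v → p v ≡ q v
forest-unique {p = p} {q} F fix sub = Forest.rank-induction F (λ v → p v ≡ q v)
  (λ v pv → trans pv (sym (fix v pv))) up
  where
  up : ∀ v → p v ≢ v → p (p v) ≡ q (p v) → p v ≡ q v
  up v ne IH with sub (ne ∘ sym , inj₁ refl)
  ... | _ , inj₁ qv  = sym qv
  ... | _ , inj₂ qpv = contradiction (sym (Forest.no-2-cycle F refl (trans IH qpv))) ne

module _ {n} {p : Fin n → Fin n} (F : Forest p) where
  open Forest F

  Rerooted : Fin n → Set
  Rerooted w = ∃ λ q → Σ (Forest q) λ F′ → q w ≡ w × p ⊆ₑ q × q ⊆ₑ p × Joined⊆ F F′ × Joined⊆ F′ F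

  -- Reverses the edge between a root x and its child `w`. The component keeps its vertices and only
  -- changes the name of its root from x to `w`.
  flip-root : ∀ w → p w ≢ w → p (p w) ≡ p w → Rerooted w
  flip-root w ne fix = q , F′ , qw , sub , sub⁻ , cong rename ,
                       λ {u} {v} → rename-injective (root u) (root v) (root-fixed u) (root-fixed v)
    where
    x = p w
    q = updateAt (updateAt p x (const w)) w (const w)
    qw : q w ≡ w
    qw = updateAt-updates w (updateAt p x (const w))
    qx : q x ≡ w
    qx = trans (updateAt-minimal x w (updateAt p x (const w)) ne) (updateAt-updates x p)
    q-other : ∀ {v} → v ≢ w → v ≢ x → q v ≡ p v
    q-other v≢w v≢x = trans (updateAt-minimal _ w _ v≢w) (updateAt-minimal _ x p v≢x)

    rename : Fin n → Fin n
    rename z = if does (z ≟ x) then w else z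
    rename-x : rename x ≡ w
    rename-x rewrite dec-true (x ≟ x) refl = refl
    rename-other : ∀ {z} → z ≢ x → rename z ≡ z
    rename-other {z} z≢x rewrite dec-false (z ≟ x) z≢x = refl
    rename-injective : ∀ y z → p y ≡ y → p z ≡ z → rename y ≡ rename z → y ≡ z
    rename-injective y z py pz e with y ≟ x | z ≟ x
    ... | yes y≡x | yes z≡x = trans y≡x (sym z≡x)
    ... | yes _   | no _    = contradiction (subst (λ t → p t ≡ t) (sym e) pz) ne
    ... | no _    | yes _   = contradiction (subst (λ t → p t ≡ t) e py) ne
    ... | no _    | no _    = e

    height : Fin n → ℕ
    -- Shifting all old ranks by 1 frees the value 0 for the new root.
    height v = if does (v ≟ w) then 0 else suc (rank v)
    height-w : height w ≡ 0
    height-w rewrite dec-true (w ≟ w) refl = refl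

    height-< : ∀ v → q v ≢ v → height (q v) < height v
    height-< v qv≢v with v ≟ w
    ... | yes refl = contradiction qw qv≢v
    ... | no v≢w with v ≟ x
    ...   | yes refl rewrite qx | height-w = s≤s z≤n
    ...   | no v≢x rewrite q-other v≢w v≢x with p v ≟ w
    ...     | yes _ = s≤s z≤n
    ...     | no  _ = s≤s (rank-< v qv≢v)

    parent : ∀ v → rename (root (q v)) ≡ rename (root v)
    parent v with v ≟ w
    ... | yes refl rewrite qw = refl
    ... | no v≢w with v ≟ x
    ...   | yes refl rewrite qx = cong rename (sym (root-parent w))
    ...   | no v≢x rewrite q-other v≢w v≢x = cong rename (root-parent v)

    fixed : ∀ v → q (rename (root v)) ≡ rename (root v)
    fixed v with root v ≟ x
    ... | yes _ = qw
    ... | no r≢x = trans (q-other (λ e → ne (subst (λ t → p t ≡ t) e (root-fixed v))) r≢x) (root-fixed v)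

    own : ∀ v → q v ≡ v → rename (root v) ≡ v
    own v qv with v ≟ w
    ... | yes refl = trans (cong rename (trans (sym (root-parent w)) (root-root x fix))) rename-x
    ... | no v≢w with v ≟ x
    ...   | yes refl = contradiction (trans (sym qv) qx) ne
    ...   | no v≢x = trans (cong rename (root-root v (trans (sym (q-other v≢w v≢x)) qv))) (rename-other v≢x)

    F′ : Forest q
    F′ = record { rank = height ; root = rename ∘ root ; rank-< = height-< ; root-parent = parent
                ; root-fixed = fixed ; root-root = own }

    half : ∀ {u v} → u ≢ v → p u ≡ v → q u ≡ v ⊎ q v ≡ u
    half {u} {v} u≢v pu with u ≟ w
    ... | yes refl = inj₂ (trans (cong q (sym pu)) qx)
    ... | no u≢w with u ≟ x
    ...   | yes refl = contradiction (trans (sym fix) pu) u≢v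
    ...   | no u≢x = inj₁ (trans (q-other u≢w u≢x) pu)

    half⁻ : ∀ {u v} → u ≢ v → q u ≡ v → p u ≡ v ⊎ p v ≡ u
    half⁻ {u} {v} u≢v qu with u ≟ w
    ... | yes refl = contradiction (trans (sym qw) qu) u≢v
    ... | no u≢w with u ≟ x
    ...   | yes refl = inj₂ (cong p (trans (sym qu) qx))
    ...   | no u≢x = inj₁ (trans (sym (q-other u≢w u≢x)) qu)

    sub : p ⊆ₑ q
    sub (u≢v , inj₁ e) = u≢v , half u≢v e
    sub (u≢v , inj₂ e) = u≢v , swap (half (u≢v ∘ sym) e)

    sub⁻ : q ⊆ₑ p
    sub⁻ (u≢v , inj₁ e) = u≢v , half⁻ u≢v e
    sub⁻ (u≢v , inj₂ e) = u≢v , swap (half⁻ (u≢v ∘ sym) e)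

  link : ∀ w u → p w ≡ w → ¬ Joined u w →
         ∃ λ q → Σ (Forest q) λ F′ → p ⊆ₑ q × (∀ {a b} → Edge q a b → Edge p a b ⊎ (a ≡ w × b ≡ u) ⊎ (a ≡ u × b ≡ w)) ×
                 Joined⊆ F F′ × Forest.Joined F′ u w
  link w u pw apart = q , F′ , sub , sub⁻ , cong rename , trans (rename-other ru≢w) (sym (trans (cong rename (root-root w pw)) rename-w))
    where
    q = updateAt p w (const u)
    qw : q w ≡ u
    qw = updateAt-updates w p
    q-other : ∀ {v} → v ≢ w → q v ≡ p v
    q-other v≢w = updateAt-minimal _ w p v≢w
    ru≢w : root u ≢ w
    ru≢w e = apart (trans e (sym (root-root w pw)))

    rename : Fin n → Fin n
    rename z = if does (z ≟ w) then root u else z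
    rename-w : rename w ≡ root u
    rename-w rewrite dec-true (w ≟ w) refl = refl
    rename-other : ∀ {z} → z ≢ w → rename z ≡ z
    rename-other {z} z≢w rewrite dec-false (z ≟ w) z≢w = refl

    height : Fin n → ℕ
    -- The tree of `w` is hung below `u`, so all its ranks are lifted above the rank of `u`.
    height v = if does (root v ≟ w) then rank v + suc (rank u) else rank v

    height-< : ∀ v → q v ≢ v → height (q v) < height v
    height-< v qv≢v with v ≟ w
    ... | yes refl rewrite qw | dec-false (root u ≟ w) ru≢w | dec-true (root w ≟ w) (root-root w pw) = m≤n+m (suc (rank u)) (rank w)
    ... | no v≢w rewrite q-other v≢w | root-parent v with does (root v ≟ w)
    ...   | true  = +-monoˡ-< (suc (rank u)) (rank-< v qv≢v)
    ...   | false = rank-< v qv≢v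

    parent : ∀ v → rename (root (q v)) ≡ rename (root v)
    parent v with v ≟ w
    ... | yes refl rewrite qw = trans (rename-other ru≢w) (sym (trans (cong rename (root-root w pw)) rename-w))
    ... | no v≢w rewrite q-other v≢w = cong rename (root-parent v)

    fixed : ∀ v → q (rename (root v)) ≡ rename (root v)
    fixed v with root v ≟ w
    ... | yes _  = trans (q-other ru≢w) (root-fixed u)
    ... | no r≢w = trans (q-other r≢w) (root-fixed v)

    own : ∀ v → q v ≡ v → rename (root v) ≡ v
    own v qv with v ≟ w
    ... | yes refl = contradiction (cong root (trans (sym qw) qv)) apart
    ... | no v≢w = trans (cong rename (root-root v (trans (sym (q-other v≢w)) qv))) (rename-other v≢w)

    F′ : Forest q
    F′ = record { rank = height ; root = rename ∘ root ; rank-< = height-< ; root-parent = parent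
                ; root-fixed = fixed ; root-root = own }

    half : ∀ {a b} → a ≢ b → p a ≡ b → q a ≡ b
    half {a} a≢b pa with a ≟ w
    ... | yes refl = contradiction (trans (sym pw) pa) a≢b
    ... | no a≢w   = trans (q-other a≢w) pa

    half⁻ : ∀ {a b} → q a ≡ b → p a ≡ b ⊎ (a ≡ w × b ≡ u)
    half⁻ {a} qa with a ≟ w
    ... | yes refl = inj₂ (refl , trans (sym qa) qw)
    ... | no a≢w   = inj₁ (trans (sym (q-other a≢w)) qa)

    sub : p ⊆ₑ q
    sub (a≢b , inj₁ e) = a≢b , inj₁ (half a≢b e)
    sub (a≢b , inj₂ e) = a≢b , inj₂ (half (a≢b ∘ sym) e)

    sub⁻ : ∀ {a b} → Edge q a b → Edge p a b ⊎ (a ≡ w × b ≡ u) ⊎ (a ≡ u × b ≡ w)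
    sub⁻ (a≢b , inj₁ e) with half⁻ e
    ... | inj₁ e′        = inj₁ (a≢b , inj₁ e′)
    ... | inj₂ new       = inj₂ (inj₁ new)
    sub⁻ (a≢b , inj₂ e) with half⁻ e
    ... | inj₁ e′        = inj₁ (a≢b , inj₂ e′)
    ... | inj₂ (bw , au) = inj₂ (inj₂ (au , bw))

-- Induction along the path to the root. Once `p w` has become a root, the edge between `w` and
-- `p w` can only be directed from `w` to `p w`, and one flip finishes.
reroot : {p : Fin n → Fin n} (F : Forest p) → ∀ w → Rerooted F w
reroot {p = p} F = Forest.rank-induction F (Rerooted F)
  (λ w pw → p , F , pw , id , id , id , id) up
  where
  up : ∀ w → p w ≢ w → Rerooted F (p w) → Rerooted F w
  up w ne (p₁ , F₁ , fix , sub , sub⁻ , j , j⁻) with sub (ne ∘ sym , inj₁ refl)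
  ... | _ , inj₂ p₁x = contradiction (trans (sym fix) p₁x) ne
  ... | _ , inj₁ p₁w with flip-root F₁ w (λ e → ne (trans (sym p₁w) e)) (trans (cong p₁ p₁w) (trans fix (sym p₁w)))
  ...   | p₂ , F₂ , fix₂ , sub₂ , sub₂⁻ , j₂ , j₂⁻ =
            p₂ , F₂ , fix₂ , sub₂ ∘ sub , sub⁻ ∘ sub₂⁻ , j₂ ∘ j , j⁻ ∘ j₂⁻

_⊆ₐ_ : (Fin n → Fin n) → Graph n → Set
p ⊆ₐ G = ∀ {u v} → Edge p u v → Adj G u v

-- Kruskal's procedure: an edge is added when its ends lie in different components, after one
-- component has been rerooted at its end of the edge.
join-pairs : (G : Graph n) → IsSimple G → {g : Fin n → Fin n} (F₀ : Forest g) → g ⊆ₐ G →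
             ∀ (ps : List (Fin n × Fin n)) →
             ∃ λ p → Σ (Forest p) λ F → g ⊆ₑ p × p ⊆ₐ G ×
               (∀ {u v} → (u , v) ∈ ps → Adj G u v → Forest.Joined F u v)
join-pairs G simple F₀ g⊆G [] = _ , F₀ , id , g⊆G , λ ()
join-pairs G simple F₀ g⊆G ((u , v) ∷ ps) with join-pairs G simple F₀ g⊆G ps
... | p , F , g⊆p , p⊆G , joined with Forest.root F u ≟ Forest.root F v | lookup (lookup G u) v Boolₚ.≟ true
...   | yes j | _       = p , F , g⊆p , p⊆G , λ { (here refl) _ → j ; (there m) → joined m }
...   | no _  | no ¬adj = p , F , g⊆p , p⊆G , λ { (here refl) a → contradiction a ¬adj ; (there m) → joined m }
...   | no ¬j | yes adj with reroot F v
...     | p₁ , F₁ , fix , sub₁ , sub₁⁻ , j₁ , j₁⁻ with link F₁ v u fix (¬j ∘ j₁⁻)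
...       | p₂ , F₂ , sub₂ , sub₂⁻ , j₂ , new =
  p₂ , F₂ , sub₂ ∘ sub₁ ∘ g⊆p , in-G ∘ sub₂⁻ , λ { (here refl) _ → new ; (there m) a → j₂ (j₁ (joined m a)) }
  where
  in-G : ∀ {a b} → Edge p₁ a b ⊎ (a ≡ v × b ≡ u) ⊎ (a ≡ u × b ≡ v) → Adj G a b
  in-G (inj₁ e)                    = p⊆G (sub₁⁻ e)
  in-G (inj₂ (inj₁ (refl , refl))) = proj₁ simple u v adj
  in-G (inj₂ (inj₂ (refl , refl))) = adj

-- Spanning trees as rooted trees

record RootedTree {n} (p : Fin n → Fin n) (r : Fin n) : Set where
  field
    forest   : Forest p
    root-r   : p r ≡ r
    only-r   : ∀ v → p v ≡ v → v ≡ r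
  open Forest forest public

root-tree-at : {p : Fin n → Fin n} (F : Forest p) → (∀ u v → Forest.Joined F u v) → ∀ r →
               ∃ λ q → RootedTree q r × p ⊆ₑ q × q ⊆ₑ p
root-tree-at F connected r with reroot F r
... | q , F′ , qr , sub , sub⁻ , j , _ = q , record
      { forest = F′ ; root-r = qr
      ; only-r = λ v qv → trans (sym (Forest.root-root F′ v qv)) (trans (j (connected v r)) (Forest.root-root F′ r qr)) }
    , sub , sub⁻

-- Offering all pairs of vertices to `join-pairs` joins the ends of every edge of `G`, hence any two
-- vertices along a walk.
spanning-extension : (G : Graph n) → IsSimple G → Connected G → {g : Fin n → Fin n} → Forest g → g ⊆ₐ G → ∀ r →
                     ∃ λ p → RootedTree p r × g ⊆ₑ p × p ⊆ₐ G
spanning-extension {n} G simple conn F₀ g⊆G r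
  with join-pairs G simple F₀ g⊆G (cartesianProduct (allFin n) (allFin n))
... | p , F , g⊆p , p⊆G , joined with root-tree-at F (λ u v → walk (conn u v)) r
  where
  walk : ∀ {u v} → Reachable G u v → Forest.Joined F u v
  walk here        = refl
  walk (step a rs) = trans (joined (∈ₚ.∈-cartesianProduct⁺ (∈ₚ.∈-allFin _) (∈ₚ.∈-allFin _)) a) (walk rs)
... | q , t , p⊆q , q⊆p = q , t , p⊆q ∘ g⊆p , p⊆G ∘ q⊆p

tree-graph : (Fin n → Fin n) → Graph n
tree-graph p = Vec.tabulate (λ u → Vec.tabulate (λ v → does (Edge? p u v)))

lookup-tree-graph : (p : Fin n → Fin n) → ∀ u v → lookup (lookup (tree-graph p) u) v ≡ does (Edge? p u v)
lookup-tree-graph p u v = trans (cong (λ row → lookup row v) (Vecₚ.lookup∘tabulate _ u)) (Vecₚ.lookup∘tabulate _ v)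

does⇒ : ∀ {P : Set} (d : Dec P) → does d ≡ true → P
does⇒ (yes p) _ = p

Adj⇒Edge : (p : Fin n → Fin n) → ∀ {u v} → Adj (tree-graph p) u v → Edge p u v
Adj⇒Edge p {u} {v} a = does⇒ (Edge? p u v) (trans (sym (lookup-tree-graph p u v)) a)

Edge⇒Adj : (p : Fin n → Fin n) → ∀ {u v} → Edge p u v → Adj (tree-graph p) u v
Edge⇒Adj p {u} {v} e = trans (lookup-tree-graph p u v) (dec-true (Edge? p u v) e)

-- The cases are the first, the last and an inner position. That k is at least 2 makes the
-- predecessor and the successor distinct.
cycle-neighbours : {H : Graph n} → (∀ i j → Adj H i j → Adj H j i) → (C : Cycle H) → ∀ a →
  ∃₂ λ b c → b ≢ c × Adj H (Cycle.v C a) (Cycle.v C b) × Adj H (Cycle.v C a) (Cycle.v C c)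
cycle-neighbours {H = H} symm record { k = suc (suc k) ; k≥2 = s≤s (s≤s _) ; v = v ; path = path ; close = close } zero =
  suc zero , fromℕ (suc (suc k)) , (λ ()) , path zero , symm _ _ close
cycle-neighbours {H = H} symm record { k = suc k ; k≥2 = s≤s (s≤s _) ; v = v ; path = path ; close = close } (suc t)
  with suc t in eq | view (suc t)
... | _ | ‵fromℕ = inject₁ t , zero , (λ { e → zero≢ (trans (sym eq) (cong suc (from-zero t e))) }) , subst (λ z → Adj H (v z) (v (inject₁ t))) eq (symm _ _ (path t)) , close
  where
  from-zero : ∀ {m} (t : Fin (suc m)) → inject₁ t ≡ zero → t ≡ zero
  from-zero zero _ = refl
  zero≢ : ∀ {m} → fromℕ (suc (suc m)) ≢ suc zero
  zero≢ ()
... | _ | ‵inject₁ t′ = inject₁ t , suc t′ , apart , subst (λ z → Adj H (v z) (v (inject₁ t))) eq (symm _ _ (path t)) , path t′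
  where
  apart : inject₁ t ≢ suc t′
  apart e = m≢1+n+m (toℕ t) {1} (begin
    toℕ t                     ≡⟨ Finₚ.toℕ-inject₁ t ⟨
    toℕ (inject₁ t)           ≡⟨ cong toℕ e ⟩
    suc (toℕ t′)              ≡⟨ cong suc (Finₚ.toℕ-inject₁ t′) ⟨
    suc (toℕ (inject₁ t′))    ≡⟨ cong (suc ∘ toℕ) eq ⟨
    suc (suc (toℕ t))         ∎)
    where open ≡-Reasoning

maximal : ∀ {m} (f : Fin (suc m) → ℕ) → ∃ λ a → ∀ b → f b ≤ f a
maximal f = argmax f zero (allFin _) , λ b → All.lookup (f[xs]≤f[argmax] {f = f} zero (allFin _)) (∈ₚ.∈-allFin b)

minimal : ∀ {m} (f : Fin (suc m) → ℕ) → ∃ λ a → ∀ b → f a ≤ f b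
minimal f = argmin f zero (allFin _) , λ b → All.lookup (f[argmin]≤f[xs] {f = f} zero (allFin _)) (∈ₚ.∈-allFin b)

-- Both neighbours of a vertex of maximal rank on a cycle would be its parent.
forest-acyclic : {p : Fin n → Fin n} → Forest p → {H : Graph n} → (∀ i j → Adj H i j → Adj H j i) →
                 (∀ {u v} → Adj H u v → Edge p u v) → Acyclic H
forest-acyclic {p = p} F symm edges C with maximal (Forest.rank F ∘ Cycle.v C)
... | a , max with cycle-neighbours symm C a
...   | b , c , b≢c , ab , ac = b≢c (Cycle.distinct C b c (trans (sym (parent b (edges ab))) (parent c (edges ac))))
  where
  v = Cycle.v C
  parent : ∀ x → Edge p (v a) (v x) → p (v a) ≡ v x
  parent x (_ , inj₁ e) = e
  parent x (ne , inj₂ e) = contradiction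
    (<-≤-trans (subst (λ z → Forest.rank F z < Forest.rank F (v x)) e (Forest.rank-< F (v x) (λ e′ → ne (trans (sym e) e′)))) (max x))
    (<-irrefl refl)

tree-graph-isTree : {p : Fin n → Fin n} {r : Fin n} → RootedTree p r → IsTree (tree-graph p)
tree-graph-isTree {p = p} {r} t = (symm , λ i a → proj₁ (Adj⇒Edge p a) refl)
                                , (λ i j → join (to-r i) (to-r j))
                                , forest-acyclic (RootedTree.forest t) symm (Adj⇒Edge p)
  where
  H = tree-graph p
  symm : ∀ i j → Adj H i j → Adj H j i
  symm i j a = Edge⇒Adj p (Edge-sym p (Adj⇒Edge p a))
  to-r : ∀ v → Reachable H v r
  to-r = Forest.rank-induction (RootedTree.forest t) (λ v → Reachable H v r)
    (λ v pv → subst (Reachable H v) (RootedTree.only-r t v pv) here)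
    (λ v ne rs → step (Edge⇒Adj p (ne ∘ sym , inj₁ refl)) rs)
  rev : ∀ {i j k} → Reachable H i j → Reachable H i k → Reachable H j k
  rev here        acc = acc
  rev (step a rs) acc = rev rs (step (symm _ _ a) acc)
  _++ʷ_ : ∀ {i j k} → Reachable H i j → Reachable H j k → Reachable H i k
  here ++ʷ q      = q
  step a rs ++ʷ q = step a (rs ++ʷ q)
  join : ∀ {i j} → Reachable H i r → Reachable H j r → Reachable H i j
  join ri rj = ri ++ʷ rev rj here

path-to-root : {p : Fin n → Fin n} (F : Forest p) → ∀ v →
  ∃ λ k → p (iterate p v k) ≡ iterate p v k × (∀ i → i < k → Forest.rank F (iterate p v (suc i)) < Forest.rank F (iterate p v i))
path-to-root {p = p} F = Forest.rank-induction F _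
  (λ v pv → 0 , pv , λ _ ())
  (λ { v ne (k , fix , dec) → suc k , fix , λ { zero _ → Forest.rank-< F v ne ; (suc i) (s≤s i<k) → dec i i<k } })

-- An edge of `H` outside the tree would close a cycle with the tree path between its ends.
-- Rerooting at `w` turns that path into the iterates of a parent function from `u`, and the
-- decreasing rank makes its vertices distinct.
spanning-subtree-full : {p : Fin n → Fin n} {r : Fin n} → RootedTree p r → (H : Graph n) → IsSimple H → Acyclic H →
                        p ⊆ₐ H → ∀ {u w} → Adj H u w → Edge p u w
spanning-subtree-full {p = p} {r} t H (symm , irr) acyclic p⊆H {u} {w} uw
  with Edge? p u w
... | yes e = e
... | no ¬e with root-tree-at (RootedTree.forest t) all-joined w
  where
  root≡r : ∀ v → RootedTree.root t v ≡ r
  root≡r v = RootedTree.only-r t _ (RootedTree.root-fixed t v)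
  all-joined : ∀ u v → RootedTree.root t u ≡ RootedTree.root t v
  all-joined u v = trans (root≡r u) (sym (root≡r v))
... | q , t′ , p⊆q , q⊆p with path-to-root (RootedTree.forest t′) u
...   | k , fix , dec = contradiction cyc acyclic
  where
  rank = RootedTree.rank t′
  at : ℕ → _
  at = iterate q u
  end : at k ≡ w
  end = RootedTree.only-r t′ _ fix
  later : ∀ i j → i < j → j ≤ k → rank (at j) < rank (at i)
  later i (suc j) (s≤s i≤j) j<k with m≤n⇒m<n∨m≡n i≤j
  ... | inj₁ i<j  = <-trans (dec j j<k) (later i j i<j (<⇒≤ j<k))
  ... | inj₂ refl = dec j j<k
  apart : ∀ i j → i < j → j ≤ k → at i ≢ at j
  apart i j i<j j≤k e = <-irrefl (cong rank (sym e)) (later i j i<j j≤k)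
  edge : ∀ i → i < k → Edge q (at i) (at (suc i))
  edge i i<k = apart i (suc i) ≤-refl i<k , inj₁ (sym (iterate-suc q u i))
  -- Length 0 would make the edge a loop, and length 1 would make it an edge of the tree.
  long : ∀ k → at k ≡ w → (∀ i → i < k → Edge q (at i) (at (suc i))) → 2 ≤ k
  long 0 e _ = contradiction (subst (Adj H u) (sym e) uw) (irr u)
  long 1 e h = contradiction (q⊆p (subst (Edge q u) e (h 0 (s≤s z≤n)))) ¬e
  long (suc (suc _)) _ _ = s≤s (s≤s z≤n)
  bound : ∀ (a : Fin (suc k)) → toℕ a ≤ k
  bound a = ≤-pred (Finₚ.toℕ<n a)
  cyc : Cycle H
  cyc = record
    { k = k ; k≥2 = long k end edge ; v = λ a → at (toℕ a)
    ; distinct = λ a b e → Finₚ.toℕ-injective (case a b e)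
    ; path = λ i → subst (λ m → Adj H (at m) (at (suc (toℕ i)))) (sym (Finₚ.toℕ-inject₁ i)) (p⊆H (q⊆p (edge (toℕ i) (Finₚ.toℕ<n i))))
    ; close = subst (λ x → Adj H x u) (sym (trans (cong at (Finₚ.toℕ-fromℕ k)) end)) (symm u w uw) }
    where
    case : ∀ a b → at (toℕ a) ≡ at (toℕ b) → toℕ a ≡ toℕ b
    case a b e with <-cmp (toℕ a) (toℕ b)
    ... | tri< lt _ _ = contradiction e (apart _ _ lt (bound b))
    ... | tri≈ _ eq _ = eq
    ... | tri> _ _ gt = contradiction (sym e) (apart _ _ gt (bound a))

-- The edgeless forest `id` extends to a spanning tree inside `H`; as `H` is acyclic, that tree has
-- all edges of `H`.
rooted-tree-of : (H : Graph n) → IsTree H → ∀ r → ∃ λ p → RootedTree p r × (∀ {u v} → Adj H u v ⇔ Edge p u v)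
rooted-tree-of H (simple , conn , acyclic) r
  with spanning-extension H simple conn id-forest (λ (ne , e) → contradiction ([ id , sym ]′ e) ne) r
... | p , t , _ , p⊆H = p , t , mk⇔ (spanning-subtree-full t H simple acyclic p⊆H) p⊆H

graph-ext : {H H′ : Graph n} → (∀ {u v} → Adj H u v ⇔ Adj H′ u v) → H ≡ H′
graph-ext {H = H} {H′} eq = vec-ext λ u → vec-ext λ v → Boolₚ.⇔→≡ {lookup (lookup H u) v} {lookup (lookup H′ u) v} {true} eq

-- Cycles of a self-map

periodic-∀ : (φ : A → A) → ∀ {v} k → iterate φ v (suc k) ≡ v → (P : A → Set) →
             (∀ i → i ≤ k → P (iterate φ v i)) → ∀ i → P (iterate φ v i)
periodic-∀ φ {v} k per P h i = go i i ≤-refl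
  where
  go : ∀ N i → i ≤ N → P (iterate φ v i)
  go N i i≤N with i ≤? k
  go N       i i≤N | yes i≤k = h i i≤k
  go zero    i i≤N | no i≰k  = contradiction (≤-trans i≤N z≤n) i≰k
  go (suc N) i i≤N | no i≰k  = subst P shift (go N (i ∸ suc k) (≤-pred (<-≤-trans (shorter i≰k) i≤N)))
    where
    shorter : ¬ i ≤ k → i ∸ suc k < i
    shorter i≰k = ∸-monoʳ-< {i} {suc k} {0} (s≤s z≤n) (≰⇒> i≰k)
    shift : iterate φ v (i ∸ suc k) ≡ iterate φ v i
    shift = begin
      iterate φ v (i ∸ suc k)                         ≡⟨ cong (λ z → iterate φ z (i ∸ suc k)) per ⟨
      iterate φ (iterate φ v (suc k)) (i ∸ suc k)     ≡⟨ iterate-+ φ v (suc k) _ ⟨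
      iterate φ v (suc k + (i ∸ suc k))               ≡⟨ cong (iterate φ v) (m+[n∸m]≡n (≰⇒> i≰k)) ⟩
      iterate φ v i                                   ∎
      where open ≡-Reasoning

periodic-multiple : (φ : A → A) → ∀ {v} k → iterate φ v (suc k) ≡ v → ∀ i → iterate φ v (i * suc k) ≡ v
periodic-multiple φ k per zero    = refl
periodic-multiple φ {v} k per (suc i) = trans (iterate-+ φ v (suc k) (i * suc k))
  (trans (cong (λ z → iterate φ z (i * suc k)) per) (periodic-multiple φ k per i))

-- The i steps made and the i k steps added amount to i full periods; this leads back to `v` without
-- subtraction.
periodic-return : (φ : A → A) → ∀ {v} k → iterate φ v (suc k) ≡ v → ∀ i → iterate φ (iterate φ v i) (i * k) ≡ v
periodic-return φ {v} k per i = trans (sym (iterate-+ φ v i (i * k)))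
  (trans (cong (iterate φ v) (sym (*-suc i k))) (periodic-multiple φ k per i))

periodic-gap : (φ : A → A) → ∀ {v} k → iterate φ v (suc k) ≡ v → ∀ i d →
               iterate φ v i ≡ iterate φ v (i + d) → iterate φ v d ≡ v
periodic-gap φ {v} k per i d e = begin
  iterate φ v d                                  ≡⟨ cong (λ z → iterate φ z d) (periodic-return φ k per i) ⟨
  iterate φ (iterate φ (iterate φ v i) c) d      ≡⟨ iterate-+ φ (iterate φ v i) c d ⟨
  iterate φ (iterate φ v i) (c + d)              ≡⟨ cong (iterate φ (iterate φ v i)) (+-comm c d) ⟩
  iterate φ (iterate φ v i) (d + c)              ≡⟨ iterate-+ φ (iterate φ v i) d c ⟩
  iterate φ (iterate φ (iterate φ v i) d) c      ≡⟨ cong (λ z → iterate φ z c) (iterate-+ φ v i d) ⟨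
  iterate φ (iterate φ v (i + d)) c              ≡⟨ cong (λ z → iterate φ z c) e ⟨
  iterate φ (iterate φ v i) c                    ≡⟨ periodic-return φ k per i ⟩
  v                                              ∎
  where
  open ≡-Reasoning
  c = i * k

-- Selects the least vertex of each cycle. A cycle has at most n vertices, so letting k range over
-- `Fin n` sees all of it and keeps the property decidable.
CycleMin : (Fin n → Fin n) → Fin n → Set
CycleMin {n} φ v = (∃ λ (k : Fin n) → iterate φ v (suc (toℕ k)) ≡ v) × (∀ (k : Fin n) → toℕ v ≤ toℕ (iterate φ v (toℕ k)))

cycleMin? : (φ : Fin n → Fin n) → ∀ v → Dec (CycleMin φ v)
cycleMin? φ v = Finₚ.any? (λ k → iterate φ v (suc (toℕ k)) ≟ v) ×-dec Finₚ.all? (λ k → toℕ v ≤? toℕ (iterate φ v (toℕ k)))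

cycleMin-≤ : (φ : Fin n → Fin n) → ∀ {v} → CycleMin φ v → ∀ i → toℕ v ≤ toℕ (iterate φ v i)
cycleMin-≤ φ {v} ((k , per) , min) = periodic-∀ φ (toℕ k) per (λ u → toℕ v ≤ toℕ u)
  (λ i i≤k → subst (λ j → toℕ v ≤ toℕ (iterate φ v j)) (Finₚ.toℕ-fromℕ< (≤-<-trans i≤k (Finₚ.toℕ<n k)))
    (min (fromℕ< (≤-<-trans i≤k (Finₚ.toℕ<n k)))))

orbit-minimum-cycleMin : (φ : Fin n → Fin n) → ∀ {u} k → k < n → iterate φ u (suc k) ≡ u →
                         ∀ (a : Fin (suc k)) → (∀ (b : Fin (suc k)) → toℕ (iterate φ u (toℕ a)) ≤ toℕ (iterate φ u (toℕ b))) →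
                         CycleMin φ (iterate φ u (toℕ a))
orbit-minimum-cycleMin {n} φ {u} k k<n per-u a min = (fromℕ< k<n , per-w) , λ b → w-min (toℕ b)
  where
  open ≡-Reasoning
  w = iterate φ u (toℕ a)
  per-w : iterate φ w (suc (toℕ (fromℕ< k<n))) ≡ w
  per-w = begin
    iterate φ w (suc (toℕ (fromℕ< k<n)))      ≡⟨ cong (λ d → iterate φ w (suc d)) (Finₚ.toℕ-fromℕ< k<n) ⟩
    iterate φ w (suc k)                       ≡⟨ iterate-+ φ u (toℕ a) (suc k) ⟨
    iterate φ u (toℕ a + suc k)               ≡⟨ cong (iterate φ u) (+-comm (toℕ a) (suc k)) ⟩
    iterate φ u (suc k + toℕ a)               ≡⟨ iterate-+ φ u (suc k) (toℕ a) ⟩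
    iterate φ (iterate φ u (suc k)) (toℕ a)   ≡⟨ cong (λ z → iterate φ z (toℕ a)) per-u ⟩
    w                                         ∎
  u-min : ∀ b → toℕ w ≤ toℕ (iterate φ u b)
  u-min = periodic-∀ φ k per-u (λ z → toℕ w ≤ toℕ z)
    (λ b b≤k → subst (λ c → toℕ w ≤ toℕ (iterate φ u c)) (Finₚ.toℕ-fromℕ< (s≤s b≤k)) (min (fromℕ< (s≤s b≤k))))
  w-min : ∀ b → toℕ w ≤ toℕ (iterate φ w b)
  w-min b = subst (λ z → toℕ w ≤ toℕ z) (iterate-+ φ u (toℕ a) b) (u-min (toℕ a + b))

-- By the pigeonhole principle the orbit enters its cycle within n steps, and within n further steps
-- it passes the least vertex of that cycle.
reaches-cycleMin : (φ : Fin n → Fin n) → ∀ v → ∃ λ i → i ≤ n + n × CycleMin φ (iterate φ v i)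
reaches-cycleMin {n} φ v = from-repeat (Finₚ.pigeonhole (n<1+n n) (λ i → iterate φ v (toℕ i)))
  where
  from-repeat : (∃₂ λ (i j : Fin (suc n)) → toℕ i < toℕ j × iterate φ v (toℕ i) ≡ iterate φ v (toℕ j)) →
                ∃ λ i → i ≤ n + n × CycleMin φ (iterate φ v i)
  from-repeat (i , j , i<j , same) = from-minimal (minimal (λ b → toℕ (iterate φ u (toℕ b))))
    where
    u = iterate φ v (toℕ i)
    k = toℕ j ∸ suc (toℕ i)
    j≤n : toℕ j ≤ n
    j≤n = ≤-pred (Finₚ.toℕ<n j)
    i+k≡j : toℕ i + suc k ≡ toℕ j
    i+k≡j = trans (+-suc (toℕ i) k) (m+[n∸m]≡n i<j)
    k<n : k < n
    k<n = ≤-trans (m≤n+m (suc k) (toℕ i)) (subst (_≤ n) (sym i+k≡j) j≤n)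
    per-u : iterate φ u (suc k) ≡ u
    per-u = trans (sym (iterate-+ φ v (toℕ i) (suc k))) (trans (cong (iterate φ v) i+k≡j) (sym same))
    from-minimal : (∃ λ (a : Fin (suc k)) → ∀ b → toℕ (iterate φ u (toℕ a)) ≤ toℕ (iterate φ u (toℕ b))) →
                   ∃ λ i → i ≤ n + n × CycleMin φ (iterate φ v i)
    from-minimal (a , min) = toℕ i + toℕ a
      , +-mono-≤ (≤-pred (Finₚ.toℕ<n i)) (≤-trans (≤-pred (Finₚ.toℕ<n a)) (<⇒≤ k<n))
      , subst (CycleMin φ) (sym (iterate-+ φ v (toℕ i) (toℕ a))) (orbit-minimum-cycleMin φ k k<n per-u a min)

first : (ℕ → Bool) → ℕ → ℕ
first P zero    = 0
first P (suc N) = if P 0 then 0 else suc (first (P ∘ suc) N)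

first≤ : ∀ P N → first P N ≤ N
first≤ P zero = z≤n
first≤ P (suc N) with P 0
... | true  = z≤n
... | false = s≤s (first≤ (P ∘ suc) N)

first-hit : ∀ P N i → i ≤ N → P i ≡ true → P (first P N) ≡ true × first P N ≤ i
first-hit P zero    .0 z≤n  Pi = Pi , z≤n
first-hit P (suc N) i  i≤N  Pi with P 0 in P0
... | true  = P0 , z≤n
first-hit P (suc N) zero    i≤N       Pi | false with () ← trans (sym P0) Pi
first-hit P (suc N) (suc i) (s≤s i≤N) Pi | false with first-hit (P ∘ suc) N i i≤N Pi
... | hit , le = hit , s≤s le

-- The waiting time until the first hit is going to be the rank of a forest; one step along the
-- orbit must shorten it.
first-shift : ∀ P N i → i ≤ N → P i ≡ true → P 0 ≡ false → first (P ∘ suc) N < first P N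
first-shift P N i i≤N Pi P0 with first P N | first-hit P N i i≤N Pi | first≤ P N
... | zero  | hit , _ | _  with () ← trans (sym P0) hit
... | suc r | hit , _ | r< = s≤s (proj₂ (first-hit (P ∘ suc) N r (<⇒≤ r<) hit))

isCycleMin : (Fin n → Fin n) → Fin n → Bool
isCycleMin φ v = does (cycleMin? φ v)

cut : (Fin n → Fin n) → Fin n → Fin n
cut φ v = if isCycleMin φ v then v else φ v

-- The rank of a vertex is the number of steps until its orbit meets the least vertex of a cycle,
-- where the outgoing arc has been cut.
cut-forest : (φ : Fin n → Fin n) → Forest (cut φ)
cut-forest {n} φ = forest-from-rank (cut φ) rank (n + n) (λ v → first≤ (hits v) (n + n)) (λ v → rank-< v (isCycleMin φ v) refl)
  where
  hits : Fin n → ℕ → Bool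
  hits v i = isCycleMin φ (iterate φ v i)
  rank : Fin n → ℕ
  rank v = first (hits v) (n + n)
  rank-< : ∀ v b → isCycleMin φ v ≡ b → (if b then v else φ v) ≢ v → rank (if b then v else φ v) < rank v
  rank-< v true  eq ne = contradiction refl ne
  rank-< v false eq ne = let i , i≤ , c = reaches-cycleMin φ v in
    first-shift (hits v) (n + n) i i≤ (dec-true (cycleMin? φ (iterate φ v i)) c) eq

Short : ℕ → (Fin n → Fin n) → Fin n → Set
Short K φ v = ∃ λ (k : Fin K) → iterate φ v (suc (toℕ k)) ≡ v

short? : ∀ K (φ : Fin n → Fin n) v → Dec (Short K φ v)
short? K φ v = Finₚ.any? (λ k → iterate φ v (suc (toℕ k)) ≟ v)

-- Each selected vertex claims the first `K` vertices of its orbit. A repetition within one orbit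
-- would give a return after at most `K` steps, and two orbits that meet run along the same cycle
-- and have the same least vertex.
long-cycles : ∀ K (φ : Fin n → Fin n) → # (λ v → isCycleMin φ v ∧ not (does (short? K φ v))) * K ≤ n
long-cycles {n} K φ = begin
  # long * K                                              ≡⟨ cong₂ _*_ (length-elems long) (Listₚ.length-upTo K) ⟨
  length (elems long) * length (upTo K)                   ≡⟨ length-cartesianProductWith _,_ (elems long) (upTo K) ⟨
  length (cartesianProduct (elems long) (upTo K))         ≤⟨ injection-length≤ R inj
                                                               (Uniqueₚ.cartesianProduct⁺ (elems-unique long) (Uniqueₚ.upTo⁺ K)) total ⟩
  length (allFin n)                                       ≡⟨ Listₚ.length-tabulate id ⟩
  n                                                       ∎
  where
  open ≤-Reasoning
  long : Fin n → Bool
  long v = isCycleMin φ v ∧ not (does (short? K φ v))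
  R : Fin n × ℕ → Fin n → Set
  R (v , i) x = CycleMin φ v × ¬ Short K φ v × i < K × iterate φ v i ≡ x
  total : ∀ {vi} → vi ∈ cartesianProduct (elems long) (upTo K) → ∃ λ x → x ∈ allFin n × R vi x
  total {v , i} vi∈ with ∈ₚ.∈-cartesianProduct⁻ (elems long) (upTo K) vi∈
  ... | v∈ , i∈ = _ , ∈ₚ.∈-allFin _ , does⇒ (cycleMin? φ v) (Boolₚ.∧-conicalˡ _ _ lv)
                , (λ s → not≢ (dec-true (short? K φ v) s) (Boolₚ.∧-conicalʳ _ _ lv)) , ∈ₚ.∈-upTo⁻ i∈ , refl
    where
    lv = ∈-elems⁻ long v∈
    not≢ : ∀ {b} → b ≡ true → not b ≢ true
    not≢ refl ()
  below : ∀ {v v′ i i′} → CycleMin φ v → CycleMin φ v′ → iterate φ v i ≡ iterate φ v′ i′ → toℕ v ≤ toℕ v′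
  below {v} {v′} {i} {i′} c ((k , per) , _) e = subst (λ z → toℕ v ≤ toℕ z)
    (trans (iterate-+ φ v i _) (trans (cong (λ z → iterate φ z (i′ * toℕ k)) e) (periodic-return φ (toℕ k) per i′)))
    (cycleMin-≤ φ c (i + i′ * toℕ k))
  order : ∀ {v i i′} → CycleMin φ v → ¬ Short K φ v → i′ < K → iterate φ v i ≡ iterate φ v i′ → ¬ i < i′
  order {v} {i} {i′} ((k , per) , _) ¬s i′<K e i<i′ = ¬s (fromℕ< d<K , subst (λ d → iterate φ v (suc d) ≡ v) (sym (Finₚ.toℕ-fromℕ< d<K))
    (periodic-gap φ (toℕ k) per i (suc d) (trans e (cong (iterate φ v) (sym i+d)))))
    where
    d = i′ ∸ suc i
    i+d : i + suc d ≡ i′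
    i+d = trans (+-suc i d) (m+[n∸m]≡n i<i′)
    d<K : d < K
    d<K = ≤-<-trans (m∸n≤m i′ (suc i)) i′<K
  inj : ∀ {vi vi′ x} → R vi x → R vi′ x → vi ≡ vi′
  inj {v , i} {v′ , i′} (c , s , i<K , e) (c′ , s′ , i′<K , e′)
    with Finₚ.toℕ-injective (≤-antisym (below {i = i} {i′} c c′ (trans e (sym e′))) (below {i = i′} {i} c′ c (trans e′ (sym e))))
  ... | refl with <-cmp i i′
  ...   | tri< lt _ _   = contradiction lt (order c s i′<K (trans e (sym e′)))
  ...   | tri≈ _ refl _ = refl
  ...   | tri> _ _ gt   = contradiction gt (order c s i<K (trans e′ (sym e)))

#-cycleMin : ∀ K (φ : Fin n → Fin n) → # (isCycleMin φ) * K ≤ # (λ v → does (short? K φ v)) * K + n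
#-cycleMin {n} K φ = begin
  # (isCycleMin φ) * K         ≤⟨ *-monoˡ-≤ K (sum-mono (λ v → split (isCycleMin φ v) (does (short? K φ v)))) ⟩
  sum (λ v → ind (short v) + ind (long v)) * K  ≡⟨ cong (_* K) (∑-distrib-+ (ind ∘ short) (ind ∘ long)) ⟩
  (# short + # long) * K       ≡⟨ *-distribʳ-+ K (# short) (# long) ⟩
  # short * K + # long * K     ≤⟨ +-monoʳ-≤ (# short * K) (long-cycles K φ) ⟩
  # short * K + n              ∎
  where
  open ≤-Reasoning
  short long : Fin n → Bool
  short v = does (short? K φ v)
  long v = isCycleMin φ v ∧ not (short v)
  split : ∀ a b → ind a ≤ ind b + ind (a ∧ not b)
  split false b     = z≤n
  split true  true  = ≤-refl
  split true  false = ≤-refl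

-- Self-maps along edges and their short cycles

lookup-injective : {xs : List A} → Unique xs → ∀ i j → List.lookup xs i ≡ List.lookup xs j → i ≡ j
lookup-injective (x∉ ∷ u) zero    zero    e = refl
lookup-injective (x∉ ∷ u) zero    (suc j) e = contradiction e (All.lookup x∉ (∈ₚ.∈-lookup j))
lookup-injective (x∉ ∷ u) (suc i) zero    e = contradiction (sym e) (All.lookup x∉ (∈ₚ.∈-lookup i))
lookup-injective (x∉ ∷ u) (suc i) (suc j) e = cong suc (lookup-injective u i j e)

neighbours : Graph n → Fin n → List (Fin n)
neighbours G v = elems (lookup (lookup G v))

length-neighbours : (G : Graph n) → ∀ v → length (neighbours G v) ≡ deg G v
length-neighbours G v = trans (length-elems (lookup (lookup G v))) (#≡trues (lookup G v))
  where
  #≡trues : ∀ {m} (row : Vec Bool m) → # (lookup row) ≡ trues row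
  #≡trues []            = refl
  #≡trues (true ∷ row)  = cong suc (#≡trues row)
  #≡trues (false ∷ row) = #≡trues row

self-maps : Graph n → List (Vec (Fin n) n)
self-maps G = vectors (neighbours G)

-- The index k means a return at step k + 1.
FirstReturn : ℕ → Fin n → (Fin n → Fin n) → Set
FirstReturn k v φ = iterate φ v (suc k) ≡ v × (∀ (i : Fin k) → iterate φ v (toℕ i) ≢ iterate φ v k)

firstReturn? : ∀ k (v : Fin n) φ → Dec (FirstReturn k v φ)
firstReturn? k v φ = (iterate φ v (suc k) ≟ v) ×-dec Finₚ.all? (λ i → ¬? (iterate φ v (toℕ i) ≟ iterate φ v k))

-- By descent: if the last vertex before the return was already visited at step i, then the return
-- happens as early as step i + 1.
first-return : (φ : Fin n → Fin n) → ∀ {v} K → Short K φ v → ∃ λ (k : Fin K) → FirstReturn (toℕ k) v φ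
first-return {n} φ {v} K (k , per) = go K (toℕ k) (Finₚ.toℕ<n k) (Finₚ.toℕ<n k) per
  where
  Result = ∃ λ (k : Fin K) → FirstReturn (toℕ k) v φ
  go : ∀ N k → k < N → k < K → iterate φ v (suc k) ≡ v → Result
  decide : ∀ N k → k < suc N → k < K → iterate φ v (suc k) ≡ v → Dec (∃ λ (i : Fin k) → iterate φ v (toℕ i) ≡ iterate φ v k) → Result
  go (suc N) k k<N k<K per = decide N k k<N k<K per (Finₚ.any? (λ i → iterate φ v (toℕ i) ≟ iterate φ v k))
  decide N k k<N k<K per (no ne) = fromℕ< k<K
    , subst (λ k → FirstReturn k v φ) (sym (Finₚ.toℕ-fromℕ< k<K)) (per , λ i e → ne (i , e))
  decide N k k<N k<K per (yes (i , e)) = go N (toℕ i) (<-≤-trans (Finₚ.toℕ<n i) (≤-pred k<N)) (<-trans (Finₚ.toℕ<n i) k<K)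
    (trans (iterate-suc φ v (toℕ i)) (trans (cong φ e) (trans (sym (iterate-suc φ v k)) per)))

-- The last arc of the return path can be redirected to any neighbour; the original map is recovered from the
-- result, since the redirection does not affect the earlier steps of the path.
first-return-bound : (G : Graph n) → ∀ m → (∀ v → m ≤ deg G v) → ∀ k v X → Unique X →
                     (∀ {f} → f ∈ X → f ∈ self-maps G × FirstReturn k v (lookup f)) →
                     length X * m ≤ length (self-maps G)
first-return-bound {n} G m m≤ k v X uX good = subst (_≤ length (self-maps G))
  (trans (length-cartesianProductWith _,_ X (allFin m)) (cong (length X *_) (Listₚ.length-tabulate {n = m} id)))
  (injection-length≤ R inj (Uniqueₚ.cartesianProduct⁺ uX (Uniqueₚ.allFin⁺ m)) total)
  where
  open ≡-Reasoning
  last : Vec (Fin n) n → Fin n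
  last f = iterate (lookup f) v k
  choice : Vec (Fin n) n → Fin m → Fin n
  -- Only the first `m` neighbours are offered, so that every map has the same number of
  -- redirections.
  choice f i = List.lookup (neighbours G (last f)) (Fin.inject≤ i (subst (m ≤_) (sym (length-neighbours G (last f))) (m≤ (last f))))
  redirect : Vec (Fin n) n → Fin m → Vec (Fin n) n
  redirect f i = f Vec.[ last f ]≔ choice f i
  R : Vec (Fin n) n × Fin m → Vec (Fin n) n → Set
  R (f , i) f′ = FirstReturn k v (lookup f) × f′ ≡ redirect f i
  total : ∀ {fi} → fi ∈ cartesianProduct X (allFin m) → ∃ λ f′ → f′ ∈ self-maps G × R fi f′
  total {f , i} fi∈ with ∈ₚ.∈-cartesianProduct⁻ X (allFin m) fi∈
  ... | f∈ , _ = redirect f i , ∈-vectors⁺ (neighbours G) _ stays , proj₂ (good f∈) , refl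
    where
    stays : ∀ j → lookup (redirect f i) j ∈ neighbours G j
    stays j with j ≟ last f
    ... | yes refl = subst (_∈ neighbours G j) (sym (Vecₚ.lookup∘update j f (choice f i))) (∈ₚ.∈-lookup _)
    ... | no ne    = subst (_∈ neighbours G j) (sym (Vecₚ.lookup∘update′ ne f (choice f i)))
                       (∈-vectors⁻ (neighbours G) f (proj₁ (good f∈)) j)
  same-path : ∀ f i → FirstReturn k v (lookup f) → ∀ j → j ≤ k → iterate (lookup (redirect f i)) v j ≡ iterate (lookup f) v j
  same-path f i ret zero    j≤k = refl
  same-path f i (ret , new) (suc j) j<k = begin
    iterate φ′ v (suc j)            ≡⟨ iterate-suc φ′ v j ⟩
    φ′ (iterate φ′ v j)             ≡⟨ cong φ′ (same-path f i (ret , new) j (<⇒≤ j<k)) ⟩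
    φ′ (iterate (lookup f) v j)     ≡⟨ Vecₚ.lookup∘update′ (subst (λ j → iterate (lookup f) v j ≢ last f) (Finₚ.toℕ-fromℕ< j<k) (new (fromℕ< j<k))) f (choice f i) ⟩
    lookup f (iterate (lookup f) v j) ≡⟨ iterate-suc (lookup f) v j ⟨
    iterate (lookup f) v (suc j)    ∎
    where φ′ = lookup (redirect f i)
  inj : ∀ {fi gj f′} → R fi f′ → R gj f′ → fi ≡ gj
  inj {f , i} {g , j} (rf , refl) (rg , e) = cong₂ _,_ f≡g (lookup-choice f≡g)
    where
    same-last : last f ≡ last g
    same-last = begin
      last f                              ≡⟨ same-path f i rf k ≤-refl ⟨
      iterate (lookup (redirect f i)) v k ≡⟨ cong (λ h → iterate (lookup h) v k) e ⟩
      iterate (lookup (redirect g j)) v k ≡⟨ same-path g j rg k ≤-refl ⟩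
      last g                              ∎
    -- The value lost by the redirection is known in advance: it was `v`.
    back : ∀ f → FirstReturn k v (lookup f) → lookup f (last f) ≡ v
    back f (ret , _) = trans (sym (iterate-suc (lookup f) v k)) ret
    f≡g : f ≡ g
    f≡g = vec-ext agree
      where
      agree : ∀ x → lookup f x ≡ lookup g x
      agree x with x ≟ last f
      ... | yes refl = trans (back f rf) (trans (sym (back g rg)) (cong (lookup g) (sym same-last)))
      ... | no ne    = begin
        lookup f x               ≡⟨ Vecₚ.lookup∘update′ ne f (choice f i) ⟨
        lookup (redirect f i) x  ≡⟨ cong (λ h → lookup h x) e ⟩
        lookup (redirect g j) x  ≡⟨ Vecₚ.lookup∘update′ (λ x≡ → ne (trans x≡ (sym same-last))) g (choice g j) ⟩
        lookup g x               ∎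
    lookup-choice : f ≡ g → i ≡ j
    lookup-choice refl = Finₚ.inject≤-injective _ _ i j (lookup-injective (elems-unique (lookup (lookup G (last f)))) _ _
      (begin
        choice f i                           ≡⟨ Vecₚ.lookup∘update (last f) f (choice f i) ⟨
        lookup (redirect f i) (last f)       ≡⟨ cong (λ h → lookup h (last f)) e ⟩
        lookup (redirect f j) (last f)       ≡⟨ Vecₚ.lookup∘update (last f) f (choice f j) ⟩
        choice f j                           ∎))

shortCount : ℕ → (Fin n → Fin n) → ℕ
shortCount K φ = # (λ v → does (short? K φ v))

-- The first moment bound. For a uniformly random self-map, a vertex has a given first return time
-- with probability at most 1/m, so it lies on a cycle of length at most `K` with probability at
-- most K/m.
short-average : (G : Graph n) → ∀ m → (∀ v → m ≤ deg G v) → ∀ K t X → Unique X →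
                (∀ {f} → f ∈ X → f ∈ self-maps G × t ≤ shortCount K (lookup f) * K) →
                length X * t * m ≤ n * (K * length (self-maps G)) * K
short-average {n} G m m≤ K t X uX h = begin
  length X * t * m                                                   ≤⟨ *-monoˡ-≤ m (length*≤sum-filter P? t K X (All.tabulate (λ f∈ → proj₂ (h f∈)))) ⟩
  sum (λ v → length (filter (P? v) X)) * K * m                       ≡⟨ solve 3 (λ a b c → a :* b :* c := a :* c :* b) refl (sum (λ v → length (filter (P? v) X))) K m ⟩
  sum (λ v → length (filter (P? v) X)) * m * K                       ≡⟨ cong (_* K) (sum-*ʳ (λ v → length (filter (P? v) X)) m) ⟩
  sum (λ v → length (filter (P? v) X) * m) * K                       ≤⟨ *-monoˡ-≤ K (sum-mono at) ⟩
  sum {n} (λ v → K * length (self-maps G)) * K                       ≡⟨ cong (_* K) (sum-const n (K * length (self-maps G))) ⟩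
  n * (K * length (self-maps G)) * K                                 ∎
  where
  open ≤-Reasoning
  P? = λ v (f : Vec (Fin n) n) → short? K (lookup f) v
  at : ∀ v → length (filter (P? v) X) * m ≤ K * length (self-maps G)
  at v = begin
    length Xᵥ * m                                            ≤⟨ *-monoˡ-≤ m (length≤sum-filter Q? Xᵥ (All.map (first-return _ K) (Allₚ.all-filter (P? v) X))) ⟩
    sum (λ k → length (filter (Q? k) Xᵥ)) * m                ≡⟨ sum-*ʳ (λ k → length (filter (Q? k) Xᵥ)) m ⟩
    sum (λ k → length (filter (Q? k) Xᵥ) * m)                ≤⟨ sum-mono (λ k → first-return-bound G m m≤ (toℕ k) v _
                                                                 (Uniqueₚ.filter⁺ (Q? k) (Uniqueₚ.filter⁺ (P? v) uX))
                                                                 (λ f∈ → let f∈Xᵥ , r = ∈ₚ.∈-filter⁻ (Q? k) {xs = Xᵥ} f∈ in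
                                                                         proj₁ (h (proj₁ (∈ₚ.∈-filter⁻ (P? v) {xs = X} f∈Xᵥ))) , r)) ⟩
    sum {K} (λ k → length (self-maps G))                     ≡⟨ sum-const K _ ⟩
    K * length (self-maps G)                                 ∎
    where
    Xᵥ = filter (P? v) X
    Q? = λ (k : Fin K) (f : Vec (Fin n) n) → firstReturn? (toℕ k) v (lookup f)

-- Markov's inequality
few-short-cycles : (G : Graph n) → ∀ m → (∀ v → m ≤ deg G v) → ∀ K → K * K ≤ m → 1 ≤ n → 1 ≤ m →
  length (self-maps G) ≤ 2 * length (filter (λ f → shortCount K (lookup f) * K ≤? 2 * n) (self-maps G))
few-short-cycles {n} G m m≤ K K²≤m n≥1 m≥1 = combine (length F) (length (filter good? F)) (length bad) (filter-split good? F) 2bad≤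
  where
  open ≤-Reasoning
  F = self-maps G
  good? = λ (f : Vec (Fin n) n) → shortCount K (lookup f) * K ≤? 2 * n
  bad = filter (λ f → ¬? (good? f)) F
  2bad≤ : length bad * 2 ≤ length F
  2bad≤ = *-cancelʳ-≤ (length bad * 2) (length F) (n * m) {{>-nonZero (*-mono-≤ n≥1 m≥1)}} (begin
    length bad * 2 * (n * m)          ≡⟨ solve 3 (λ b n m → b :* con 2 :* (n :* m) := b :* (con 2 :* n) :* m) refl (length bad) n m ⟩
    length bad * (2 * n) * m          ≤⟨ short-average G m m≤ K (2 * n) bad (Uniqueₚ.filter⁺ (λ f → ¬? (good? f)) (vectors-unique (neighbours G) (λ v → elems-unique (lookup (lookup G v)))))
                                           (λ f∈ → let f∈F , ¬good = ∈ₚ.∈-filter⁻ (λ f → ¬? (good? f)) {xs = F} f∈ in f∈F , <⇒≤ (≰⇒> ¬good)) ⟩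
    n * (K * length F) * K            ≡⟨ solve 3 (λ n k l → n :* (k :* l) :* k := l :* (n :* (k :* k))) refl n K (length F) ⟩
    -- As K² ≤ m, the mean of `shortCount` times `K` is at most n, so it can exceed 2 n for at most
    -- half of the maps.
    length F * (n * (K * K))          ≤⟨ *-monoʳ-≤ (length F) (*-monoʳ-≤ n K²≤m) ⟩
    length F * (n * m)                ∎)
  combine : ∀ f g b → f ≡ g + b → b * 2 ≤ f → f ≤ 2 * g
  combine .(g + b) g b refl h = subst (g + b ≤_) (cong (g +_) (sym (+-identityʳ g)))
    (+-monoʳ-≤ g (+-cancelʳ-≤ b b g (subst (_≤ g + b) (solve 1 (λ b → b :* con 2 := b :+ b) refl b) h)))

-- Encoding self-maps by spanning trees

mark : (Fin n → Bool) → (Fin n → A) → Vec (Maybe A) n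
mark b x = Vec.tabulate (λ v → if b v then just (x v) else nothing)

justs-mark : (b : Fin n → Bool) (x : Fin n → A) → justs (mark b x) ≡ # b
justs-mark {zero}  b x = refl
justs-mark {suc n} b x with b zero
... | true  = cong suc (justs-mark (b ∘ suc) (x ∘ suc))
... | false = justs-mark (b ∘ suc) (x ∘ suc)

mark-just : (b : Fin n → Bool) (x : Fin n → A) → ∀ v {a} → lookup (mark b x) v ≡ just a → b v ≡ true × x v ≡ a
mark-just b x v e with b v | trans (sym (Vecₚ.lookup∘tabulate (λ v → if b v then just (x v) else nothing) v)) e
... | true | refl = refl , refl

mark-injective : (b b′ : Fin n → Bool) (x x′ : Fin n → A) → mark b x ≡ mark b′ x′ →
                 ∀ v → b v ≡ b′ v × (b v ≡ true → x v ≡ x′ v)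
mark-injective b b′ x x′ e v with b v | b′ v | trans (sym (Vecₚ.lookup∘tabulate (λ v → if b v then just (x v) else nothing) v))
    (trans (cong (λ c → lookup c v) e) (Vecₚ.lookup∘tabulate (λ v → if b′ v then just (x′ v) else nothing) v))
... | true  | true  | eq = refl , λ _ → just-injective eq
... | false | false | _    = refl , λ ()

#-cong : {b b′ : Fin n → Bool} → (∀ v → b v ≡ b′ v) → # b ≡ # b′
#-cong h = sum-cong-≗ (λ v → cong ind (h v))

#-not-≤ : (b b′ : Fin n → Bool) → # (not ∘ b) ≤ # (not ∘ b′) → # b′ ≤ # b
#-not-≤ b b′ h = +-cancelʳ-≤ (# (not ∘ b)) (# b′) (# b)
  (subst (# b′ + # (not ∘ b) ≤_) (trans (#-complement b′) (sym (#-complement b))) (+-monoʳ-≤ (# b′) h))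

not-true : ∀ {b} → not b ≡ true → b ≡ false
not-true {false} _ = refl

-- Each edge of g is an edge of p, charged to its endpoint farther from the root of p; this is injective.
new-edges : {g p : Fin n → Fin n} → Forest g → g ⊆ₑ p → (q : Fin n → Bool) → (∀ v → q v ≡ false → g v ≢ v) →
            # (λ w → not (does (Edge? g w (p w)))) ≤ # q
new-edges {n} {g} {p} F sub q moves = #-not-≤ q (λ w → not (does (Edge? g w (p w))))
  (≤-trans (#-injection (not ∘ q) (λ w → does (Edge? g w (p w))) child into inj)
           (≤-reflexive (#-cong {b = λ w → does (Edge? g w (p w))} (λ w → sym (Boolₚ.not-involutive (does (Edge? g w (p w))))))))
  where
  child : Fin n → Fin n
  child v = if does (p v ≟ g v) then v else g v
  edge : ∀ v → not (q v) ≡ true → Edge g v (g v)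
  edge v nq = moves v (not-true nq) ∘ sym , inj₁ refl
  child-cases : ∀ v → not (q v) ≡ true → (child v ≡ v × p v ≡ g v) ⊎ (child v ≡ g v × p (g v) ≡ v)
  child-cases v nq with p v ≟ g v | sub (edge v nq)
  ... | yes e | _          = inj₁ (refl , e)
  ... | no ne | _ , inj₁ e = contradiction e ne
  ... | no ne | _ , inj₂ e = inj₂ (refl , e)
  into : ∀ v → not (q v) ≡ true → does (Edge? g (child v) (p (child v))) ≡ true
  into v nq with child v | child-cases v nq
  ... | _ | inj₁ (refl , e) = dec-true (Edge? g v (p v)) (subst (Edge g v) (sym e) (edge v nq))
  ... | _ | inj₂ (refl , e) = dec-true (Edge? g (g v) (p (g v))) (subst (Edge g (g v)) (sym e) (Edge-sym g (edge v nq)))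
  inj : ∀ v w → not (q v) ≡ true → not (q w) ≡ true → child v ≡ child w → v ≡ w
  inj v w nv nw e with child-cases v nv | child-cases w nw
  ... | inj₁ (cv , _)  | inj₁ (cw , _)  = trans (sym cv) (trans e cw)
  ... | inj₂ (cv , pv) | inj₂ (cw , pw) = trans (sym pv) (trans (cong p (trans (sym cv) (trans e cw))) pw)
  -- A common charge in opposite directions would make v and w parents of each other in `g`.
  ... | inj₁ (cv , pv) | inj₂ (cw , pw) = let v≡gw = trans (sym cv) (trans e cw) in
    Forest.no-2-cycle F {v} {w} (trans (sym pv) (trans (cong p v≡gw) pw)) (sym v≡gw)
  ... | inj₂ (cv , pv) | inj₁ (cw , pw) = let w≡gv = trans (sym cw) (trans (sym e) cv) in
    sym (Forest.no-2-cycle F {w} {v} (trans (sym pw) (trans (cong p w≡gv) pv)) (sym w≡gv))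

Code : ℕ → Set
Code n = Graph n × Vec (Maybe (Fin n)) n × Vec (Maybe ⊤) n

-- A tree edge outside the forest is named by its child end, so a mark without a value suffices. The
-- root of `p` is marked too, and with it there are at most as many marks as cut arcs, by
-- `new-edges`.
encode : Vec (Fin n) n → (Fin n → Fin n) → Code n
encode f p = tree-graph p
           , mark (isCycleMin (lookup f)) (lookup f)
           , mark (λ w → not (does (Edge? (cut (lookup f)) w (p w)))) (const tt)

-- All trees are rooted at the same `r`, so the undirected tree determines `p`.
Encodes : Fin n → Vec (Fin n) n → Code n → Set
Encodes r f y = (∀ v → lookup f v ≢ v) × ∃ λ p → RootedTree p r × cut (lookup f) ⊆ₑ p × y ≡ encode f p

cut-cycleMin : (φ : Fin n → Fin n) → ∀ v → isCycleMin φ v ≡ true → cut φ v ≡ v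
cut-cycleMin φ v e rewrite e = refl

cut-other : (φ : Fin n → Fin n) → ∀ v → isCycleMin φ v ≡ false → cut φ v ≡ φ v
cut-other φ v e rewrite e = refl

-- The tree gives back `p`, the marks tell which of its edges lie in the forest, and these edges
-- with the roots determine `cut φ`. The arcs missing from `cut φ` are stored with their values.
-- Both reconstructions are instances of `forest-unique`.
encodes-injective : (r : Fin n) → ∀ {f f′ y} → Encodes r f y → Encodes r f′ y → f ≡ f′
encodes-injective {n} r {f} {f′} (moves , p , t , sub , refl) (moves′ , p′ , t′ , sub′ , e) = vec-ext λ v → agree v (isCycleMin φ v) refl
  where
  φ  = lookup f
  φ′ = lookup f′
  e₁ = cong proj₁ e
  e₂ = mark-injective _ _ _ _ (cong (proj₁ ∘ proj₂) e)
  e₃ = mark-injective _ _ _ _ (cong (proj₂ ∘ proj₂) e)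
  p≗p′ : ∀ v → p v ≡ p′ v
  p≗p′ = forest-unique (RootedTree.forest t)
    (λ v pv → subst (λ z → p′ z ≡ z) (sym (RootedTree.only-r t v pv)) (RootedTree.root-r t′))
    (λ {u} {v} ed → Adj⇒Edge p′ (subst (λ H → Adj H u v) e₁ (Edge⇒Adj p ed)))
  moves-cut : ∀ v → cut φ v ≡ v → isCycleMin φ v ≡ true
  moves-cut v cv with isCycleMin φ v
  ... | true  = refl
  ... | false = contradiction cv (moves v)
  roots : ∀ v → cut φ v ≡ v → cut φ′ v ≡ v
  roots v cv = cut-cycleMin φ′ v (trans (sym (proj₁ (e₂ v))) (moves-cut v cv))
  kept : ∀ u v → p u ≡ v → Edge (cut φ) u v → Edge (cut φ′) u v
  kept u v refl ed = subst (Edge (cut φ′) u) (sym (p≗p′ u)) (does⇒ (Edge? (cut φ′) u (p′ u))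
    (Boolₚ.not-injective (trans (sym (proj₁ (e₃ u))) (cong not (dec-true (Edge? (cut φ) u (p u)) ed)))))
  cut⊆cut′ : cut φ ⊆ₑ cut φ′
  cut⊆cut′ {u} {v} ed with sub ed
  ... | _ , inj₁ pu = kept u v pu ed
  ... | _ , inj₂ pv = Edge-sym (cut φ′) (kept v u pv (Edge-sym (cut φ) ed))
  agree : ∀ v b → isCycleMin φ v ≡ b → φ v ≡ φ′ v
  agree v true  qv = proj₂ (e₂ v) qv
  agree v false qv = trans (sym (cut-other φ v qv)) (trans (forest-unique (cut-forest φ) roots cut⊆cut′ v)
    (cut-other φ′ v (trans (sym (proj₁ (e₂ v))) qv)))

∈-neighbours⇒Adj : (G : Graph n) → ∀ {u v} → v ∈ neighbours G u → Adj G u v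
∈-neighbours⇒Adj G {u} = ∈-elems⁻ (lookup (lookup G u))

-- Over a one-letter alphabet `partials` lists the subsets of at most a given size.
markers : List ⊤
markers = tt ∷ []

-- At least half of the self-maps have few short cycles, which is the factor 2. For these the number
-- of cut arcs times `K` is at most 3 n: the short cycles account for 2 n and the long ones for n.
many-spanning-trees : (G : Graph n) → IsSimple G → Connected G → Fin n → ∀ m → (∀ v → m ≤ deg G v) → 1 ≤ m →
  ∀ K c → K * K ≤ m → (∀ x → x * K ≤ 3 * n → x ≤ c) →
  ∀ L → (∀ H → IsSpanningTree G H → H ∈ L) →
  m ^ n ≤ 2 * (length L * (length (partials (neighbours G) c) * length (partials {n = n} (const markers) c)))
many-spanning-trees {n} G simple conn r m m≤ m≥1 K c K²≤m small L complete = begin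
  m ^ n                                  ≡⟨ prod-const n m ⟨
  prod {n} (λ _ → m)                     ≤⟨ prod-mono (λ v → subst (m ≤_) (sym (length-neighbours G v)) (m≤ v)) ⟩
  prod (length ∘ neighbours G)           ≡⟨ length-vectors (neighbours G) ⟨
  length (self-maps G)                   ≤⟨ few-short-cycles G m m≤ K K²≤m (≤-trans (s≤s z≤n) (Finₚ.toℕ<n r)) m≥1 ⟩
  2 * length good                        ≤⟨ *-monoʳ-≤ 2 (injection-length≤ (Encodes r) (encodes-injective r)
                                              (Uniqueₚ.filter⁺ good? (vectors-unique (neighbours G) (λ v → elems-unique (lookup (lookup G v))))) total) ⟩
  2 * length codes                       ≡⟨ cong (2 *_) (trans (length-cartesianProductWith _,_ L _)
                                              (cong (length L *_) (length-cartesianProductWith _,_ (partials (neighbours G) c) _))) ⟩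
  2 * (length L * (length (partials (neighbours G) c) * length (partials {n = n} (const markers) c))) ∎
  where
  open ≤-Reasoning
  good? = λ (f : Vec (Fin n) n) → shortCount K (lookup f) * K ≤? 2 * n
  good = filter good? (self-maps G)
  codes = cartesianProduct L (cartesianProduct (partials (neighbours G) c) (partials (const markers) c))
  total : ∀ {f} → f ∈ good → ∃ λ y → y ∈ codes × Encodes r f y
  total {f} f∈ = encode f p
    , ∈ₚ.∈-cartesianProduct⁺ (complete _ (tree-graph-isTree tree , λ i j a → p⊆G (Adj⇒Edge p a)))
        (∈ₚ.∈-cartesianProduct⁺
          (∈-partials (neighbours G) c _ (subst (_≤ c) (sym (justs-mark q φ)) few-q)
            (λ v e → let _ , fv = mark-just q φ v e in subst (_∈ neighbours G v) fv (in-N v)))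
          (∈-partials (const markers) c _ (subst (_≤ c) (sym (justs-mark (λ w → not (does (Edge? (cut φ) w (p w)))) (const tt))) (≤-trans (new-edges (cut-forest φ) sub q moves-cut) few-q))
            (λ _ _ → here refl)))
    , moves , p , tree , (λ {u} {v} → sub {u} {v}) , refl
    where
    φ = lookup f
    q = isCycleMin φ
    f∈F = proj₁ (∈ₚ.∈-filter⁻ good? {xs = self-maps G} f∈)
    in-N : ∀ v → φ v ∈ neighbours G v
    in-N = ∈-vectors⁻ (neighbours G) f f∈F
    moves : ∀ v → φ v ≢ v
    moves v e = proj₂ simple v (subst (Adj G v) e (∈-neighbours⇒Adj G (in-N v)))
    moves-cut : ∀ v → q v ≡ false → cut φ v ≢ v
    moves-cut v qv e = moves v (trans (sym (cut-other φ v qv)) e)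
    few-q : # q ≤ c
    few-q = small (# q) (≤-trans (#-cycleMin K φ) (≤-trans (+-monoˡ-≤ n (proj₂ (∈ₚ.∈-filter⁻ good? {xs = self-maps G} f∈)))
      (≤-reflexive (+-comm (2 * n) n))))
    half : ∀ u v → u ≢ v → cut φ u ≡ v → Adj G u v
    half u v u≢v e with q u in qu
    ... | true  = contradiction e u≢v
    ... | false = subst (Adj G u) e (∈-neighbours⇒Adj G (in-N u))
    cut⊆G : cut φ ⊆ₐ G
    cut⊆G (u≢v , inj₁ e) = half _ _ u≢v e
    cut⊆G (u≢v , inj₂ e) = proj₁ simple _ _ (half _ _ (u≢v ∘ sym) e)
    extension = spanning-extension G simple conn (cut-forest φ) cut⊆G r
    p = proj₁ extension
    tree = proj₁ (proj₂ extension)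
    sub : cut φ ⊆ₑ p
    sub = proj₁ (proj₂ (proj₂ extension))
    p⊆G : p ⊆ₐ G
    p⊆G = proj₂ (proj₂ (proj₂ extension))

-- Leaves of a rooted tree

HasChild : (Fin n → Fin n) → Fin n → Set
HasChild p v = ∃ λ u → u ≢ v × p u ≡ v

hasChild? : (p : Fin n → Fin n) → ∀ v → Dec (HasChild p v)
hasChild? p v = Finₚ.any? (λ u → ¬? (u ≟ v) ×-dec (p u ≟ v))

-- A root with a single neighbour is no leaf in this sense, since that neighbour is its child. Thus
-- the parent of a vertex other than the root is never a leaf.
hasChild leaf : (Fin n → Fin n) → Fin n → Bool
hasChild p v = does (hasChild? p v)
leaf p v = not (hasChild p v)

leaf⇒childless : (p : Fin n → Fin n) → ∀ {v} → leaf p v ≡ true → ¬ HasChild p v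
leaf⇒childless p {v} lv h with () ← trans (sym lv) (cong not (dec-true (hasChild? p v) h))

childless⇒leaf : (p : Fin n → Fin n) → ∀ {v} → ¬ HasChild p v → leaf p v ≡ true
childless⇒leaf p {v} ¬h = cong not (dec-false (hasChild? p v) ¬h)

parent-not-leaf : (p : Fin n → Fin n) → ∀ v → p v ≢ v → leaf p (p v) ≡ false
parent-not-leaf p v ne = cong not (dec-true (hasChild? p (p v)) (v , ne ∘ sym , refl))

leaf-not-root : {p : Fin n → Fin n} {r : Fin n} → RootedTree p r → (∃ λ v → v ≢ r) → ∀ i → leaf p i ≡ true → p i ≢ i
leaf-not-root {p = p} {r} t (v , v≢r) i li pi = leaf⇒childless p li (subst (HasChild p) (sym (RootedTree.only-r t i pi))
  (Forest.rank-induction (RootedTree.forest t) (λ v → v ≢ r → HasChild p r)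
    (λ v pv v≢r → contradiction (RootedTree.only-r t v pv) v≢r)
    (λ v ne IH v≢r → through v v≢r IH) v v≢r))
  where
  through : ∀ v → v ≢ r → (p v ≢ r → HasChild p r) → HasChild p r
  through v v≢r IH with p v ≟ r
  ... | yes e = v , v≢r , e
  ... | no ne = IH ne

-- A neighbour is named by its place in the list of neighbours, so that one range below D serves for
-- every vertex.
position : List (Fin n) → Fin n → ℕ
position []       x = 0
position (y ∷ ys) x = if does (x ≟ y) then 0 else suc (position ys x)

position< : ∀ {xs} {x : Fin n} → x ∈ xs → position xs x < length xs
position< {xs = y ∷ ys} {x} x∈ with x ≟ y | x∈
... | yes _ | _         = s≤s z≤n
... | no ne | here e    = contradiction e ne
... | no ne | there x∈′ = s≤s (position< x∈′)

position-injective : ∀ {xs} {x y : Fin n} → x ∈ xs → y ∈ xs → position xs x ≡ position xs y → x ≡ y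
position-injective {xs = z ∷ zs} {x} {y} x∈ y∈ e with x ≟ z | y ≟ z | x∈ | y∈
... | yes a | yes b | _         | _         = trans a (sym b)
... | no a  | no b  | here e′   | _         = contradiction e′ a
... | no a  | no b  | there _   | here e′   = contradiction e′ b
... | no a  | no b  | there x∈′ | there y∈′ = position-injective x∈′ y∈′ (suc-injective e)

Adj⇒∈-neighbours : (G : Graph n) → ∀ {u v} → Adj G u v → v ∈ neighbours G u
Adj⇒∈-neighbours G {u} = ∈-elems⁺ (lookup (lookup G u))

-- Many leaves: counting embeddings

module _ (G : Graph n) (D : ℕ) (deg<D : ∀ v → deg G v < D) where

  -- The strict bound on the degrees absorbs the 1 that `permanent-bound` adds to each row sum.
  count<D : ∀ v {cs} → Unique cs → suc (count (lookup (lookup G v)) cs) ≤ D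
  count<D v u = ≤-trans (s≤s (≤-trans (count≤# _ u)
    (≤-reflexive (trans (sym (length-elems (lookup (lookup G v)))) (length-neighbours G v))))) (deg<D v)

  module _ {p : Fin n → Fin n} {r : Fin n} (t : RootedTree p r) (other : ∃ λ v → v ≢ r) where

    record Embedding (s : Vec (Fin n) n) : Set where
      field
        injective  : ∀ i j → lookup s i ≡ lookup s j → i ≡ j
        surjective : ∀ w → ∃ λ i → lookup s i ≡ w
        adjacent   : ∀ v → p v ≢ v → Adj G (lookup s (p v)) (lookup s v)

    -- The two Booleans say whether `v` is a leaf and whether it is the root. The root stores its
    -- image, any other non-leaf stores a position among the neighbours of the image of its parent,
    -- and leaves store nothing.
    entry : Vec (Fin n) n → Fin n → Bool → Bool → ℕ
    entry s v true  _     = 0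
    entry s v false true  = toℕ (lookup s v)
    entry s v false false = position (neighbours G (lookup s (p v))) (lookup s v)

    range-of : Bool → Bool → List ℕ
    range-of true  _     = 0 ∷ []
    range-of false true  = upTo n
    range-of false false = upTo D

    isRoot : Fin n → Bool
    isRoot v = does (p v ≟ v)

    core-code : Vec (Fin n) n → Vec ℕ n
    core-code s = Vec.tabulate (λ v → entry s v (leaf p v) (isRoot v))

    core-ranges : Fin n → List ℕ
    core-ranges v = range-of (leaf p v) (isRoot v)

    core-code∈ : ∀ {s} → Embedding s → core-code s ∈ vectors core-ranges
    core-code∈ {s} em = ∈-vectors⁺ core-ranges (core-code s)
      (λ v → subst (_∈ core-ranges v) (sym (Vecₚ.lookup∘tabulate _ v)) (fits v (leaf p v) (isRoot v) refl))
      where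
      fits : ∀ v a b → isRoot v ≡ b → entry s v a b ∈ range-of a b
      fits v true  b     e = here refl
      fits v false true  e = ∈ₚ.∈-upTo⁺ (Finₚ.toℕ<n (lookup s v))
      fits v false false e = ∈ₚ.∈-upTo⁺ (<-trans (subst (position (neighbours G (lookup s (p v))) (lookup s v) <_) (length-neighbours G (lookup s (p v)))
        (position< (Adj⇒∈-neighbours G (Embedding.adjacent em v (λ pv → false≢true (trans (sym e) (dec-true (p v ≟ v) pv))))))) (deg<D _))
        where
        false≢true : false ≢ true
        false≢true ()

    -- Decoding proceeds away from the root. It never passes through a leaf, since a parent is not a
    -- leaf, so the image of the parent is known at each step.
    same-core : ∀ {s s′} → Embedding s → Embedding s′ → core-code s ≡ core-code s′ →
                ∀ v → leaf p v ≡ false → lookup s v ≡ lookup s′ v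
    same-core {s} {s′} em em′ e = Forest.rank-induction (RootedTree.forest t) _ base up
      where
      entries : ∀ v → entry s v (leaf p v) (isRoot v) ≡ entry s′ v (leaf p v) (isRoot v)
      entries v = trans (sym (Vecₚ.lookup∘tabulate _ v)) (trans (cong (λ c → lookup c v) e) (Vecₚ.lookup∘tabulate _ v))
      base : ∀ v → p v ≡ v → leaf p v ≡ false → lookup s v ≡ lookup s′ v
      base v pv lv = Finₚ.toℕ-injective (subst₂ (λ a b → entry s v a b ≡ entry s′ v a b) lv (dec-true (p v ≟ v) pv) (entries v))
      up : ∀ v → p v ≢ v → (leaf p (p v) ≡ false → lookup s (p v) ≡ lookup s′ (p v)) → leaf p v ≡ false → lookup s v ≡ lookup s′ v
      up v ne IH lv = position-injective (Adj⇒∈-neighbours G (Embedding.adjacent em v ne))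
        (subst (λ u → lookup s′ v ∈ neighbours G u) (sym parents) (Adj⇒∈-neighbours G (Embedding.adjacent em′ v ne)))
        (trans (subst₂ (λ a b → entry s v a b ≡ entry s′ v a b) lv (dec-false (p v ≟ v) ne) (entries v))
               (cong (λ u → position (neighbours G u) (lookup s′ v)) (sym parents)))
        where
        parents : lookup s (p v) ≡ lookup s′ (p v)
        parents = IH (parent-not-leaf p v ne)

    -- With the non-leaves placed, the leaves are matched with the remaining vertices, and each must
    -- go to a neighbour of the image of its parent. Every row of this matching problem contributes
    -- a factor of at most D/2.
    core-fibre : ∀ c zs → Unique zs → All (λ s → Embedding s × core-code s ≡ c) zs →
                 length zs * 2 ^ (# leaf p) ≤ prod (λ v → if leaf p v then D else 1)
    core-fibre c []       u _ = z≤n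
    core-fibre c (ψ ∷ zs) u all@((emψ , cψ) ∷ _) = begin
      length (ψ ∷ zs) * 2 ^ (# leaf p)
        ≡⟨ cong (length (ψ ∷ zs) *_) (prod-if (leaf p) 2) ⟨
      length (ψ ∷ zs) * prod (λ v → if leaf p v then 2 else 1)
        ≤⟨ permanent-bound N C (leaf p) ψ (ψ ∷ zs) uC u (All.map (λ (em , cs) → matching em (trans cs (sym cψ))) all) ⟩
      prod (λ v → if leaf p v then suc (count (N v) C) else 1)
        ≤⟨ prod-mono (λ v → bound v (leaf p v)) ⟩
      prod (λ v → if leaf p v then D else 1) ∎
      where
      open ≤-Reasoning
      N : Fin n → Fin n → Bool
      N v = lookup (lookup G (lookup ψ (p v)))
      C = map (lookup ψ) (elems (leaf p))
      uC : Unique C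
      uC = Uniqueₚ.map⁺ (Embedding.injective emψ _ _) (elems-unique (leaf p))
      bound : ∀ v b → (if b then suc (count (N v) C) else 1) ≤ (if b then D else 1)
      bound v true  = count<D (lookup ψ (p v)) uC
      bound v false = ≤-refl
      leaf-or-core : ∀ v → leaf p v ≡ true ⊎ leaf p v ≡ false
      leaf-or-core v with leaf p v
      ... | true  = inj₁ refl
      ... | false = inj₂ refl
      clash : ∀ {v} → leaf p v ≡ true → leaf p v ≢ false
      clash a b with () ← trans (sym a) b
      matching : ∀ {φ} → Embedding φ → core-code φ ≡ core-code ψ → Matching N (leaf p) C ψ φ
      matching {φ} em e = record
        { range      = λ i li → range i li (Embedding.surjective emψ (lookup φ i))
        ; allowed    = λ i li → let ne = leaf-not-root t other i li in
            subst (λ u → Adj G u (lookup φ i)) (core (p i) (parent-not-leaf p i ne)) (Embedding.adjacent em i ne)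
        ; injective  = λ i j _ _ → Embedding.injective em i j
        ; surjective = λ c∈ → surj (∈ₚ.∈-map⁻ (lookup ψ) c∈)
        ; outside    = core }
        where
        core = same-core em emψ e
        range : ∀ i → leaf p i ≡ true → (∃ λ j → lookup ψ j ≡ lookup φ i) → lookup φ i ∈ C
        range i li (j , ψj) with leaf-or-core j
        ... | inj₁ lj = subst (_∈ C) ψj (∈ₚ.∈-map⁺ (lookup ψ) (∈-elems⁺ (leaf p) lj))
        ... | inj₂ cj = contradiction (subst (λ k → leaf p k ≡ false) (Embedding.injective em j i (trans (core j cj) ψj)) cj) (clash li)
        surj : ∀ {c} → (∃ λ j → j ∈ elems (leaf p) × c ≡ lookup ψ j) → ∃ λ i → leaf p i ≡ true × lookup φ i ≡ c
        surj (j , j∈ , refl) with Embedding.surjective em (lookup ψ j)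
        ... | i , φi with leaf-or-core i
        ...   | inj₁ li = i , li , φi
        ...   | inj₂ ci = contradiction (subst (λ k → leaf p k ≡ false) (Embedding.injective emψ i j (trans (sym (core i ci)) φi)) ci)
                            (clash (∈-elems⁻ (leaf p) j∈))

    core-ranges-bound : prod (length ∘ core-ranges) ≤ n * prod (λ v → if leaf p v then 1 else D)
    core-ranges-bound = begin
      prod (length ∘ core-ranges)                          ≡⟨ prod-omit (length ∘ core-ranges) r ⟩
      length (core-ranges r) * prod (omit r (length ∘ core-ranges))
        ≤⟨ *-mono-≤ (at-root (leaf p r) (isRoot r) (dec-true (p r ≟ r) (RootedTree.root-r t))) (prod-mono rest) ⟩
      n * x r * prod (omit r x)                            ≡⟨ *-assoc n (x r) _ ⟩
      n * (x r * prod (omit r x))                          ≡⟨ cong (n *_) (prod-omit x r) ⟨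
      n * prod x                                           ∎
      where
      open ≤-Reasoning
      x : Fin n → ℕ
      x v = if leaf p v then 1 else D
      n≥1 : 1 ≤ n
      n≥1 = ≤-trans (s≤s z≤n) (Finₚ.toℕ<n r)
      D≥1 : 1 ≤ D
      D≥1 = ≤-trans (s≤s z≤n) (deg<D r)
      at-root : ∀ a b → b ≡ true → length (range-of a b) ≤ n * (if a then 1 else D)
      at-root true  b     _    = subst (1 ≤_) (sym (*-identityʳ n)) n≥1
      at-root false true  _    = subst (_≤ n * D) (trans (*-identityʳ n) (sym (Listₚ.length-upTo n))) (*-monoʳ-≤ n D≥1)
      rest : ∀ v → omit r (length ∘ core-ranges) v ≤ omit r x v
      rest v with v ≟ r
      ... | yes _ = ≤-refl
      ... | no v≢r with leaf p v | dec-false (p v ≟ v) (λ pv → v≢r (RootedTree.only-r t v pv))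
      ...   | true  | _ = ≤-refl
      ...   | false | e rewrite e = ≤-reflexive (Listₚ.length-upTo D)

    few-embeddings : ∀ X → Unique X → All Embedding X → length X * 2 ^ (# leaf p) ≤ n * D ^ n
    few-embeddings X u ems = begin
      length X * 2 ^ (# leaf p)
        ≤⟨ fibre-bound (Vecₚ.≡-dec ℕ._≟_) Embedding core-code _ _ core-fibre (vectors core-ranges) X u ems (All.map core-code∈ ems) ⟩
      length (vectors core-ranges) * prod (λ v → if leaf p v then D else 1)
        ≡⟨ cong (_* prod (λ v → if leaf p v then D else 1)) (length-vectors core-ranges) ⟩
      prod (length ∘ core-ranges) * prod (λ v → if leaf p v then D else 1)
        ≤⟨ *-monoˡ-≤ (prod (λ v → if leaf p v then D else 1)) core-ranges-bound ⟩
      n * prod (λ v → if leaf p v then 1 else D) * prod (λ v → if leaf p v then D else 1)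
        ≡⟨ *-assoc n (prod (λ v → if leaf p v then 1 else D)) _ ⟩
      n * (prod (λ v → if leaf p v then 1 else D) * prod (λ v → if leaf p v then D else 1))
        ≡⟨ cong (n *_) (trans (sym (prod-* (λ v → if leaf p v then 1 else D) (λ v → if leaf p v then D else 1)))
             (trans (prod-cong (λ v → merge (leaf p v))) (prod-const n D))) ⟩
      n * D ^ n ∎
      where
      open ≤-Reasoning
      merge : ∀ b → (if b then 1 else D) * (if b then D else 1) ≡ D
      merge true  = *-identityˡ D
      merge false = *-identityʳ D

-- Few leaves: counting parent functions

firstChild : (Fin n → Fin n) → Fin n → Fin n
firstChild φ w = witness (hasChild? φ w)
  module FirstChild where
  witness : Dec (HasChild φ w) → Fin _
  witness (yes (u , _)) = u
  witness (no _)        = w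

firstChild-spec : (φ : Fin n → Fin n) → ∀ w → HasChild φ w → firstChild φ w ≢ w × φ (firstChild φ w) ≡ w
firstChild-spec φ w h = spec (hasChild? φ w)
  where
  spec : (d : Dec (HasChild φ w)) → FirstChild.witness φ w d ≢ w × φ (FirstChild.witness φ w d) ≡ w
  spec (yes (u , ne , e)) = ne , e
  spec (no ¬h)            = contradiction h ¬h

-- Each non-leaf distinguishes one of its children. On the distinguished children `φ` is a bijection
-- onto the non-leaves, with inverse `firstChild φ`, and this bijection is the matching to which the
-- permanent bound applies.
eldest? : (φ : Fin n → Fin n) → ∀ u → Dec (φ u ≢ u × firstChild φ (φ u) ≡ u)
eldest? φ u = ¬? (φ u ≟ u) ×-dec (firstChild φ (φ u) ≟ u)

eldest : (Fin n → Fin n) → Fin n → Bool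
eldest φ u = does (eldest? φ u)

eldest-injective : (φ : Fin n → Fin n) → ∀ u v → eldest φ u ≡ true → eldest φ v ≡ true → φ u ≡ φ v → u ≡ v
eldest-injective φ u v eu ev e = trans (sym (proj₂ (does⇒ (eldest? φ u) eu)))
  (trans (cong (firstChild φ) e) (proj₂ (does⇒ (eldest? φ v) ev)))

eldest-parent : (φ : Fin n → Fin n) → ∀ u → eldest φ u ≡ true → hasChild φ (φ u) ≡ true
eldest-parent φ u eu = dec-true (hasChild? φ (φ u)) (u , proj₁ (does⇒ (eldest? φ u) eu) ∘ sym , refl)

firstChild-eldest : (φ : Fin n → Fin n) → ∀ w → hasChild φ w ≡ true →
                    eldest φ (firstChild φ w) ≡ true × φ (firstChild φ w) ≡ w
firstChild-eldest φ w hw with firstChild-spec φ w (does⇒ (hasChild? φ w) hw)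
... | ne , e = dec-true (eldest? φ (firstChild φ w)) ((λ e′ → ne (trans (sym e′) e)) , cong (firstChild φ) e) , e

#-eldest : (φ : Fin n → Fin n) → # (eldest φ) ≡ # (hasChild φ)
#-eldest φ = ≤-antisym
  (#-injection (eldest φ) (hasChild φ) φ (eldest-parent φ) (eldest-injective φ))
  (#-injection (hasChild φ) (eldest φ) (firstChild φ) (λ w hw → proj₁ (firstChild-eldest φ w hw))
    (λ v w hv hw e → trans (sym (proj₂ (firstChild-eldest φ v hv))) (trans (cong φ e) (proj₂ (firstChild-eldest φ w hw)))))

#-not : (b : Fin n → Bool) → # (not ∘ b) ≡ n ∸ # b
#-not {n} b = sym (trans (cong (_∸ # b) (sym (#-complement b))) (m+n∸m≡n (# b) (# (not ∘ b))))

#-eldest-leaf : (φ : Fin n → Fin n) → # (eldest φ) ≡ n ∸ # leaf φ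
#-eldest-leaf φ = trans (#-eldest φ) (trans (#-cong (λ v → sym (Boolₚ.not-involutive (hasChild φ v)))) (#-not (leaf φ)))

#-not-eldest : (φ : Fin n → Fin n) → # (not ∘ eldest φ) ≡ # leaf φ
#-not-eldest {n} φ = trans (#-not (eldest φ)) (trans (cong (n ∸_) (#-eldest φ)) (sym (#-not (hasChild φ))))

leaf-transport : {p φ : Fin n → Fin n} (s : Fin n → Fin n) → (∀ {u v} → s u ≡ s v → u ≡ v) → (∀ w → ∃ λ u → s u ≡ w) →
                 (∀ v → φ (s v) ≡ s (p v)) → # leaf p ≤ # leaf φ
leaf-transport {p = p} {φ} s inj surj conj = #-injection (leaf p) (leaf φ) s
  (λ v lv → childless⇒leaf φ (λ (w , w≢ , φw) → let u , su = surj w in leaf⇒childless p lv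
    (u , (λ u≡v → w≢ (trans (sym su) (cong s u≡v))) , inj (trans (sym (conj u)) (trans (cong φ su) φw)))))
  (λ _ _ _ _ → inj)

module _ (G : Graph n) (D : ℕ) (deg<D : ∀ v → deg G v < D) (l : ℕ) where

  -- Here the isomorphism type of the tree enters through its number of leaves.
  record ParentMap (f : Vec (Fin n) n) : Set where
    field
      adjacent : ∀ v → lookup f v ≢ v → Adj G v (lookup f v)
      leaves   : # leaf (lookup f) ≡ l

  -- There are as many vertices that are not eldest children as there are leaves, so both parts have
  -- exactly `l` defined entries. The first part fixes `φ` off the matching, and the second tells
  -- which vertices the matching has to cover.
  parent-code : Vec (Fin n) n → Vec (Maybe (Fin n)) n × Vec (Maybe ⊤) n
  parent-code f = mark (not ∘ eldest (lookup f)) (lookup f) , mark (leaf (lookup f)) (const tt)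

  -- The vertex itself is included because a root is its own parent.
  closed-neighbours : Fin n → List (Fin n)
  closed-neighbours v = v ∷ neighbours G v

  parent-codes : List (Vec (Maybe (Fin n)) n × Vec (Maybe ⊤) n)
  parent-codes = cartesianProduct (partials closed-neighbours l) (partials (const markers) l)

  parent-code∈ : ∀ {f} → ParentMap f → parent-code f ∈ parent-codes
  parent-code∈ {f} pm = ∈ₚ.∈-cartesianProduct⁺
    (∈-partials closed-neighbours l _
      (≤-reflexive (trans (justs-mark (not ∘ eldest φ) φ) (trans (#-not-eldest φ) (ParentMap.leaves pm))))
      (λ v e → let _ , fv = mark-just (not ∘ eldest φ) φ v e in subst (_∈ closed-neighbours v) fv (near v)))
    (∈-partials (const markers) l _ (≤-reflexive (trans (justs-mark (leaf φ) (const tt)) (ParentMap.leaves pm))) (λ _ _ → here refl))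
    where
    φ = lookup f
    near : ∀ v → φ v ∈ closed-neighbours v
    near v with φ v ≟ v
    ... | yes e = here e
    ... | no ne = there (Adj⇒∈-neighbours G (ParentMap.adjacent pm v ne))

  -- Within a fibre the eldest children and the non-leaves are fixed sets of n - l vertices, and
  -- what varies is the matching between them along edges of `G`.
  parent-fibre : ∀ c zs → Unique zs → All (λ f → ParentMap f × parent-code f ≡ c) zs →
                 length zs * 2 ^ (n ∸ l) ≤ D ^ (n ∸ l)
  parent-fibre c []       u _ = z≤n
  parent-fibre c (ψ ∷ zs) u all@((pmψ , cψ) ∷ _) = begin
    length (ψ ∷ zs) * 2 ^ (n ∸ l)
      ≡⟨ cong (λ k → length (ψ ∷ zs) * 2 ^ k) size ⟨
    length (ψ ∷ zs) * 2 ^ (# I)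
      ≡⟨ cong (length (ψ ∷ zs) *_) (prod-if I 2) ⟨
    length (ψ ∷ zs) * prod (λ v → if I v then 2 else 1)
      ≤⟨ permanent-bound N C I ψ (ψ ∷ zs) uC u (All.map (λ (pm , cf) → matching pm (trans cf (sym cψ))) all) ⟩
    prod (λ v → if I v then suc (count (N v) C) else 1)
      ≤⟨ prod-mono (λ v → bound v (I v)) ⟩
    prod (λ v → if I v then D else 1)
      ≡⟨ prod-if I D ⟩
    D ^ (# I)
      ≡⟨ cong (D ^_) size ⟩
    D ^ (n ∸ l) ∎
    where
    open ≤-Reasoning
    I = eldest (lookup ψ)
    size : # I ≡ n ∸ l
    size = trans (#-eldest-leaf (lookup ψ)) (cong (n ∸_) (ParentMap.leaves pmψ))
    N : Fin n → Fin n → Bool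
    N v = lookup (lookup G v)
    C = elems (hasChild (lookup ψ))
    uC : Unique C
    uC = elems-unique (hasChild (lookup ψ))
    bound : ∀ v b → (if b then suc (count (N v) C) else 1) ≤ (if b then D else 1)
    bound v true  = count<D G D deg<D v uC
    bound v false = ≤-refl
    matching : ∀ {f} → ParentMap f → parent-code f ≡ parent-code ψ → Matching N I C ψ f
    matching {f} pm e = record
      { range      = λ i Ii → ∈-elems⁺ (hasChild (lookup ψ)) (trans (sym (parents (φ i))) (eldest-parent φ i (own i Ii)))
      ; allowed    = λ i Ii → ParentMap.adjacent pm i (proj₁ (does⇒ (eldest? φ i) (own i Ii)))
      ; injective  = λ i j Ii Ij → eldest-injective φ i j (own i Ii) (own j Ij)
      ; surjective = λ {w} w∈ → let ew , fw = firstChild-eldest φ w (trans (parents w) (∈-elems⁻ (hasChild (lookup ψ)) w∈)) in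
                                firstChild φ w , trans (sym (same-eldest (firstChild φ w))) ew , fw
      ; outside    = λ i Ii → proj₂ (e₁ i) (cong not (trans (same-eldest i) Ii)) }
      where
      φ = lookup f
      e₁ = mark-injective (not ∘ eldest φ) (not ∘ eldest (lookup ψ)) φ (lookup ψ) (cong proj₁ e)
      e₂ = mark-injective (leaf φ) (leaf (lookup ψ)) (const tt) (const tt) (cong proj₂ e)
      same-eldest : ∀ i → eldest φ i ≡ I i
      same-eldest i = Boolₚ.not-injective (proj₁ (e₁ i))
      own : ∀ i → I i ≡ true → eldest φ i ≡ true
      own i Ii = trans (same-eldest i) Ii
      parents : ∀ w → hasChild φ w ≡ hasChild (lookup ψ) w
      parents w = Boolₚ.not-injective (proj₁ (e₂ w))

  few-parent-maps : ∀ X → Unique X → All ParentMap X →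
    length X * 2 ^ (n ∸ l) ≤ length (partials closed-neighbours l) * length (partials {n = n} (const markers) l) * D ^ (n ∸ l)
  few-parent-maps X u pms = subst (λ k → length X * 2 ^ (n ∸ l) ≤ k * D ^ (n ∸ l))
    (length-cartesianProductWith _,_ (partials closed-neighbours l) _)
    (fibre-bound (Productₚ.≡-dec (Vecₚ.≡-dec (Maybeₚ.≡-dec _≟_)) (Vecₚ.≡-dec (Maybeₚ.≡-dec Unitₚ._≟_)))
      ParentMap parent-code _ _ parent-fibre parent-codes X u pms (All.map parent-code∈ pms))

-- Powers

^-*-distrib : ∀ x y n → (x * y) ^ n ≡ x ^ n * y ^ n
^-*-distrib x y zero    = refl
^-*-distrib x y (suc n) = trans (cong (x * y *_) (^-*-distrib x y n))
  (solve 4 (λ x y a b → x :* y :* (a :* b) := x :* a :* (y :* b)) refl x y (x ^ n) (y ^ n))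

^-swap : ∀ x a b → (x ^ a) ^ b ≡ (x ^ b) ^ a
^-swap x a b = trans (^-*-assoc x a b) (trans (cong (x ^_) (*-comm a b)) (sym (^-*-assoc x b a)))

^-cancelˡ-≤ : ∀ k → 1 ≤ k → ∀ {x y} → x ^ k ≤ y ^ k → x ≤ y
^-cancelˡ-≤ k k≥1 {x} {y} h = ≮⇒≥ (λ y<x → <⇒≱ (^-monoˡ-< k {{>-nonZero k≥1}} y<x) h)

-- Comparisons of large powers are settled by evaluating `_≤ᵇ_` on numerals.
≤-by-computation : ∀ a b → (a ≤ᵇ b) ≡ true → a ≤ b
≤-by-computation a b e = ≤ᵇ⇒≤ a b (subst T (sym e) tt)

pow≥1 : ∀ {x} → 1 ≤ x → ∀ n → 1 ≤ x ^ n
pow≥1 {x} x≥1 n = m^n>0 x {{>-nonZero x≥1}} n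

cancel-powers : ∀ x y q a b n → 1 ≤ a → q * a ≤ b → x * b ^ n ≤ y * a ^ n → x * q ^ n ≤ y
cancel-powers x y q a b n a≥1 qa≤b h = *-cancelʳ-≤ (x * q ^ n) y (a ^ n) {{>-nonZero (pow≥1 a≥1 n)}} (begin
  x * q ^ n * a ^ n    ≡⟨ *-assoc x (q ^ n) (a ^ n) ⟩
  x * (q ^ n * a ^ n)  ≡⟨ cong (x *_) (^-*-distrib q a n) ⟨
  x * (q * a) ^ n      ≤⟨ *-monoʳ-≤ x (^-monoˡ-≤ n qa≤b) ⟩
  x * b ^ n            ≤⟨ h ⟩
  y * a ^ n            ∎)
  where open ≤-Reasoning

-- The exponential series: with a y K = 2ᴷ K! Σ_{k≤K} (y/2)ᵏ/k!, one has a (y+1) K ≤ 2 a y K since √e ≤ 2.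

half-series : ℕ → ℕ → ℕ
half-series y zero    = 1
half-series y (suc K) = 2 * suc K * half-series y K + y ^ suc K

power-increment : ∀ y K → suc y ^ suc K ≤ y ^ suc K + suc K * suc y ^ K
power-increment y zero    = ≤-reflexive (solve 1 (λ y → (con 1 :+ y) :* con 1 := y :* con 1 :+ con 1 :* con 1) refl y)
power-increment y (suc K) = begin
  suc y * suc y ^ suc K                                  ≤⟨ *-monoʳ-≤ (suc y) (power-increment y K) ⟩
  suc y * (y ^ suc K + suc K * suc y ^ K)                ≡⟨ solve 4 (λ y a k b → (con 1 :+ y) :* (a :+ k :* b) := (a :+ y :* a) :+ k :* ((con 1 :+ y) :* b)) refl y (y ^ suc K) (suc K) (suc y ^ K) ⟩
  y ^ suc K + y * y ^ suc K + suc K * (suc y * suc y ^ K) ≤⟨ +-monoˡ-≤ _ (+-monoˡ-≤ _ (^-monoˡ-≤ (suc K) (n≤1+n y))) ⟩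
  suc y ^ suc K + y * y ^ suc K + suc K * suc y ^ suc K  ≡⟨ solve 3 (λ a b k → a :+ b :+ k :* a := b :+ (con 1 :+ k) :* a) refl (suc y ^ suc K) (y * y ^ suc K) (suc K) ⟩
  y * y ^ suc K + suc (suc K) * suc y ^ suc K            ∎
  where open ≤-Reasoning

-- The mean value inequality: the derivative of the exponential sum up to degree K + 1 is the sum up
-- to degree K, and the two arguments differ by 1/2. The same inequality for a single power is
-- `power-increment`.
half-series-increment : ∀ y K → half-series (suc y) (suc K) ≤ half-series y (suc K) + suc K * half-series (suc y) K
half-series-increment y zero = ≤-reflexive (solve 1 (λ y → con 2 :* con 1 :* con 1 :+ (con 1 :+ y) :* con 1 := con 2 :* con 1 :* con 1 :+ y :* con 1 :+ con 1 :* con 1) refl y)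
half-series-increment y (suc K) = begin
  2 * k * half-series (suc y) (suc K) + suc y ^ k
    ≤⟨ +-mono-≤ (*-monoʳ-≤ (2 * k) (half-series-increment y K)) (power-increment y (suc K)) ⟩
  2 * k * (half-series y (suc K) + suc K * half-series (suc y) K) + (y ^ k + k * suc y ^ suc K)
    ≡⟨ solve 6 (λ k a j b c d → con 2 :* k :* (a :+ j :* b) :+ (c :+ k :* d) := con 2 :* k :* a :+ c :+ k :* (con 2 :* j :* b :+ d))
         refl k (half-series y (suc K)) (suc K) (half-series (suc y) K) (y ^ k) (suc y ^ suc K) ⟩
  2 * k * half-series y (suc K) + y ^ k + k * half-series (suc y) (suc K) ∎
  where open ≤-Reasoning
        k = suc (suc K)

half-series-suc : ∀ y K → half-series (suc y) K ≤ 2 * half-series y K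
half-series-suc y zero    = s≤s z≤n
half-series-suc y (suc K) = +-cancelʳ-≤ X X (2 * half-series y (suc K)) (begin
  X + X                                    ≤⟨ +-mono-≤ inc inc ⟩
  (a + k * b) + (a + k * b)                ≡⟨ solve 3 (λ a k b → (a :+ k :* b) :+ (a :+ k :* b) := con 2 :* a :+ con 2 :* k :* b) refl a k b ⟩
  -- `2 * k * b` is `X` without its last power, so one `X` cancels.
  2 * a + 2 * k * b                        ≤⟨ +-monoʳ-≤ (2 * a) (m≤m+n (2 * k * b) _) ⟩
  2 * a + X                                ∎)
  where open ≤-Reasoning
        k = suc K
        X = half-series (suc y) (suc K)
        a = half-series y (suc K)
        b = half-series (suc y) K
        inc = half-series-increment y K

half-series-bound : ∀ y K → half-series y K ≤ 2 ^ y * (2 ^ K * K !)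
half-series-bound zero K = ≤-reflexive (trans (at-0 K) (sym (*-identityˡ _)))
  where
  at-0 : ∀ K → half-series 0 K ≡ 2 ^ K * K !
  at-0 zero    = refl
  at-0 (suc K) = trans (+-identityʳ _) (trans (cong (2 * suc K *_) (at-0 K))
    (solve 3 (λ k p f → con 2 :* k :* (p :* f) := con 2 :* p :* (k :* f)) refl (suc K) (2 ^ K) (K !)))
half-series-bound (suc y) K = ≤-trans (half-series-suc y K) (≤-trans (*-monoʳ-≤ 2 (half-series-bound y K))
  (≤-reflexive (sym (*-assoc 2 (2 ^ y) _))))

half-series-double : ∀ n K → half-series (2 * n) K ≡ 2 ^ K * expScaled n K
half-series-double n zero    = refl
half-series-double n (suc K) = trans (cong₂ (λ a b → 2 * suc K * a + b) (half-series-double n K) (^-*-distrib 2 n (suc K)))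
  (solve 4 (λ k p e q → con 2 :* k :* (p :* e) :+ con 2 :* p :* q := con 2 :* p :* (k :* e :+ q)) refl (suc K) (2 ^ K) (expScaled n K) (n ^ suc K))

expScaled≤ : ∀ n K → expScaled n K ≤ 4 ^ n * K !
expScaled≤ n K = *-cancelˡ-≤ (2 ^ K) {{>-nonZero (pow≥1 (s≤s z≤n) K)}} (begin
  2 ^ K * expScaled n K          ≡⟨ half-series-double n K ⟨
  half-series (2 * n) K          ≤⟨ half-series-bound (2 * n) K ⟩
  2 ^ (2 * n) * (2 ^ K * K !)    ≡⟨ cong (_* (2 ^ K * K !)) (^-*-assoc 2 2 n) ⟨
  4 ^ n * (2 ^ K * K !)          ≡⟨ solve 3 (λ a b c → a :* (b :* c) := b :* (a :* c)) refl (4 ^ n) (2 ^ K) (K !) ⟩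
  2 ^ K * (4 ^ n * K !)          ∎)
  where open ≤-Reasoning

-- Combining the counts numerically

few-leaves-numeric : ∀ x D n l P₁ P₂ → l ≤ n → l * 500 ≤ n →
  P₁ * 16 ^ n ≤ (D * 16) ^ l * 17 ^ n → P₂ * 16 ^ n ≤ (1 * 16) ^ l * 17 ^ n →
  x * 2 ^ (n ∸ l) ≤ P₁ * P₂ * D ^ (n ∸ l) → x ^ 500 * 2 ^ n ≤ (D ^ n) ^ 500
-- After the 500-th power, `512 ^ l` grows to at most `512 ^ n`, so each vertex weighs 512 · 289^500
-- against 512^500. As 512/289 > 1.7, the factor 2 that is claimed remains with much to spare.
few-leaves-numeric x D n l P₁ P₂ l≤n 500l≤n h₁ h₂ h = powers 500 (512 * 289 ^ 500) (512 ^ 500)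
    500l≤n (≤-by-computation 1 (512 * 289 ^ 500) refl) (≤-by-computation (2 * (512 * 289 ^ 500)) (512 ^ 500) refl) refl refl
  where
  open ≤-Reasoning
  split : ∀ b → b ^ n ≡ b ^ (n ∸ l) * b ^ l
  split b = trans (cong (b ^_) (sym (m∸n+n≡m l≤n))) (^-distribˡ-+-* b (n ∸ l) l)
  -- 512 = 2 · 16² unites the 2 of the permanent bound with the denominators of the two partial
  -- vectors, and 289 = 17² their numerators.
  base : x * 512 ^ n ≤ D ^ n * 512 ^ l * 289 ^ n
  base = begin
    x * 512 ^ n
      ≡⟨ cong (x *_) (trans (^-*-distrib 2 256 n) (cong (2 ^ n *_) (^-*-distrib 16 16 n))) ⟩
    x * (2 ^ n * (16 ^ n * 16 ^ n))
      ≡⟨ cong (λ z → x * (z * (16 ^ n * 16 ^ n))) (split 2) ⟩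
    x * (2 ^ (n ∸ l) * 2 ^ l * (16 ^ n * 16 ^ n))
      ≡⟨ solve 4 (λ x a b c → x :* (a :* b :* (c :* c)) := x :* a :* (b :* (c :* c))) refl x (2 ^ (n ∸ l)) (2 ^ l) (16 ^ n) ⟩
    x * 2 ^ (n ∸ l) * (2 ^ l * (16 ^ n * 16 ^ n))
      ≤⟨ *-monoˡ-≤ (2 ^ l * (16 ^ n * 16 ^ n)) h ⟩
    P₁ * P₂ * D ^ (n ∸ l) * (2 ^ l * (16 ^ n * 16 ^ n))
      ≡⟨ solve 5 (λ p q d t c → p :* q :* d :* (t :* (c :* c)) := p :* c :* (q :* c) :* (d :* t)) refl P₁ P₂ (D ^ (n ∸ l)) (2 ^ l) (16 ^ n) ⟩
    P₁ * 16 ^ n * (P₂ * 16 ^ n) * (D ^ (n ∸ l) * 2 ^ l)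
      ≤⟨ *-monoˡ-≤ (D ^ (n ∸ l) * 2 ^ l) (*-mono-≤ h₁ h₂) ⟩
    (D * 16) ^ l * 17 ^ n * ((1 * 16) ^ l * 17 ^ n) * (D ^ (n ∸ l) * 2 ^ l)
      ≡⟨ cong (λ z → z * 17 ^ n * ((1 * 16) ^ l * 17 ^ n) * (D ^ (n ∸ l) * 2 ^ l)) (^-*-distrib D 16 l) ⟩
    D ^ l * 16 ^ l * 17 ^ n * (16 ^ l * 17 ^ n) * (D ^ (n ∸ l) * 2 ^ l)
      ≡⟨ solve 5 (λ a b c d t → a :* b :* c :* (b :* c) :* (d :* t) := d :* a :* (t :* (b :* b)) :* (c :* c)) refl
           (D ^ l) (16 ^ l) (17 ^ n) (D ^ (n ∸ l)) (2 ^ l) ⟩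
    D ^ (n ∸ l) * D ^ l * (2 ^ l * (16 ^ l * 16 ^ l)) * (17 ^ n * 17 ^ n)
      ≡⟨ cong₂ _*_ (cong₂ _*_ (sym (split D)) (trans (cong (2 ^ l *_) (sym (^-*-distrib 16 16 l))) (sym (^-*-distrib 2 256 l)))) (sym (^-*-distrib 17 17 n)) ⟩
    D ^ n * 512 ^ l * 289 ^ n ∎
  powers : ∀ e a b → l * e ≤ n → 1 ≤ a → 2 * a ≤ b → a ≡ 512 * 289 ^ e → b ≡ 512 ^ e → x ^ e * 2 ^ n ≤ (D ^ n) ^ e
  powers e a b le≤n a≥1 2a≤b refl refl = cancel-powers (x ^ e) ((D ^ n) ^ e) 2 a b n a≥1 2a≤b (begin
    x ^ e * (512 ^ e) ^ n                            ≡⟨ cong (x ^ e *_) (^-swap 512 e n) ⟩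
    x ^ e * (512 ^ n) ^ e                            ≡⟨ ^-*-distrib x (512 ^ n) e ⟨
    (x * 512 ^ n) ^ e                                ≤⟨ ^-monoˡ-≤ e base ⟩
    (D ^ n * 512 ^ l * 289 ^ n) ^ e                  ≡⟨ trans (^-*-distrib (D ^ n * 512 ^ l) (289 ^ n) e) (cong (_* (289 ^ n) ^ e) (^-*-distrib (D ^ n) (512 ^ l) e)) ⟩
    (D ^ n) ^ e * (512 ^ l) ^ e * (289 ^ n) ^ e      ≡⟨ cong₂ (λ y z → (D ^ n) ^ e * y * z) (^-*-assoc 512 l e) (^-swap 289 n e) ⟩
    (D ^ n) ^ e * 512 ^ (l * e) * (289 ^ e) ^ n      ≤⟨ *-monoˡ-≤ ((289 ^ e) ^ n) (*-monoʳ-≤ ((D ^ n) ^ e) (^-monoʳ-≤ 512 le≤n)) ⟩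
    (D ^ n) ^ e * 512 ^ n * (289 ^ e) ^ n            ≡⟨ *-assoc ((D ^ n) ^ e) _ _ ⟩
    (D ^ n) ^ e * (512 ^ n * (289 ^ e) ^ n)          ≡⟨ cong ((D ^ n) ^ e *_) (^-*-distrib 512 (289 ^ e) n) ⟨
    (D ^ n) ^ e * (512 * 289 ^ e) ^ n                ∎)

-- After the s-th power, the stored entries cost (D s²)^(c s) ≤ 2^(j c s) ≤ 2^n, and each of the two
-- partial vectors costs another (1 + 1/s)^(s n) ≤ 4^n. Together this is 32^n.
many-trees-numeric : ∀ L m D n c s j P₁ P₂ → 1 ≤ s → suc s ^ s ≤ 4 * s ^ s → D * s * s ≤ 2 ^ j → c * (s * j) ≤ n →
  P₁ * s ^ n ≤ (D * s) ^ c * suc s ^ n → P₂ * s ^ n ≤ (1 * s) ^ c * suc s ^ n →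
  m ^ n ≤ 2 * (L * (P₁ * P₂)) → (m ^ n) ^ s ≤ (2 * L) ^ s * 32 ^ n
many-trees-numeric L m D n c s j P₁ P₂ s≥1 4s Ds²≤ csj≤n h₁ h₂ h =
  *-cancelʳ-≤ ((m ^ n) ^ s) ((2 * L) ^ s * 32 ^ n) (z * z) {{>-nonZero (*-mono-≤ z≥1 z≥1)}} (begin
    (m ^ n) ^ s * (z * z)
      ≡⟨ cong (λ y → (m ^ n) ^ s * (y * y)) (^-swap s s n) ⟩
    (m ^ n) ^ s * ((s ^ n) ^ s * (s ^ n) ^ s)
      ≡⟨ trans (^-*-distrib (m ^ n) (s ^ n * s ^ n) s) (cong ((m ^ n) ^ s *_) (^-*-distrib (s ^ n) (s ^ n) s)) ⟨
    (m ^ n * (s ^ n * s ^ n)) ^ s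
      ≤⟨ ^-monoˡ-≤ s base ⟩
    (2 * L * (D * s * s) ^ c * (suc s ^ n * suc s ^ n)) ^ s
      ≡⟨ trans (^-*-distrib (2 * L * (D * s * s) ^ c) (suc s ^ n * suc s ^ n) s)
           (cong₂ _*_ (^-*-distrib (2 * L) ((D * s * s) ^ c) s)
             (trans (^-*-distrib (suc s ^ n) (suc s ^ n) s) (cong (λ y → y * y) (^-swap (suc s) n s)))) ⟩
    (2 * L) ^ s * ((D * s * s) ^ c) ^ s * ((suc s ^ s) ^ n * (suc s ^ s) ^ n)
      ≤⟨ *-mono-≤ (*-monoʳ-≤ ((2 * L) ^ s) error) (*-mono-≤ (^-monoˡ-≤ n 4s) (^-monoˡ-≤ n 4s)) ⟩
    (2 * L) ^ s * 2 ^ n * ((4 * s ^ s) ^ n * (4 * s ^ s) ^ n)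
      ≡⟨ cong (λ y → (2 * L) ^ s * 2 ^ n * (y * y)) (^-*-distrib 4 (s ^ s) n) ⟩
    (2 * L) ^ s * 2 ^ n * (4 ^ n * z * (4 ^ n * z))
      ≡⟨ solve 4 (λ l t f z → l :* t :* (f :* z :* (f :* z)) := l :* (t :* (f :* f)) :* (z :* z)) refl ((2 * L) ^ s) (2 ^ n) (4 ^ n) z ⟩
    (2 * L) ^ s * (2 ^ n * (4 ^ n * 4 ^ n)) * (z * z)
      ≡⟨ cong (λ y → (2 * L) ^ s * y * (z * z)) (trans (^-*-distrib 2 16 n) (cong (2 ^ n *_) (^-*-distrib 4 4 n))) ⟨
    (2 * L) ^ s * 32 ^ n * (z * z) ∎)
  where
  open ≤-Reasoning
  z = (s ^ s) ^ n
  z≥1 : 1 ≤ z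
  z≥1 = pow≥1 (pow≥1 s≥1 s) n
  error : ((D * s * s) ^ c) ^ s ≤ 2 ^ n
  error = begin
    ((D * s * s) ^ c) ^ s   ≤⟨ ^-monoˡ-≤ s (^-monoˡ-≤ c Ds²≤) ⟩
    ((2 ^ j) ^ c) ^ s       ≡⟨ trans (cong (_^ s) (^-*-assoc 2 j c)) (^-*-assoc 2 (j * c) s) ⟩
    2 ^ (j * c * s)         ≤⟨ ^-monoʳ-≤ 2 (≤-trans (≤-reflexive (solve 3 (λ j c s → j :* c :* s := c :* (s :* j)) refl j c s)) csj≤n) ⟩
    2 ^ n                   ∎
  base : m ^ n * (s ^ n * s ^ n) ≤ 2 * L * (D * s * s) ^ c * (suc s ^ n * suc s ^ n)
  base = begin
    m ^ n * (s ^ n * s ^ n)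
      ≤⟨ *-monoˡ-≤ (s ^ n * s ^ n) h ⟩
    2 * (L * (P₁ * P₂)) * (s ^ n * s ^ n)
      ≡⟨ solve 4 (λ l p q t → con 2 :* (l :* (p :* q)) :* (t :* t) := con 2 :* l :* ((p :* t) :* (q :* t))) refl L P₁ P₂ (s ^ n) ⟩
    2 * L * (P₁ * s ^ n * (P₂ * s ^ n))
      ≤⟨ *-monoʳ-≤ (2 * L) (*-mono-≤ h₁ h₂) ⟩
    2 * L * ((D * s) ^ c * suc s ^ n * ((1 * s) ^ c * suc s ^ n))
      ≡⟨ cong (λ y → 2 * L * ((D * s) ^ c * suc s ^ n * (y ^ c * suc s ^ n))) (*-identityˡ s) ⟩
    2 * L * ((D * s) ^ c * suc s ^ n * (s ^ c * suc s ^ n))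
      ≡⟨ solve 4 (λ l a b t → l :* (a :* t :* (b :* t)) := l :* (a :* b) :* (t :* t)) refl (2 * L) ((D * s) ^ c) (s ^ c) (suc s ^ n) ⟩
    2 * L * ((D * s) ^ c * s ^ c) * (suc s ^ n * suc s ^ n)
      ≡⟨ cong (λ y → 2 * L * y * (suc s ^ n * suc s ^ n)) (^-*-distrib (D * s) s c) ⟨
    2 * L * (D * s * s) ^ c * (suc s ^ n * suc s ^ n) ∎

-- At the power s = 16 e the saving 2^n has become 65536^n. The losses are 2^n for the factor (2
-- n)^s, 4^n for (D/m)^(s n) and 32^n from the spanning trees, in total 256^n. The quotient 256^n
-- has the fourth root 4^n, which belongs to the power k = 4 e.
compare-numeric : ∀ x L m D n e s k → s ≡ e * 16 → k ≡ e * 4 → 1 ≤ s → suc s ^ s ≤ 4 * s ^ s → D * s ≤ suc s * m → (2 * n) ^ s ≤ 2 ^ n →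
  x ^ e * 2 ^ n ≤ (n * D ^ n) ^ e → (m ^ n) ^ s ≤ (2 * L) ^ s * 32 ^ n →
  x ^ k * 4 ^ n ≤ L ^ k
compare-numeric x L m D n e s k s≡ refl s≥1 4s Ds≤ n-small upper lower = ^-cancelˡ-≤ 4 (s≤s z≤n) (begin
  (x ^ (e * 4) * 4 ^ n) ^ 4       ≡⟨ trans (^-*-distrib (x ^ (e * 4)) (4 ^ n) 4) (cong₂ _*_ (fourth x) (^-swap 4 n 4)) ⟩
  x ^ s * 256 ^ n                 ≤⟨ cancel-powers (x ^ s) (L ^ s) 256 256 65536 n (s≤s z≤n) (≤-by-computation (256 * 256) 65536 refl) main ⟩
  L ^ s                           ≡⟨ fourth L ⟨
  (L ^ (e * 4)) ^ 4               ∎)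
  where
  open ≤-Reasoning
  fourth : ∀ y → (y ^ (e * 4)) ^ 4 ≡ y ^ s
  fourth y = trans (^-*-assoc y (e * 4) 4) (cong (y ^_) (trans (*-assoc e 4 4) (sym s≡)))
  sixteenth : ∀ y → (y ^ e) ^ 16 ≡ y ^ s
  sixteenth y = trans (^-*-assoc y e 16) (cong (y ^_) (sym s≡))
  D-bound : D ^ s ≤ 4 * m ^ s
  D-bound = *-cancelʳ-≤ (D ^ s) (4 * m ^ s) (s ^ s) {{>-nonZero (pow≥1 s≥1 s)}} (begin
    D ^ s * s ^ s          ≡⟨ ^-*-distrib D s s ⟨
    (D * s) ^ s            ≤⟨ ^-monoˡ-≤ s Ds≤ ⟩
    (suc s * m) ^ s        ≡⟨ ^-*-distrib (suc s) m s ⟩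
    suc s ^ s * m ^ s      ≤⟨ *-monoˡ-≤ (m ^ s) 4s ⟩
    4 * s ^ s * m ^ s      ≡⟨ solve 3 (λ f a b → f :* a :* b := f :* b :* a) refl 4 (s ^ s) (m ^ s) ⟩
    4 * m ^ s * s ^ s      ∎)
  main : x ^ s * 65536 ^ n ≤ L ^ s * 256 ^ n
  main = begin
    x ^ s * 65536 ^ n               ≡⟨ cong₂ _*_ (sixteenth x) (^-swap 2 n 16) ⟨
    (x ^ e) ^ 16 * (2 ^ n) ^ 16     ≡⟨ ^-*-distrib (x ^ e) (2 ^ n) 16 ⟨
    (x ^ e * 2 ^ n) ^ 16            ≤⟨ ^-monoˡ-≤ 16 upper ⟩
    ((n * D ^ n) ^ e) ^ 16          ≡⟨ sixteenth (n * D ^ n) ⟩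
    (n * D ^ n) ^ s                 ≡⟨ trans (^-*-distrib n (D ^ n) s) (cong (n ^ s *_) (^-swap D n s)) ⟩
    n ^ s * (D ^ s) ^ n             ≤⟨ *-monoʳ-≤ (n ^ s) (^-monoˡ-≤ n D-bound) ⟩
    n ^ s * (4 * m ^ s) ^ n         ≡⟨ cong (n ^ s *_) (trans (^-*-distrib 4 (m ^ s) n) (cong (4 ^ n *_) (^-swap m s n))) ⟩
    n ^ s * (4 ^ n * (m ^ n) ^ s)   ≤⟨ *-monoʳ-≤ (n ^ s) (*-monoʳ-≤ (4 ^ n) lower) ⟩
    n ^ s * (4 ^ n * ((2 * L) ^ s * 32 ^ n))
      ≡⟨ cong (λ y → n ^ s * (4 ^ n * (y * 32 ^ n))) (^-*-distrib 2 L s) ⟩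
    n ^ s * (4 ^ n * (2 ^ s * L ^ s * 32 ^ n))
      ≡⟨ solve 5 (λ n f t l u → n :* (f :* (t :* l :* u)) := t :* n :* (l :* (f :* u))) refl (n ^ s) (4 ^ n) (2 ^ s) (L ^ s) (32 ^ n) ⟩
    2 ^ s * n ^ s * (L ^ s * (4 ^ n * 32 ^ n))
      ≡⟨ cong (_* (L ^ s * (4 ^ n * 32 ^ n))) (^-*-distrib 2 n s) ⟨
    (2 * n) ^ s * (L ^ s * (4 ^ n * 32 ^ n))
      ≤⟨ *-monoˡ-≤ (L ^ s * (4 ^ n * 32 ^ n)) n-small ⟩
    2 ^ n * (L ^ s * (4 ^ n * 32 ^ n))
      ≡⟨ solve 4 (λ t l f u → t :* (l :* (f :* u)) := l :* (t :* (f :* u))) refl (2 ^ n) (L ^ s) (4 ^ n) (32 ^ n) ⟩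
    L ^ s * (2 ^ n * (4 ^ n * 32 ^ n))
      ≡⟨ cong (L ^ s *_) (trans (^-*-distrib 2 128 n) (cong (2 ^ n *_) (^-*-distrib 4 32 n))) ⟨
    L ^ s * 256 ^ n ∎

-- Choice of the parameters

≤-double : ∀ {a b} → a + a ≤ b + b → a ≤ b
≤-double h = ≮⇒≥ (λ b<a → <⇒≱ (+-mono-< b<a b<a) h)

-- Here b + 1 plays the part of 10^10, and Δ and m are the rounded degree bounds. Two errors enter
-- the ratio, the tolerance 1/(b + 1) and the rounding relative to d; both are small compared with
-- 1/s.
degree-ratio : ∀ b s d Δ m → 4 * s ≤ b → 4 * s + 4 ≤ d → Δ * suc b ≤ (suc b + 1) * d → b * d ≤ m * suc b + b →
               suc Δ * s ≤ suc s * m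
degree-ratio b s d Δ m 4s≤b 4s≤d Δ≤ ≤m = *-cancelʳ-≤ (suc Δ * s) (suc s * m) (suc b) (+-cancelʳ-≤ (suc s * b) _ _ (begin
  suc Δ * s * suc b + suc s * b
    ≡⟨ solve 4 (λ D s B b → (con 1 :+ D) :* s :* B :+ (con 1 :+ s) :* b := s :* (D :* B) :+ s :* B :+ (con 1 :+ s) :* b) refl Δ s (suc b) b ⟩
  s * (Δ * suc b) + s * suc b + suc s * b
    ≤⟨ +-monoˡ-≤ (suc s * b) (+-monoˡ-≤ (s * suc b) (*-monoʳ-≤ s Δ≤)) ⟩
  s * ((suc b + 1) * d) + s * suc b + suc s * b
    ≡⟨ solve 3 (λ s b d → s :* ((con 1 :+ b :+ con 1) :* d) :+ s :* (con 1 :+ b) :+ (con 1 :+ s) :* b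
         := s :* (b :* d) :+ (con 2 :* s :* d :+ (s :+ con 2 :* s :* b :+ b))) refl s b d ⟩
  s * (b * d) + (2 * s * d + (s + 2 * s * b + b))
    ≤⟨ +-monoʳ-≤ (s * (b * d)) (≤-double error) ⟩
  s * (b * d) + b * d
    ≡⟨ solve 2 (λ s x → s :* x :+ x := (con 1 :+ s) :* x) refl s (b * d) ⟩
  suc s * (b * d)
    ≤⟨ *-monoʳ-≤ (suc s) ≤m ⟩
  suc s * (m * suc b + b)
    ≡⟨ solve 4 (λ S m B b → S :* (m :* B :+ b) := S :* m :* B :+ S :* b) refl (suc s) m (suc b) b ⟩
  suc s * m * suc b + suc s * b ∎))
  where
  open ≤-Reasoning
  s≤b : s ≤ b
  s≤b = ≤-trans (m≤m+n s (3 * s)) 4s≤b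
  error : 2 * s * d + (s + 2 * s * b + b) + (2 * s * d + (s + 2 * s * b + b)) ≤ b * d + b * d
  error = begin
    2 * s * d + (s + 2 * s * b + b) + (2 * s * d + (s + 2 * s * b + b))
      ≡⟨ solve 3 (λ s b d → con 2 :* s :* d :+ (s :+ con 2 :* s :* b :+ b) :+ (con 2 :* s :* d :+ (s :+ con 2 :* s :* b :+ b))
           := con 4 :* s :* d :+ (b :* (con 4 :* s) :+ con 2 :* s :+ con 2 :* b)) refl s b d ⟩
    4 * s * d + (b * (4 * s) + 2 * s + 2 * b)
      -- The inequality has been doubled so that one copy of `b * d` absorbs the tolerance and the
      -- other one the rounding.
      ≤⟨ +-mono-≤ (*-monoˡ-≤ d 4s≤b) (+-monoˡ-≤ (2 * b) (+-monoʳ-≤ (b * (4 * s)) (*-monoʳ-≤ 2 s≤b))) ⟩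
    b * d + (b * (4 * s) + 2 * b + 2 * b)
      ≡⟨ solve 3 (λ s b x → x :+ (b :* (con 4 :* s) :+ con 2 :* b :+ con 2 :* b) := x :+ b :* (con 4 :* s :+ con 4)) refl s b (b * d) ⟩
    b * d + b * (4 * s + 4)
      ≤⟨ +-monoʳ-≤ (b * d) (*-monoʳ-≤ b 4s≤d) ⟩
    b * d + b * d ∎

power-of-2-above : ∀ x → 1 ≤ x → ∃ λ j → x ≤ 2 ^ j × 2 ^ j ≤ 2 * x
power-of-2-above (suc zero)    _ = 0 , ≤-refl , s≤s z≤n
power-of-2-above (suc (suc x)) _ with power-of-2-above (suc x) (s≤s z≤n)
... | j , lo , hi with suc (suc x) ≤? 2 ^ j
...   | yes le = j , le , ≤-trans hi (*-monoʳ-≤ 2 (n≤1+n (suc x)))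
...   | no gt  = suc j
  , ≤-trans (+-mono-≤ (s≤s z≤n) lo) (≤-trans (+-monoˡ-≤ (2 ^ j) (≤-trans (s≤s z≤n) lo)) (+-monoʳ-≤ (2 ^ j) (m≤m+n (2 ^ j) 0)))
  , *-monoʳ-≤ 2 (<⇒≤ (≰⇒> gt))

square≤power : ∀ a k → 3 ≤ k → a * (k * k) ≤ 2 ^ k → ∀ i → a * ((i + k) * (i + k)) ≤ 2 ^ (i + k)
square≤power a k k≥3 base zero    = base
square≤power a k k≥3 base (suc i) = begin
  a * (suc x * suc x)      ≤⟨ *-monoʳ-≤ a (begin
      suc x * suc x          ≡⟨ solve 1 (λ x → (con 1 :+ x) :* (con 1 :+ x) := x :* x :+ (con 2 :* x :+ con 1)) refl x ⟩
      x * x + (2 * x + 1)    ≤⟨ +-monoʳ-≤ (x * x) (+-monoʳ-≤ (2 * x) (≤-trans (s≤s z≤n) x≥3)) ⟩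
      x * x + (2 * x + x)    ≡⟨ solve 1 (λ x → x :* x :+ (con 2 :* x :+ x) := x :* x :+ con 3 :* x) refl x ⟩
      x * x + 3 * x          ≤⟨ +-monoʳ-≤ (x * x) (*-monoˡ-≤ x x≥3) ⟩
      x * x + x * x          ≡⟨ solve 1 (λ y → y :+ y := con 2 :* y) refl (x * x) ⟩
      2 * (x * x)            ∎) ⟩
  a * (2 * (x * x))        ≡⟨ solve 2 (λ a y → a :* (con 2 :* y) := con 2 :* (a :* y)) refl a (x * x) ⟩
  2 * (a * (x * x))        ≤⟨ *-monoʳ-≤ 2 (square≤power a k k≥3 base i) ⟩
  2 * 2 ^ x                ∎
  where
  open ≤-Reasoning
  x = i + k
  x≥3 : 3 ≤ x
  x≥3 = ≤-trans k≥3 (m≤n+m k i)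

linear≤power : ∀ a k → a * suc k ≤ 2 ^ k → ∀ i → a * suc (i + k) ≤ 2 ^ (i + k)
linear≤power a k base zero    = base
linear≤power a k base (suc i) = begin
  a * suc (suc (i + k))       ≤⟨ *-monoʳ-≤ a (+-mono-≤ (s≤s z≤n) (≤-reflexive (sym (+-identityʳ (suc (i + k)))))) ⟩
  a * (2 * suc (i + k))       ≡⟨ solve 2 (λ a y → a :* (con 2 :* y) := con 2 :* (a :* y)) refl a (suc (i + k)) ⟩
  2 * (a * suc (i + k))       ≤⟨ *-monoʳ-≤ 2 (linear≤power a k base i) ⟩
  2 * 2 ^ (i + k)             ∎
  where open ≤-Reasoning

-- With q the quotient of n by s, it suffices that 2 n ≤ 2^q. Since n < s (q + 1), this is a linear
-- function of q against an exponential one, settled from q = k on.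
polynomial≤power : ∀ s k n → 1 ≤ s → 2 * s * suc k ≤ 2 ^ k → k * s ≤ n → (2 * n) ^ s ≤ 2 ^ n
polynomial≤power s k n s≥1 base ks≤n = begin
  (2 * n) ^ s          ≤⟨ ^-monoˡ-≤ s (begin
      2 * n              ≤⟨ *-monoʳ-≤ 2 (<⇒≤ n<) ⟩
      2 * (s * suc q)    ≡⟨ *-assoc 2 s (suc q) ⟨
      2 * s * suc q      ≤⟨ subst (λ t → 2 * s * suc t ≤ 2 ^ t) (m∸n+n≡m k≤q) (linear≤power (2 * s) k base (q ∸ k)) ⟩
      2 ^ q              ∎) ⟩
  (2 ^ q) ^ s          ≡⟨ ^-*-assoc 2 q s ⟩
  2 ^ (q * s)          ≤⟨ ^-monoʳ-≤ 2 (m/n*n≤m n s) ⟩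
  2 ^ n                ∎
  where
  open ≤-Reasoning
  instance
    s≢0 : NonZero s
    s≢0 = >-nonZero s≥1
  q = n / s
  k≤q : k ≤ q
  k≤q = subst (_≤ q) (m*n/n≡m k s) (/-monoˡ-≤ s ks≤n)
  n< : n < s * suc q
  n< = subst₂ _<_ (sym (m≡m%n+[m/n]*n n s)) (*-comm (suc q) s) (+-monoˡ-< (q * s) (m%n<n n s))

-- Copies of the tree as embeddings and as parent functions

module _ (G : Graph n) (D : ℕ) (deg<D : ∀ v → deg G v < D) (T : Graph n)
         {p : Fin n → Fin n} {r : Fin n} (t : RootedTree p r) (T≡p : ∀ {u v} → Adj T u v ⇔ Edge p u v) where

  Copy : Graph n → Set
  Copy H = IsSpanningTree G H × Isomorphic H T

  -- A copy is the image of `T` under the isomorphism that comes with it. One embedding is kept per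
  -- copy, so automorphisms of `T` cause no repetition.
  copies-as-embeddings : (other : ∃ λ v → v ≢ r) → ∀ Hs → Unique Hs → All Copy Hs →
    ∃ λ X → Unique X × length X ≡ length Hs × All (Embedding G D deg<D t other) X
  copies-as-embeddings other Hs u copies with image R inj Hs u (All.map embed copies)
    where
    Em = Embedding G D deg<D t other
    R : Graph n → Vec (Fin n) n → Set
    R H s = Em s × (∀ i j → Adj H (lookup s i) (lookup s j) ⇔ Adj T i j)
    inj : ∀ {H H′ s} → R H s → R H′ s → H ≡ H′
    inj {H} {H′} {s} (em , e) (_ , e′) = graph-ext λ {u} {v} →
      let i , si = Embedding.surjective em u
          j , sj = Embedding.surjective em v
      in subst₂ (λ u v → Adj H u v ⇔ Adj H′ u v) si sj
           (mk⇔ (Equivalence.from (e′ i j) ∘ Equivalence.to (e i j)) (Equivalence.from (e i j) ∘ Equivalence.to (e′ i j)))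
    embed : ∀ {H} → Copy H → ∃ (R H)
    embed {H} ((_ , H⊆G) , σ , iso) = s , record
        { injective  = λ i j e → trans (sym (Inverse.strictlyInverseʳ σ i))
            (trans (cong (Inverse.from σ) (trans (sym (s≡ i)) (trans e (s≡ j)))) (Inverse.strictlyInverseʳ σ j))
        ; surjective = λ w → Inverse.from σ w , trans (s≡ (Inverse.from σ w)) (Inverse.strictlyInverseˡ σ w)
        ; adjacent   = λ v ne → H⊆G _ _ (Equivalence.from (iso′ (p v) v) (Equivalence.from T≡p (ne , inj₂ refl)))
        } , iso′
      where
      s = Vec.tabulate (Inverse.to σ)
      s≡ : ∀ i → lookup s i ≡ Inverse.to σ i
      s≡ = Vecₚ.lookup∘tabulate (Inverse.to σ)
      iso′ : ∀ i j → Adj H (lookup s i) (lookup s j) ⇔ Adj T i j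
      iso′ i j = subst₂ (λ u v → Adj H u v ⇔ Adj T i j) (sym (s≡ i)) (sym (s≡ j)) (iso i j)
  ... | X , uX , len , back = X , uX , len , All.tabulate (λ s∈ → proj₁ (proj₂ (proj₂ (back s∈))))

  -- The parent function of `T` is conjugated by the isomorphism. Its edges are those of the copy,
  -- and its leaves are the images of the leaves of `p`.
  copies-as-parent-maps : ∀ Hs → Unique Hs → All Copy Hs →
    ∃ λ X → Unique X × length X ≡ length Hs × All (ParentMap G D deg<D (# leaf p)) X
  copies-as-parent-maps Hs u copies with image R inj Hs u (All.map parents copies)
    where
    PM = ParentMap G D deg<D (# leaf p)
    R : Graph n → Vec (Fin n) n → Set
    R H f = PM f × (∀ {u v} → Adj H u v ⇔ Edge (lookup f) u v)
    inj : ∀ {H H′ f} → R H f → R H′ f → H ≡ H′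
    inj (_ , e) (_ , e′) = graph-ext (mk⇔ (Equivalence.from e′ ∘ Equivalence.to e) (Equivalence.from e ∘ Equivalence.to e′))
    parents : ∀ {H} → Copy H → ∃ (R H)
    parents {H} ((_ , H⊆G) , σ , iso) = f , record
        { adjacent = λ v ne → H⊆G _ _ (Equivalence.from edges (ne ∘ sym , inj₁ refl))
        ; leaves   = ≤-antisym
            (leaf-transport {p = φ} {p} (Inverse.from σ) from-injective (λ w → to w , from∘to w) conj⁻)
            (leaf-transport {p = p} {φ} to to-injective (λ w → from w , to∘from w) conj)
        } , λ {u} {v} → edges {u} {v}
      where
      to = Inverse.to σ
      from = Inverse.from σ
      to∘from = Inverse.strictlyInverseˡ σ
      from∘to = Inverse.strictlyInverseʳ σ
      to-injective : ∀ {u v} → to u ≡ to v → u ≡ v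
      to-injective {u} {v} e = trans (sym (from∘to u)) (trans (cong from e) (from∘to v))
      from-injective : ∀ {u v} → from u ≡ from v → u ≡ v
      from-injective {u} {v} e = trans (sym (to∘from u)) (trans (cong to e) (to∘from v))
      f = Vec.tabulate (λ w → to (p (from w)))
      φ = lookup f
      φ≡ : ∀ w → φ w ≡ to (p (from w))
      φ≡ = Vecₚ.lookup∘tabulate (λ w → to (p (from w)))
      conj : ∀ v → φ (to v) ≡ to (p v)
      conj v = trans (φ≡ (to v)) (cong (λ z → to (p z)) (from∘to v))
      conj⁻ : ∀ w → p (from w) ≡ from (φ w)
      conj⁻ w = trans (sym (from∘to (p (from w)))) (cong from (sym (φ≡ w)))
      half : ∀ u v → p (from u) ≡ from v ⇔ φ u ≡ v
      half u v = mk⇔ (λ e → from-injective (trans (sym (conj⁻ u)) e)) (λ e → trans (conj⁻ u) (cong from e))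
      edges : ∀ {u v} → Adj H u v ⇔ Edge φ u v
      edges {u} {v} = mk⇔
        (λ a → transfer (Equivalence.to T≡p (Equivalence.to (iso (from u) (from v)) (subst₂ (Adj H) (sym (to∘from u)) (sym (to∘from v)) a))))
        (λ e → subst₂ (Adj H) (to∘from u) (to∘from v) (Equivalence.from (iso (from u) (from v)) (Equivalence.from T≡p (transfer⁻ e))))
        where
        transfer : Edge p (from u) (from v) → Edge φ u v
        transfer (ne , e) = (λ u≡v → ne (cong from u≡v)) , Sum.map (Equivalence.to (half u v)) (Equivalence.to (half v u)) e
        transfer⁻ : Edge φ u v → Edge p (from u) (from v)
        transfer⁻ (ne , e) = (λ e′ → ne (from-injective e′)) , Sum.map (Equivalence.from (half u v)) (Equivalence.from (half v u)) e
  ... | X , uX , len , back = X , uX , len , All.tabulate (λ f∈ → proj₁ (proj₂ (proj₂ (back f∈))))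

  few-copies : (other : ∃ λ v → v ≢ r) → ∀ Hs → Unique Hs → All Copy Hs →
               length Hs ^ 500 * 2 ^ n ≤ (n * D ^ n) ^ 500
  few-copies other Hs u copies with # leaf p * 500 ≤? n
  ... | no many = from-embeddings 500 (<⇒≤ (≰⇒> many)) (copies-as-embeddings other Hs u copies)
    where
    open ≤-Reasoning
    from-embeddings : ∀ e → n ≤ # leaf p * e → (∃ λ X → Unique X × length X ≡ length Hs × All (Embedding G D deg<D t other) X) →
                      length Hs ^ e * 2 ^ n ≤ (n * D ^ n) ^ e
    from-embeddings e n≤ (X , uX , len , ems) = begin
      length Hs ^ e * 2 ^ n                   ≤⟨ *-monoʳ-≤ (length Hs ^ e) (^-monoʳ-≤ 2 n≤) ⟩
      length Hs ^ e * 2 ^ (# leaf p * e)      ≡⟨ cong (length Hs ^ e *_) (^-*-assoc 2 (# leaf p) e) ⟨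
      length Hs ^ e * (2 ^ (# leaf p)) ^ e    ≡⟨ ^-*-distrib (length Hs) (2 ^ (# leaf p)) e ⟨
      (length Hs * 2 ^ (# leaf p)) ^ e        ≤⟨ ^-monoˡ-≤ e (subst (λ k → k * 2 ^ (# leaf p) ≤ n * D ^ n) len (few-embeddings G D deg<D t other X uX ems)) ⟩
      (n * D ^ n) ^ e                         ∎
  ... | yes few = from-parent-maps (copies-as-parent-maps Hs u copies)
    where
    open ≤-Reasoning
    l = # leaf p
    from-parent-maps : (∃ λ X → Unique X × length X ≡ length Hs × All (ParentMap G D deg<D l) X) →
                       length Hs ^ 500 * 2 ^ n ≤ (n * D ^ n) ^ 500
    from-parent-maps (X , uX , len , pms) = ≤-trans
      (few-leaves-numeric (length Hs) D n l P₁ P₂ (#≤n (leaf p)) few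
        (length-partials (closed-neighbours G D deg<D l) D 16 (λ v → subst (_< D) (sym (length-neighbours G v)) (deg<D v)) (*-mono-≤ D≥1 (s≤s z≤n)) l)
        (length-partials {n = n} (const markers) 1 16 (λ _ → ≤-refl) (s≤s z≤n) l)
        (subst (λ k → k * 2 ^ (n ∸ l) ≤ P₁ * P₂ * D ^ (n ∸ l)) len (few-parent-maps G D deg<D l X uX pms)))
      (^-monoˡ-≤ 500 (subst (_≤ n * D ^ n) (*-identityˡ (D ^ n)) (*-monoˡ-≤ (D ^ n) (≤-trans (s≤s z≤n) (Finₚ.toℕ<n r)))))
      where
      P₁ = length (partials (closed-neighbours G D deg<D l) l)
      P₂ = length (partials {n = n} (const markers) l)
      D≥1 : 1 ≤ D
      D≥1 = ≤-trans (s≤s z≤n) (deg<D r)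

-- Assembling the bound

deg≤n : (G : Graph n) → ∀ v → deg G v ≤ n
deg≤n G v = subst (_≤ _) (trans (sym (length-elems (lookup (lookup G v)))) (length-neighbours G v)) (#≤n (lookup (lookup G v)))

another-vertex : (r : Fin n) → 2 ≤ n → ∃ λ v → v ≢ r
another-vertex {suc (suc n)} zero    _ = suc zero , λ ()
another-vertex {suc (suc n)} (suc r) _ = zero , λ ()
another-vertex {suc zero}    r       (s≤s ())

compare-counts : ∀ s k → s ≡ 500 * 16 → k ≡ 500 * 4 → 1 ≤ s → suc s ^ s ≤ 4 * s ^ s → 2 * s * 21 ≤ 2 ^ 20 →
  (G : Graph n) → Fin n → IsSimple G → Connected G →
  ∀ D m j → (∀ v → deg G v < D) → (∀ v → m ≤ deg G v) → D * s ≤ suc s * m → 20 * s ≤ m →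
  1 ≤ j → D * s * s ≤ 2 ^ j → 3 * s * j * (3 * s * j) ≤ m →
  (T : Graph n) → IsTree T →
  ∀ L → (∀ H → IsSpanningTree G H → H ∈ L) →
  ∀ L′ → Unique L′ → (∀ H → H ∈ L′ → IsSpanningTree G H × Isomorphic H T) →
  length L′ ^ k * 4 ^ n ≤ length L ^ k
compare-counts {n} s k s≡ k≡ s≥1 4s base G r simple conn D m j deg<D m≤ Ds≤ 20s≤m j≥1 Ds²≤ K²≤m T isT L complete L′ u sound =
  compare-numeric (length L′) (length L) m D n 500 s k s≡ k≡ s≥1 4s Ds≤
    -- The graph has more vertices than its minimum degree, so 20 s ≤ m also makes n large enough
    -- for 2^n to beat (2 n)^s.
    (polynomial≤power s 20 n s≥1 base (≤-trans 20s≤m m≤n)) upper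
    (many-trees-numeric (length L) m D n c s j P₁ P₂ s≥1 4s Ds²≤ (m/n*n≤m n (s * j))
      (length-partials (neighbours G) D s (λ v → subst (_≤ D) (sym (length-neighbours G v)) (<⇒≤ (deg<D v))) (*-mono-≤ D≥1 s≥1) c)
      (length-partials {n = n} (const markers) 1 s (λ _ → ≤-refl) (subst (1 ≤_) (sym (*-identityˡ s)) s≥1) c)
      (many-spanning-trees G simple conn r m m≤ (≤-trans s≥1 (≤-trans (m≤n*m s 20) 20s≤m)) (3 * s * j) c K²≤m small L complete))
  where
  instance
    sj≢0 : NonZero (s * j)
    sj≢0 = >-nonZero (*-mono-≤ s≥1 j≥1)
  -- With K = 3 s j the 3 n / K cut arcs are n / (s j) in number, which is what `many-trees-numeric`
  -- can afford when an entry costs 2^j.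
  c = n / (s * j)
  P₁ = length (partials (neighbours G) c)
  P₂ = length (partials {n = n} (const markers) c)
  m≤n : m ≤ n
  m≤n = ≤-trans (m≤ r) (deg≤n G r)
  n≥2 : 2 ≤ n
  n≥2 = ≤-trans (≤-trans (*-mono-≤ {2} {20} (s≤s (s≤s z≤n)) s≥1) 20s≤m) m≤n
  D≥1 : 1 ≤ D
  D≥1 = ≤-trans (s≤s z≤n) (deg<D r)
  upper : length L′ ^ 500 * 2 ^ n ≤ (n * D ^ n) ^ 500
  upper = let p , t , T≡p = rooted-tree-of T isT r in
    few-copies G D deg<D T t T≡p (another-vertex r n≥2) L′ u (All.tabulate (λ {H} → sound H))
  small : ∀ x → x * (3 * s * j) ≤ 3 * n → x ≤ c
  small x h = subst (_≤ c) (m*n/n≡m x (s * j)) (/-monoˡ-≤ (s * j) (*-cancelˡ-≤ 3 (subst (_≤ 3 * n)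
    (solve 3 (λ x s j → x :* (con 3 :* s :* j) := con 3 :* (x :* (s :* j))) refl x s j) h)))

degree-bounds : ∀ b d deg → b * d ≤ suc b * deg → suc b * deg ≤ (suc b + 1) * d →
                deg < suc ((suc b + 1) * d / suc b) × b * d / suc b ≤ deg
degree-bounds b d deg lo hi =
    s≤s (subst (_≤ (suc b + 1) * d / suc b) (m*n/n≡m deg (suc b)) (/-monoˡ-≤ (suc b) (subst (_≤ (suc b + 1) * d) (*-comm (suc b) deg) hi)))
  , subst (b * d / suc b ≤_) (m*n/n≡m deg (suc b)) (/-monoˡ-≤ (suc b) (subst (b * d ≤_) (*-comm (suc b) deg) lo))

-- j is about log₂ (D s²), so 3 s j is of the order of log d. As 2^j is at most 4 s² m, the bound on
-- its square follows from 36 s⁴ j² ≤ 2^j, which holds at j = 80 and persists; d ≥ 2^80 forces j ≥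
-- 80.
parameters : ∀ b s → 1 ≤ s → 4 * s ≤ b → 40 * s ≤ 2 ^ 80 → 36 * s ^ 4 * (80 * 80) ≤ 2 ^ 80 → ∀ d → 2 ^ 80 ≤ d →
  let D = suc ((suc b + 1) * d / suc b) ; m = b * d / suc b in
  D * s ≤ suc s * m × 20 * s ≤ m × ∃ λ j → 1 ≤ j × D * s * s ≤ 2 ^ j × 3 * s * j * (3 * s * j) ≤ m
parameters b s s≥1 4s≤b 40s≤ base d d≥ = ratio , 20s≤m , from-power (power-of-2-above (D * s * s) (*-mono-≤ (*-mono-≤ D≥1 s≥1) s≥1))
  where
  open ≤-Reasoning
  Δ = (suc b + 1) * d / suc b
  D = suc Δ
  m = b * d / suc b
  D≥1 : 1 ≤ D
  D≥1 = s≤s z≤n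
  ratio : D * s ≤ suc s * m
  ratio = degree-ratio b s d Δ m 4s≤b (begin
      4 * s + 4        ≤⟨ +-monoʳ-≤ (4 * s) (*-monoʳ-≤ 4 s≥1) ⟩
      4 * s + 4 * s    ≡⟨ solve 1 (λ s → con 4 :* s :+ con 4 :* s := con 8 :* s) refl s ⟩
      8 * s            ≤⟨ *-monoˡ-≤ s (m≤m+n 8 32) ⟩
      40 * s           ≤⟨ 40s≤ ⟩
      2 ^ 80           ≤⟨ d≥ ⟩
      d                ∎)
    (m/n*n≤m ((suc b + 1) * d) (suc b))
    (≤-pred (subst₂ _<_ (sym (m≡m%n+[m/n]*n (b * d) (suc b))) (trans (+-comm (suc b) (m * suc b)) (+-suc (m * suc b) b)) (+-monoˡ-< (m * suc b) (m%n<n (b * d) (suc b)))))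
  d≤D : d ≤ D
  d≤D = ≤-trans (subst (_≤ Δ) (m*n/n≡m d (suc b)) (/-monoˡ-≤ (suc b) (subst (_≤ (suc b + 1) * d) (*-comm (suc b) d)
    (*-monoˡ-≤ d (m≤m+n (suc b) 1))))) (n≤1+n Δ)
  D≤2m : D ≤ 2 * m
  D≤2m = *-cancelʳ-≤ D (2 * m) s {{>-nonZero s≥1}} (begin
    D * s        ≤⟨ ratio ⟩
    suc s * m    ≤⟨ *-monoˡ-≤ m (+-monoˡ-≤ s s≥1) ⟩
    (s + s) * m  ≡⟨ solve 2 (λ s m → (s :+ s) :* m := con 2 :* m :* s) refl s m ⟩
    2 * m * s    ∎)
  20s≤m : 20 * s ≤ m
  20s≤m = *-cancelˡ-≤ 2 (begin
    2 * (20 * s)  ≡⟨ *-assoc 2 20 s ⟨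
    40 * s        ≤⟨ ≤-trans 40s≤ (≤-trans d≥ d≤D) ⟩
    D             ≤⟨ D≤2m ⟩
    2 * m         ∎)
  from-power : (∃ λ j → D * s * s ≤ 2 ^ j × 2 ^ j ≤ 2 * (D * s * s)) → ∃ λ j → 1 ≤ j × D * s * s ≤ 2 ^ j × 3 * s * j * (3 * s * j) ≤ m
  from-power (j , lo , hi) = j , ≤-trans (s≤s z≤n) 80≤j , lo
    , *-cancelʳ-≤ (3 * s * j * (3 * s * j)) m (4 * (s * s)) {{>-nonZero (*-mono-≤ {1} {4} (s≤s z≤n) (*-mono-≤ s≥1 s≥1))}} (begin
        3 * s * j * (3 * s * j) * (4 * (s * s))
          ≡⟨ solve 2 (λ s j → con 3 :* s :* j :* (con 3 :* s :* j) :* (con 4 :* (s :* s)) := con 36 :* (s :* (s :* (s :* (s :* con 1)))) :* (j :* j)) refl s j ⟩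
        36 * s ^ 4 * (j * j)
          ≤⟨ subst (λ k → 36 * s ^ 4 * (k * k) ≤ 2 ^ k) (m∸n+n≡m 80≤j) (square≤power (36 * s ^ 4) 80 (s≤s (s≤s (s≤s z≤n))) base (j ∸ 80)) ⟩
        2 ^ j
          ≤⟨ hi ⟩
        2 * (D * s * s)
          ≤⟨ *-monoʳ-≤ 2 (*-monoˡ-≤ s (*-monoˡ-≤ s D≤2m)) ⟩
        2 * (2 * m * s * s)
          ≡⟨ solve 2 (λ m s → con 2 :* (con 2 :* m :* s :* s) := m :* (con 4 :* (s :* s))) refl m s ⟩
        m * (4 * (s * s)) ∎)
    where
    80≤j : 80 ≤ j
    80≤j = ≮⇒≥ (λ j<80 → <⇒≱ (^-monoʳ-< 2 (s≤s (s≤s z≤n)) j<80) (begin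
      2 ^ 80     ≤⟨ ≤-trans d≥ d≤D ⟩
      D          ≡⟨ trans (*-identityʳ (D * 1)) (*-identityʳ D) ⟨
      D * 1 * 1  ≤⟨ *-mono-≤ (*-monoʳ-≤ D s≥1) s≥1 ⟩
      D * s * s  ≤⟨ lo ⟩
      2 ^ j      ∎))

probBound : ∀ n a b → a ^ 2000 * 4 ^ n ≤ b ^ 2000 → ProbBound n a b
probBound n a b h K = begin
  a ^ 2000 * expScaled n K    ≤⟨ *-monoʳ-≤ (a ^ 2000) (expScaled≤ n K) ⟩
  a ^ 2000 * (4 ^ n * K !)    ≡⟨ *-assoc (a ^ 2000) (4 ^ n) (K !) ⟨
  a ^ 2000 * 4 ^ n * K !      ≤⟨ *-monoˡ-≤ (K !) h ⟩
  b ^ 2000 * K !              ∎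
  where open ≤-Reasoning

-- The coefficients b₁, b₂, b₃ stay variables so that conversion checking never unfolds 10 ^ 10 as a unary numeral.
copies≤trees : ∀ b s k b₁ b₂ b₃ → b₁ ≡ b → b₂ ≡ suc b → b₃ ≡ suc b + 1 → s ≡ 500 * 16 → k ≡ 500 * 4 →
  1 ≤ s → suc s ^ s ≤ 4 * s ^ s → 2 * s * 21 ≤ 2 ^ 20 → 4 * s ≤ b → 40 * s ≤ 2 ^ 80 → 36 * s ^ 4 * (80 * 80) ≤ 2 ^ 80 →
  ∀ d → 2 ^ 80 ≤ d → ∀ n (G : Graph n) → IsSimple G → Connected G →
  (∀ v → b₁ * d ≤ b₂ * deg G v × b₂ * deg G v ≤ b₃ * d) →
  (T : Graph n) → IsTree T →
  (L : List (Graph n)) → (∀ H → H ∈ L ⇔ IsSpanningTree G H) →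
  (L′ : List (Graph n)) → Unique L′ → (∀ H → H ∈ L′ ⇔ (IsSpanningTree G H × Isomorphic H T)) →
  length L′ ^ k * 4 ^ n ≤ length L ^ k
copies≤trees b s k _ _ _ refl refl refl s≡ k≡ s≥1 4s base 4s≤b 40s≤ base′ d d≥ n G simple conn regular T isT L L⇔ L′ u L′⇔ =
  cases n refl
  where
  cases : ∀ n′ → n ≡ n′ → length L′ ^ k * 4 ^ n ≤ length L ^ k
  -- Without a vertex there is no degree to work with, but then 4^n = 1 and it suffices that copies
  -- are spanning trees.
  cases zero    refl = ≤-trans (≤-reflexive (*-identityʳ (length L′ ^ k)))
    (^-monoˡ-≤ k (⊆⇒length≤ u (λ {H} H∈ → Equivalence.from (L⇔ H) (proj₁ (Equivalence.to (L′⇔ H) H∈)))))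
  cases (suc _) eq =
    let ratio , 20s≤m , j , j≥1 , Ds²≤ , K²≤m = parameters b s s≥1 4s≤b 40s≤ base′ d d≥
        bounds = λ v → degree-bounds b d (deg G v) (proj₁ (regular v)) (proj₂ (regular v))
    in compare-counts s k s≡ k≡ s≥1 4s base G (subst Fin (sym eq) zero) simple conn _ _ j
         (proj₁ ∘ bounds) (proj₂ ∘ bounds) ratio 20s≤m j≥1 Ds²≤ K²≤m
         T isT L (λ H → Equivalence.from (L⇔ H)) L′ u (λ H → Equivalence.to (L′⇔ H))

theorem1p5 : Σ ℕ λ d₀ → 0 < d₀ ×
    (∀ (d : ℕ) → d₀ ≤ d →
    ∀ (n : ℕ) (G : Graph n) → IsSimple G → Connected G → NearlyRegular G d →
    (T : Graph n) → IsTree T →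
    (L : List (Graph n)) → Unique L → (∀ H → (H ∈ L) ⇔ IsSpanningTree G H) →
    (L' : List (Graph n)) → Unique L' →
    (∀ H → (H ∈ L') ⇔ (IsSpanningTree G H × Isomorphic H T)) →
    ProbBound n (length L') (length L))
theorem1p5 = 2 ^ 80 , ≤-by-computation 1 (2 ^ 80) refl ,
  λ d d≥ n G simple conn regular T isT L _ L⇔ L′ u L′⇔ → probBound n (length L′) (length L)
    (copies≤trees 9999999999 8000 2000 (10 ^ 10 ∸ 1) (10 ^ 10) (10 ^ 10 + 1) refl refl refl refl refl
      (s≤s z≤n)
      (≤-by-computation (suc 8000 ^ 8000) (4 * 8000 ^ 8000) refl)
      (≤-by-computation (2 * 8000 * 21) (2 ^ 20) refl)
      (≤-by-computation (4 * 8000) 9999999999 refl)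
      (≤-by-computation (40 * 8000) (2 ^ 80) refl)
      (≤-by-computation (36 * 8000 ^ 4 * (80 * 80)) (2 ^ 80) refl)
      d d≥ n G simple conn regular T isT L L⇔ L′ u L′⇔)
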